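{- Let $\alpha$ be a peak composition of $n$. Then the $H_n(0)$-module $\mathbf Q^{r}_\alpha$ is indecomposable.
   Context: $n$ is a positive integer, $\mathfrak S_n$ the symmetric group (product = composition of maps; permutations written as words), $s_i=(i,i+1)$, $\ell(\sigma)$ Coxeter length. $\mathrm{Des}_L(\sigma)=\{i:\ell(s_i\sigma)<\ell(\sigma)\}$, $\mathrm{Des}_R(\sigma)=\{i:\ell(\sigma s_i)<\ell(\sigma)\}$. $\preceq_L$ has covers $\sigma\prec s_i\sigma$, $i\notin\mathrm{Des}_L(\sigma)$; $[\sigma,\rho]_L$ is the interval for $\preceq_L$. For $S\subseteq[n-1]$, $w_1(S)$ is the longest element of $\{z\in\mathfrak S_n:\mathrm{Des}_R(z)\subseteq S\}$. For a composition $\alpha=(\alpha_1,\dots,\alpha_l)$ of $n$, $\ell(\alpha)=l$, $\mathrm{set}(\alpha)=\{\alpha_1,\dots,\alpha_1+\dots+\alpha_{l-1}\}$, $\alpha^r=(\alpha_l,\dots,\alpha_1)$. $\alpha$ is a peak composition if $\alpha_i\ne1$ for $1\le i<\ell(\alpha)$. $H_n(0)$ is the unital associative $\mathbb C$-algebra generated by $\overline\pi_1,\dots,\overline\pi_{n-1}$ with $\overline\pi_i^2=-\overline\pi_i$, $\overline\pi_i\overline\pi_{i+1}\overline\pi_i=\overline\pi_{i+1}\overline\pi_i\overline\pi_{i+1}$, $\overline\pi_i\overline\pi_j=\overline\pi_j\overline\pi_i$ for $|i-j|\ge2$. For a nonempty left weak Bruhat interval $I$, $\overline{\mathsf B}(I)$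 is the left $H_n(0)$-module with basis $I$ and $\overline\pi_i\star\gamma=-\gamma$ if $i\in\mathrm{Des}_L(\gamma)$; $=0$ if $i\notin\mathrm{Des}_L(\gamma)$, $s_i\gamma\notin I$; $=s_i\gamma$ if $i\notin\mathrm{Des}_L(\gamma)$, $s_i\gamma\in I$. The composition diagram of $\alpha$ is left-justified with $\alpha_i$ boxes in the $i$th row from the bottom. $\mathcal T''_\alpha$ is the filling of it having in column $1$, bottom to top, the first $\ell(\alpha)$ odd numbers; in column $2$, bottom to top, the first $\ell(\alpha)-1$ or $\ell(\alpha)$ even numbers (according to whether or not $\alpha_{\ell(\alpha)}=1$); and the remaining numbers of $\{1,\dots,n\}$ placed increasingly, left to right in each row, in the remaining boxes, top row first. $\mathrm w_{LT}$ reads each row left to right, top row first. $\mathbf Q^r_\alpha$ denotes the $H_n(0)$-module $\overline{\mathsf B}([\mathrm w_{LT}(\mathcal T''_\alpha),w_1(\mathrm{set}(\alpha^r))]_L)$ (up to isomorphism); it arises from an $H_n(0)$-module on standard peak immaculate tableaux of shape $\alpha$. -}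

module Defs where

open import Algebra.Bundles using (AbelianGroup; CommutativeRing; Ring)
open import Algebra.Module.Bundles using (LeftModule)
open import Algebra.Module.Construct.DirectProduct using () renaming (leftModule to _⊕_)
import Algebra.Module.Morphism.Structures as Morphism
open import Data.Bool.Base using (Bool; true; false; if_then_else_)
open import Data.Empty using (⊥-elim)
open import Data.Fin.Base as Fin using (Fin; zero; suc; toℕ; inject₁; punchIn)
import Data.Fin.Properties as Finₚ
open import Data.Fin.Permutation as Perm using (Permutation′; _⟨$⟩ʳ_; _⟨$⟩ˡ_; _∘ₚ_; transpose) renaming (_≈_ to _≈ₚ_)
open import Data.Fin.Subset using (Subset; _∈_)
open import Data.Fin.Subset.Properties using (_∈?_)
open import Data.List.Base as List using (List; []; _∷_; _++_; length)
import Data.List.Properties as Listₚ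
import Data.List.Membership.DecPropositional
open import Data.List.Relation.Binary.Permutation.Propositional as ↭ using (_↭_; ↭-trans; ↭-sym; ↭-refl)
import Data.List.Relation.Binary.Permutation.Propositional.Properties as ↭ₚ
open import Data.List.Relation.Unary.All as All using (All; []; _∷_)
import Data.List.Relation.Unary.All.Properties as Allₚ
open import Data.List.Relation.Unary.Any as Any using (Any; here; there)
import Data.List.Relation.Unary.Any.Properties as Anyₚ
open import Data.Nat.Base as ℕ using (ℕ; zero; suc)
open import Data.Nat.ListAction using (sum)
open import Data.Nat.ListAction.Properties using (sum-↭)
import Data.Nat.Properties as ℕₚ
open import Data.List.Extrema ℕₚ.≤-totalOrder using (argmax; argmax-all; f[xs]≤f[argmax])
open import Data.Product.Base using (∃; _×_; _,_; proj₁; proj₂)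
open import Data.Rational as Rat using (ℚ; 0ℚ; 1ℚ; ½)
import Data.Rational.Properties as ℚₚ
open import Data.Sum.Base using (_⊎_; inj₁; inj₂; [_,_]′)
import Data.Vec.Base as Vec
open import Function.Base using (_∘_)
open import Function.Bundles using (mk⇔)
open import Level using (Level; 0ℓ; _⊔_)
open import Relation.Binary.Bundles using (Setoid)
open import Relation.Binary.Definitions using (tri<; tri≈; tri>)
open import Relation.Binary.PropositionalEquality as ≡ using (_≡_; _≢_)
open import Relation.Nullary using (¬_; Dec; yes; no; does)
open import Relation.Nullary.Decidable using (_×-dec_; _→-dec_; map′; ¬?; dec-true; dec-false; does-⇔)

open Data.List.Membership.DecPropositional ℕₚ._≟_ using () renaming (_∈_ to _∈ᴸ_; _∈?_ to _∈ᴸ?_)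

------------------------------------------------------------------------
-- The complex numbers

module RingIdentities {c ℓ} (R : CommutativeRing c ℓ) where
  open CommutativeRing R
  open import Algebra.Properties.Ring ring using (x[y-z]≈xy-xz)
  open import Algebra.Properties.AbelianGroup +-abelianGroup using (⁻¹-∙-comm; ⁻¹-anti-homo‿-)
  open import Algebra.Properties.Group +-group using (//-rightDividesˡ; ⁻¹-involutive)
  open import Algebra.Properties.CommutativeSemigroup +-commutativeSemigroup using (interchange)

  sub-add : ∀ a b → (a - b) + b ≈ a
  sub-add a b = //-rightDividesˡ b a

  telescope : ∀ a b c → (a - b) + (b - c) ≈ a - c
  telescope a b c = trans (sym (+-assoc _ _ _)) (+-congʳ (sub-add a b))

  sub-anti : ∀ a b → a - b ≈ - (b - a)
  sub-anti a b = sym (⁻¹-anti-homo‿- b a)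

  sub-interchange : ∀ a a′ b b′ → (a - a′) + (b - b′) ≈ (a + b) - (a′ + b′)
  sub-interchange a a′ b b′ = trans (interchange _ _ _ _) (+-congˡ (⁻¹-∙-comm a′ b′))

  sub-neg : ∀ a b → b - a ≈ - a - - b
  sub-neg a b = trans (+-comm b (- a)) (+-congˡ (sym (⁻¹-involutive b)))

  sub-mul : ∀ a a′ b b′ → a * (b - b′) + b′ * (a - a′) ≈ a * b - a′ * b′
  sub-mul a a′ b b′ =
    trans (+-cong (x[y-z]≈xy-xz a b b′)
                  (trans (x[y-z]≈xy-xz b′ a a′) (+-cong (*-comm b′ a) (-‿cong (*-comm b′ a′)))))
          (telescope (a * b) (a * b′) (a′ * b′))

module ℚ-id = RingIdentities ℚₚ.+-*-commutativeRing

module Rational where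
  open ≡ using (refl; sym; trans; cong; subst)
  open Rat using (_+_; _*_; _-_; -_; ∣_∣; _<_; 1/_; positive)
  open ℚₚ using (module ≤-Reasoning; positive⁻¹; pos*pos⇒pos; *-distribʳ-+; *-identityˡ;
    *-assoc; *-inverseʳ; pos⇒nonZero; 1/pos⇒pos; ∣-p∣≡∣p∣; ≤-<-trans; ∣p+q∣≤∣p∣+∣q∣; +-mono-<;
    ∣p*q∣≡∣p∣*∣q∣; *-monoʳ-≤-nonNeg; ∣-∣-nonNeg; <⇒≤; *-monoʳ-<-pos; 0≤∣p∣)

  half-pos : ∀ {ε} → 0ℚ < ε → 0ℚ < ½ * ε
  half-pos {ε} 0<ε = positive⁻¹ (½ * ε) ⦃ pos*pos⇒pos ½ ε ⦄
    where instance _ = positive 0<ε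

  halves : ∀ ε → ½ * ε + ½ * ε ≡ ε
  halves ε = trans (sym (*-distribʳ-+ ε ½ ½)) (*-identityˡ ε)

  recip-scale : ∀ {ε b} → 0ℚ < ε → 0ℚ < b → ∃ λ δ → 0ℚ < δ × b * δ ≡ ε
  recip-scale {ε} {b} 0<ε 0<b =
    1/ b * ε , positive⁻¹ (1/ b * ε) ⦃ pos*pos⇒pos (1/ b) ε ⦄ ,
    trans (sym (*-assoc b (1/ b) ε)) (trans (cong (_* ε) (*-inverseʳ b)) (*-identityˡ ε))
    where
    instance
      _ = positive 0<ε
      _ = positive 0<b
      _ = pos⇒nonZero b
      _ = 1/pos⇒pos b

  ∣-∣-sym : ∀ p q → ∣ p - q ∣ ≡ ∣ q - p ∣
  ∣-∣-sym p q = trans (cong ∣_∣ (ℚ-id.sub-anti p q)) (∣-p∣≡∣p∣ (q - p))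

  sum-close : ∀ {p q ε} → ∣ p ∣ < ½ * ε → ∣ q ∣ < ½ * ε → ∣ p + q ∣ < ε
  sum-close {p} {q} {ε} p< q< =
    ≤-<-trans (∣p+q∣≤∣p∣+∣q∣ p q) (subst (∣ p ∣ + ∣ q ∣ <_) (halves ε) (+-mono-< p< q<))

  scaled-close : ∀ {p q b δ} → ∣ p ∣ < b → ∣ q ∣ < δ → ∣ p * q ∣ < b * δ
  scaled-close {p} {q} {b} {δ} p< q< = begin-strict
    ∣ p * q ∣      ≡⟨ ∣p*q∣≡∣p∣*∣q∣ p q ⟩
    ∣ p ∣ * ∣ q ∣  ≤⟨ *-monoʳ-≤-nonNeg ∣ q ∣ ⦃ ∣-∣-nonNeg q ⦄ (<⇒≤ p<) ⟩
    b * ∣ q ∣      <⟨ *-monoʳ-<-pos b q< ⟩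
    b * δ          ∎
    where
    open ≤-Reasoning
    instance _ = positive (≤-<-trans (0≤∣p∣ p) p<)

open Rational

-- Cauchy completion of ℚ: Cauchy sequences, up to null sequences.
record ℝ : Set where
  field
    seq      : ℕ → ℚ
    isCauchy : ∀ ε → 0ℚ Rat.< ε →
               ∃ λ N → ∀ m n → N ℕ.≤ m → N ℕ.≤ n → Rat.∣ seq m Rat.- seq n ∣ Rat.< ε

open ℝ

infix 4 _≈ᴿ_
_≈ᴿ_ : ℝ → ℝ → Set
x ≈ᴿ y = ∀ ε → 0ℚ Rat.< ε →
         ∃ λ N → ∀ n → N ℕ.≤ n → Rat.∣ seq x n Rat.- seq y n ∣ Rat.< ε

module Real where
  open ≡ using (refl; sym; trans; cong; subst)
  open Rat using (_+_; _*_; _-_; -_; ∣_∣; _<_)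

  Eventually : (ℕ → Set) → Set
  Eventually P = ∃ λ N → ∀ n → N ℕ.≤ n → P n

  both : ∀ {P Q : ℕ → Set} → Eventually P → Eventually Q → Eventually (λ n → P n × Q n)
  both (M , p) (N , q) = M ℕ.⊔ N , λ n le →
    p n (ℕₚ.≤-trans (ℕₚ.m≤m⊔n M N) le) , q n (ℕₚ.≤-trans (ℕₚ.m≤n⊔m M N) le)

  pointwise : ∀ {x y} → (∀ n → seq x n ≡ seq y n) → x ≈ᴿ y
  pointwise {x} {y} eq ε 0<ε = 0 , λ n _ →
    subst (_< ε) (sym (trans (cong (λ q → ∣ seq x n - q ∣) (sym (eq n)))
                             (cong ∣_∣ (ℚₚ.+-inverseʳ (seq x n))))) 0<ε

  symᴿ : ∀ {x y} → x ≈ᴿ y → y ≈ᴿ x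
  symᴿ {x} {y} p ε 0<ε =
    let N , f = p ε 0<ε in N , λ n le → subst (_< ε) (∣-∣-sym (seq x n) (seq y n)) (f n le)

  transᴿ : ∀ {x y z} → x ≈ᴿ y → y ≈ᴿ z → x ≈ᴿ z
  transᴿ {x} {y} {z} p q ε 0<ε =
    let N , f = both (p (Rat.½ * ε) (half-pos 0<ε)) (q (Rat.½ * ε) (half-pos 0<ε))
    in N , λ n le → subst (λ t → ∣ t ∣ < ε)
          (ℚ-id.telescope (seq x n) (seq y n) (seq z n))
          (sum-close {seq x n - seq y n} {seq y n - seq z n} {ε} (proj₁ (f n le)) (proj₂ (f n le)))

  constᴿ : ℚ → ℝ
  constᴿ q .seq _ = q
  constᴿ q .isCauchy ε 0<ε = 0 , λ _ _ _ _ → subst (_< ε) (sym (cong ∣_∣ (ℚₚ.+-inverseʳ q))) 0<ε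

  add-close : ∀ {p p′ q q′ ε} → ∣ p - p′ ∣ < Rat.½ * ε → ∣ q - q′ ∣ < Rat.½ * ε →
              ∣ (p + q) - (p′ + q′) ∣ < ε
  add-close {p} {p′} {q} {q′} {ε} a b =
    subst (λ t → ∣ t ∣ < ε)
          (ℚ-id.sub-interchange p p′ q q′)
          (sum-close a b)

  infixl 6 _+ᴿ_
  infixl 7 _*ᴿ_
  infix  8 -ᴿ_

  _+ᴿ_ : ℝ → ℝ → ℝ
  (x +ᴿ y) .seq n = seq x n + seq y n
  (x +ᴿ y) .isCauchy ε 0<ε =
    let M , f = isCauchy x (Rat.½ * ε) (half-pos 0<ε)
        N , g = isCauchy y (Rat.½ * ε) (half-pos 0<ε)
    in M ℕ.⊔ N , λ m n a b → add-close
    {seq x m} {seq x n} {seq y m} {seq y n} {ε}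
    (f m n (ℕₚ.m⊔n≤o⇒m≤o M N a) (ℕₚ.m⊔n≤o⇒m≤o M N b))
    (g m n (ℕₚ.m⊔n≤o⇒n≤o M N a) (ℕₚ.m⊔n≤o⇒n≤o M N b))

  +ᴿ-cong : ∀ {x x′ y y′} → x ≈ᴿ x′ → y ≈ᴿ y′ → x +ᴿ y ≈ᴿ x′ +ᴿ y′
  +ᴿ-cong {x} {x′} {y} {y′} p q ε 0<ε =
    let N , f = both (p (Rat.½ * ε) (half-pos 0<ε)) (q (Rat.½ * ε) (half-pos 0<ε))
    in N , λ n le → add-close {seq x n} {seq x′ n} {seq y n} {seq y′ n} {ε} (proj₁ (f n le)) (proj₂ (f n le))

  neg-close : ∀ p q → ∣ p - q ∣ ≡ ∣ (- p) - (- q) ∣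
  neg-close p q = trans (∣-∣-sym p q)
    (cong ∣_∣ (ℚ-id.sub-neg p q))

  -ᴿ_ : ℝ → ℝ
  (-ᴿ x) .seq n = - seq x n
  (-ᴿ x) .isCauchy ε 0<ε =
    let N , f = isCauchy x ε 0<ε in N , λ m n a b → subst (_< ε) (neg-close (seq x m) (seq x n)) (f m n a b)

  -ᴿ-cong : ∀ {x y} → x ≈ᴿ y → -ᴿ x ≈ᴿ -ᴿ y
  -ᴿ-cong {x} {y} p ε 0<ε =
    let N , f = p ε 0<ε in N , λ n le → subst (_< ε) (neg-close (seq x n) (seq y n)) (f n le)

  bounded : ∀ x → ∃ λ b → 0ℚ < b × ∃ λ N → ∀ n → N ℕ.≤ n → ∣ seq x n ∣ < b
  bounded x with isCauchy x 1ℚ (ℚₚ.positive⁻¹ 1ℚ)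
  ... | N , f = 1ℚ + ∣ seq x N ∣ , bound-pos , N , λ n le → bound n le
    where
    bound : ∀ n → N ℕ.≤ n → ∣ seq x n ∣ < 1ℚ + ∣ seq x N ∣
    bound n le = ℚₚ.≤-<-trans
      (subst (λ t → ∣ t ∣ Rat.≤ ∣ seq x n - seq x N ∣ + ∣ seq x N ∣)
             (ℚ-id.sub-add (seq x n) (seq x N))
             (ℚₚ.∣p+q∣≤∣p∣+∣q∣ (seq x n - seq x N) (seq x N)))
      (ℚₚ.+-monoˡ-< ∣ seq x N ∣ (f n N le ℕₚ.≤-refl))
    bound-pos = ℚₚ.≤-<-trans (ℚₚ.0≤∣p∣ (seq x N)) (bound N ℕₚ.≤-refl)

  mul-close : ∀ {p p′ q q′ b c δ η ε} → ∣ p ∣ < b → ∣ q′ ∣ < c →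
              ∣ q - q′ ∣ < δ → ∣ p - p′ ∣ < η → b * δ ≡ Rat.½ * ε → c * η ≡ Rat.½ * ε →
              ∣ p * q - p′ * q′ ∣ < ε
  mul-close {p} {p′} {q} {q′} {ε = ε} p< q′< dq dp eδ eη =
    subst (λ t → ∣ t ∣ < ε)
      (ℚ-id.sub-mul p p′ q q′)
      (sum-close (subst (∣ p * (q - q′) ∣ <_) eδ (scaled-close p< dq))
                 (subst (∣ q′ * (p - p′) ∣ <_) eη (scaled-close q′< dp)))

  _*ᴿ_ : ℝ → ℝ → ℝ
  (x *ᴿ y) .seq n = seq x n * seq y n
  (x *ᴿ y) .isCauchy ε 0<ε =
    let b , 0<b , B , x< = bounded x
        c , 0<c , C , y< = bounded y
        δ , 0<δ , eδ = recip-scale (half-pos 0<ε) 0<b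
        η , 0<η , eη = recip-scale (half-pos 0<ε) 0<c
        M , f = isCauchy y δ 0<δ
        N , g = isCauchy x η 0<η
        left₁ : ∀ {k} → (B ℕ.⊔ C) ℕ.⊔ (M ℕ.⊔ N) ℕ.≤ k → B ℕ.⊔ C ℕ.≤ k
        left₁ = ℕₚ.m⊔n≤o⇒m≤o (B ℕ.⊔ C) (M ℕ.⊔ N)
        right₁ : ∀ {k} → (B ℕ.⊔ C) ℕ.⊔ (M ℕ.⊔ N) ℕ.≤ k → M ℕ.⊔ N ℕ.≤ k
        right₁ = ℕₚ.m⊔n≤o⇒n≤o (B ℕ.⊔ C) (M ℕ.⊔ N)
    in (B ℕ.⊔ C) ℕ.⊔ (M ℕ.⊔ N) , λ m n m≥ n≥ →
       mul-close {seq x m} {seq x n} {seq y m} {seq y n} {b} {c} {δ} {η} {ε}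
         (x< m (ℕₚ.m⊔n≤o⇒m≤o B C (left₁ m≥))) (y< n (ℕₚ.m⊔n≤o⇒n≤o B C (left₁ n≥)))
         (f m n (ℕₚ.m⊔n≤o⇒m≤o M N (right₁ m≥)) (ℕₚ.m⊔n≤o⇒m≤o M N (right₁ n≥)))
         (g m n (ℕₚ.m⊔n≤o⇒n≤o M N (right₁ m≥)) (ℕₚ.m⊔n≤o⇒n≤o M N (right₁ n≥))) eδ eη

  *ᴿ-cong : ∀ {x x′ y y′} → x ≈ᴿ x′ → y ≈ᴿ y′ → x *ᴿ y ≈ᴿ x′ *ᴿ y′
  *ᴿ-cong {x} {x′} {y} {y′} p q ε 0<ε =
    let b , 0<b , x< = bounded x
        c , 0<c , y< = bounded y′
        δ , 0<δ , eδ = recip-scale (half-pos 0<ε) 0<b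
        η , 0<η , eη = recip-scale (half-pos 0<ε) 0<c
        N , f = both (both x< y<) (both (q δ 0<δ) (p η 0<η))
    in N , λ n n≥ →
       mul-close {seq x n} {seq x′ n} {seq y n} {seq y′ n} {b} {c} {δ} {η} {ε}
         (proj₁ (proj₁ (f n n≥))) (proj₂ (proj₁ (f n n≥)))
         (proj₁ (proj₂ (f n n≥))) (proj₂ (proj₂ (f n n≥))) eδ eη

open Real

ℝ-commutativeRing : CommutativeRing 0ℓ 0ℓ
ℝ-commutativeRing = record
  { Carrier = ℝ
  ; _≈_ = _≈ᴿ_
  ; _+_ = _+ᴿ_
  ; _*_ = _*ᴿ_
  ; -_  = -ᴿ_
  ; 0#  = constᴿ 0ℚ
  ; 1#  = constᴿ 1ℚ
  ; isCommutativeRing = record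
    { isRing = record
      { +-isAbelianGroup = record
        { isGroup = record
          { isMonoid = record
            { isSemigroup = record
              { isMagma = record
                { isEquivalence = record
                  { refl  = λ {x} → pointwise {x} {x} (λ n → ≡.refl)
                  ; sym   = λ {x} {y} → symᴿ {x} {y}
                  ; trans = λ {x} {y} {z} → transᴿ {x} {y} {z} }
                ; ∙-cong = λ {x} {x′} {y} {y′} → +ᴿ-cong {x} {x′} {y} {y′} }
              ; assoc = λ x y z → pointwise {(x +ᴿ y) +ᴿ z} {x +ᴿ (y +ᴿ z)}
                  (λ n → ℚₚ.+-assoc (seq x n) (seq y n) (seq z n)) }
            ; identity = (λ x → pointwise {constᴿ 0ℚ +ᴿ x} {x} (λ n → ℚₚ.+-identityˡ (seq x n)))
                       , (λ x → pointwise {x +ᴿ constᴿ 0ℚ} {x} (λ n → ℚₚ.+-identityʳ (seq x n))) }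
          ; inverse = (λ x → pointwise {(-ᴿ x) +ᴿ x} {constᴿ 0ℚ} (λ n → ℚₚ.+-inverseˡ (seq x n)))
                    , (λ x → pointwise {x +ᴿ (-ᴿ x)} {constᴿ 0ℚ} (λ n → ℚₚ.+-inverseʳ (seq x n)))
          ; ⁻¹-cong = λ {x} {y} → -ᴿ-cong {x} {y} }
        ; comm = λ x y → pointwise {x +ᴿ y} {y +ᴿ x} (λ n → ℚₚ.+-comm (seq x n) (seq y n)) }
      ; *-cong = λ {x} {x′} {y} {y′} → *ᴿ-cong {x} {x′} {y} {y′}
      ; *-assoc = λ x y z → pointwise {(x *ᴿ y) *ᴿ z} {x *ᴿ (y *ᴿ z)}
          (λ n → ℚₚ.*-assoc (seq x n) (seq y n) (seq z n))
      ; *-identity = (λ x → pointwise {constᴿ 1ℚ *ᴿ x} {x} (λ n → ℚₚ.*-identityˡ (seq x n)))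
                   , (λ x → pointwise {x *ᴿ constᴿ 1ℚ} {x} (λ n → ℚₚ.*-identityʳ (seq x n)))
      ; distrib = (λ x y z → pointwise {x *ᴿ (y +ᴿ z)} {x *ᴿ y +ᴿ x *ᴿ z}
                    (λ n → ℚₚ.*-distribˡ-+ (seq x n) (seq y n) (seq z n)))
                , (λ x y z → pointwise {(y +ᴿ z) *ᴿ x} {y *ᴿ x +ᴿ z *ᴿ x}
                    (λ n → ℚₚ.*-distribʳ-+ (seq x n) (seq y n) (seq z n)))
      }
    ; *-comm = λ x y → pointwise {x *ᴿ y} {y *ᴿ x} (λ n → ℚₚ.*-comm (seq x n) (seq y n))
    }
  }

-- The ring R[i], i² = -1; the pair (a , b) stands for a + b i.
module Gaussian {c ℓ} (R : CommutativeRing c ℓ) where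
  open CommutativeRing R
  open import Algebra.Properties.Ring ring using (-1*x≈-x)
  open import Algebra.Solver.Ring.NaturalCoefficients.Default commutativeSemiring
    using (solve; _:=_; _:+_; _:*_; con)

  _≈ᵍ_ : Carrier × Carrier → Carrier × Carrier → Set ℓ
  (a , b) ≈ᵍ (a′ , b′) = a ≈ a′ × b ≈ b′

  _*ᵍ_ : Carrier × Carrier → Carrier × Carrier → Carrier × Carrier
  (a , b) *ᵍ (a′ , b′) = a * a′ - b * b′ , a * b′ + b * a′

  sub : ∀ x y → x - y ≈ x + - 1# * y
  sub x y = +-congˡ (sym (-1*x≈-x y))

  commutativeRing : CommutativeRing c ℓ
  commutativeRing = record
    { Carrier = Carrier × Carrier
    ; _≈_ = _≈ᵍ_
    ; _+_ = λ (a , b) (a′ , b′) → a + a′ , b + b′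
    ; _*_ = _*ᵍ_
    ; -_  = λ (a , b) → - a , - b
    ; 0#  = 0# , 0#
    ; 1#  = 1# , 0#
    ; isCommutativeRing = record
      { isRing = record
        { +-isAbelianGroup = record
          { isGroup = record
            { isMonoid = record
              { isSemigroup = record
                { isMagma = record
                  { isEquivalence = record
                    { refl  = refl , refl
                    ; sym   = λ (p , q) → sym p , sym q
                    ; trans = λ (p , q) (r , s) → trans p r , trans q s }
                  ; ∙-cong = λ (p , q) (r , s) → +-cong p r , +-cong q s }
                ; assoc = λ _ _ _ → +-assoc _ _ _ , +-assoc _ _ _ }
              ; identity = (λ _ → +-identityˡ _ , +-identityˡ _) , (λ _ → +-identityʳ _ , +-identityʳ _) }
            ; inverse = (λ _ → -‿inverseˡ _ , -‿inverseˡ _) , (λ _ → -‿inverseʳ _ , -‿inverseʳ _)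
            ; ⁻¹-cong = λ (p , q) → -‿cong p , -‿cong q }
          ; comm = λ _ _ → +-comm _ _ , +-comm _ _ }
        ; *-cong = λ (p , q) (r , s) →
            +-cong (*-cong p r) (-‿cong (*-cong q s)) , +-cong (*-cong p s) (*-cong q r)
        ; *-assoc = λ (a , b) (a′ , b′) (a″ , b″) →
            trans (trans (+-congʳ (*-congʳ (sub _ _))) (sub _ _))
              (trans (solve 7 (λ j a b a′ b′ a″ b″ →
                        (a :* a′ :+ j :* (b :* b′)) :* a″ :+ j :* ((a :* b′ :+ b :* a′) :* b″)
                          := a :* (a′ :* a″ :+ j :* (b′ :* b″)) :+ j :* (b :* (a′ :* b″ :+ b′ :* a″)))
                        refl (- 1#) a b a′ b′ a″ b″)
                (sym (trans (+-congʳ (*-congˡ (sub _ _))) (sub _ _))))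
          , trans (+-congˡ refl) (trans (+-congʳ (*-congʳ (sub _ _)))
              (trans (solve 7 (λ j a b a′ b′ a″ b″ →
                        (a :* a′ :+ j :* (b :* b′)) :* b″ :+ (a :* b′ :+ b :* a′) :* a″
                          := a :* (a′ :* b″ :+ b′ :* a″) :+ b :* (a′ :* a″ :+ j :* (b′ :* b″)))
                        refl (- 1#) a b a′ b′ a″ b″)
                (sym (+-congˡ (*-congˡ (sub _ _))))))
        ; *-identity =
            (λ (a , b) →
                trans (sub _ _) (solve 3 (λ j a b → con 1 :* a :+ j :* (con 0 :* b) := a) refl (- 1#) a b)
              , solve 2 (λ a b → con 1 :* b :+ con 0 :* a := b) refl a b)
          , (λ (a , b) →
                trans (sub _ _) (solve 3 (λ j a b → a :* con 1 :+ j :* (b :* con 0) := a) refl (- 1#) a b)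
              , solve 2 (λ a b → a :* con 0 :+ b :* con 1 := b) refl a b)
        ; distrib =
            (λ (a , b) (a′ , b′) (a″ , b″) →
                trans (sub _ _) (trans (solve 7 (λ j a b a′ b′ a″ b″ →
                    a :* (a′ :+ a″) :+ j :* (b :* (b′ :+ b″))
                      := (a :* a′ :+ j :* (b :* b′)) :+ (a :* a″ :+ j :* (b :* b″)))
                    refl (- 1#) a b a′ b′ a″ b″)
                  (sym (+-cong (sub _ _) (sub _ _))))
              , solve 6 (λ a b a′ b′ a″ b″ →
                    a :* (b′ :+ b″) :+ b :* (a′ :+ a″) := (a :* b′ :+ b :* a′) :+ (a :* b″ :+ b :* a″))
                    refl a b a′ b′ a″ b″)
          , (λ (a , b) (a′ , b′) (a″ , b″) →
                trans (sub _ _) (trans (solve 7 (λ j a b a′ b′ a″ b″ →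
                    (a′ :+ a″) :* a :+ j :* ((b′ :+ b″) :* b)
                      := (a′ :* a :+ j :* (b′ :* b)) :+ (a″ :* a :+ j :* (b″ :* b)))
                    refl (- 1#) a b a′ b′ a″ b″)
                  (sym (+-cong (sub _ _) (sub _ _))))
              , solve 6 (λ a b a′ b′ a″ b″ →
                    (a′ :+ a″) :* b :+ (b′ :+ b″) :* a := (a′ :* b :+ b′ :* a) :+ (a″ :* b :+ b″ :* a))
                    refl a b a′ b′ a″ b″)
        }
      ; *-comm = λ (a , b) (a′ , b′) →
          +-cong (*-comm a a′) (-‿cong (*-comm b b′))
        , trans (+-comm _ _) (+-cong (*-comm b a′) (*-comm a b′))
      }
    }

ℂ-commutativeRing : CommutativeRing 0ℓ 0ℓ
ℂ-commutativeRing = Gaussian.commutativeRing ℝ-commutativeRing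

------------------------------------------------------------------------
-- The symmetric group 𝔖ₙ
--
-- 𝔖ₙ acts on Fin n, with x : Fin n standing for the letter toℕ x + 1.  From
-- the length function on, n is written suc m, and i : Fin m stands for the
-- index toℕ i + 1 of {1, …, n - 1}.

𝔖 : ℕ → Set
𝔖 = Permutation′

-- Composition of maps: (σ · τ)(x) = σ(τ(x)); _∘ₚ_ is diagrammatic.
infixl 7 _·_
_·_ : ∀ {n} → 𝔖 n → 𝔖 n → 𝔖 n
σ · τ = τ ∘ₚ σ

s : ∀ {m} → Fin m → 𝔖 (suc m)
s i = transpose (inject₁ i) (suc i)

product : ∀ {m} → List (Fin m) → 𝔖 (suc m)
product = List.foldr (λ i σ → s i · σ) Perm.id

IsReducedWord : ∀ {m} → 𝔖 (suc m) → List (Fin m) → Set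
IsReducedWord σ w = product w ≈ₚ σ × (∀ v → product v ≈ₚ σ → length w ℕ.≤ length v)

module Length {m : ℕ} where
  open ≡ using (refl; sym; trans; cong; cong₂; subst)
  open import Algebra.Properties.CommutativeMonoid.Sum ℕₚ.+-0-commutativeMonoid
    using (sum-cong-≗; sum-remove; sum-replicate-zero) renaming (sum to ∑)

  injʳ : ∀ (σ : 𝔖 (suc m)) {x y} → σ ⟨$⟩ʳ x ≡ σ ⟨$⟩ʳ y → x ≡ y
  injʳ σ e = trans (sym (Perm.inverseˡ σ)) (trans (cong (σ ⟨$⟩ˡ_) e) (Perm.inverseˡ σ))

  injˡ : ∀ (σ : 𝔖 (suc m)) {x y} → σ ⟨$⟩ˡ x ≡ σ ⟨$⟩ˡ y → x ≡ y
  injˡ σ e = trans (sym (Perm.inverseʳ σ)) (trans (cong (σ ⟨$⟩ʳ_) e) (Perm.inverseʳ σ))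

  inverse-cong : ∀ {σ τ : 𝔖 (suc m)} → σ ≈ₚ τ → ∀ x → σ ⟨$⟩ˡ x ≡ τ ⟨$⟩ˡ x
  inverse-cong {σ} {τ} e x = injʳ σ (trans (Perm.inverseʳ σ) (sym (trans (e _) (Perm.inverseʳ τ))))

  i₀<i₁ : ∀ (i : Fin m) → inject₁ i Fin.< suc i
  i₀<i₁ i = ℕₚ.≤-reflexive (cong suc (Finₚ.toℕ-inject₁ i))

  s-lo : ∀ (i : Fin m) → s i ⟨$⟩ʳ inject₁ i ≡ suc i
  s-lo i rewrite dec-true (inject₁ i Finₚ.≟ inject₁ i) refl = refl

  s-hi : ∀ (i : Fin m) → s i ⟨$⟩ʳ suc i ≡ inject₁ i
  s-hi i rewrite dec-false (suc i Finₚ.≟ inject₁ i) (λ e → Finₚ.<⇒≢ (i₀<i₁ i) (sym e))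
               | dec-true (suc i Finₚ.≟ suc i) refl = refl

  s-other : ∀ (i : Fin m) {x} → x ≢ inject₁ i → x ≢ suc i → s i ⟨$⟩ʳ x ≡ x
  s-other i {x} ≢lo ≢hi rewrite dec-false (x Finₚ.≟ inject₁ i) ≢lo | dec-false (x Finₚ.≟ suc i) ≢hi = refl

  data View (i : Fin m) (x : Fin (suc m)) : Set where
    lo    : x ≡ inject₁ i → View i x
    hi    : x ≡ suc i → View i x
    other : x ≢ inject₁ i → x ≢ suc i → View i x

  view : ∀ i x → View i x
  view i x with x Finₚ.≟ inject₁ i | x Finₚ.≟ suc i
  ... | yes e | _     = lo e
  ... | no _  | yes e = hi e
  ... | no ≢lo | no ≢hi = other ≢lo ≢hi

  s-invol : ∀ (i : Fin m) x → s i ⟨$⟩ʳ (s i ⟨$⟩ʳ x) ≡ x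
  s-invol i x with view i x
  ... | lo refl = trans (cong (s i ⟨$⟩ʳ_) (s-lo i)) (s-hi i)
  ... | hi refl = trans (cong (s i ⟨$⟩ʳ_) (s-hi i)) (s-lo i)
  ... | other ≢lo ≢hi = trans (cong (s i ⟨$⟩ʳ_) (s-other i ≢lo ≢hi)) (s-other i ≢lo ≢hi)

  s-inv : ∀ (i : Fin m) x → s i ⟨$⟩ˡ x ≡ s i ⟨$⟩ʳ x
  s-inv i x = trans (cong (s i ⟨$⟩ˡ_) (sym (s-invol i x))) (Perm.inverseˡ (s i))

  s-mono : ∀ (i : Fin m) {x y} → x Fin.< y → ¬ (x ≡ inject₁ i × y ≡ suc i) →
           s i ⟨$⟩ʳ x Fin.< s i ⟨$⟩ʳ y
  s-mono i {x} {y} x<y ¬p with view i x | view i y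
  ... | lo refl | lo refl = ⊥-elim (ℕₚ.<-irrefl refl x<y)
  ... | lo refl | hi refl = ⊥-elim (¬p (refl , refl))
  ... | lo refl | other n₁ n₂ = ≡.subst₂ Fin._<_ (sym (s-lo i)) (sym (s-other i n₁ n₂))
    (ℕₚ.≤∧≢⇒< (subst (ℕ._≤ toℕ y) (cong suc (Finₚ.toℕ-inject₁ i)) x<y) (n₂ ∘ sym ∘ Finₚ.toℕ-injective))
  ... | hi refl | lo refl = ⊥-elim (ℕₚ.<-asym x<y (i₀<i₁ i))
  ... | hi refl | hi refl = ⊥-elim (ℕₚ.<-irrefl refl x<y)
  ... | hi refl | other n₁ n₂ = ≡.subst₂ Fin._<_ (sym (s-hi i)) (sym (s-other i n₁ n₂))
    (ℕₚ.<-trans (i₀<i₁ i) x<y)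
  ... | other n₁ n₂ | lo refl = ≡.subst₂ Fin._<_ (sym (s-other i n₁ n₂)) (sym (s-lo i))
    (ℕₚ.<-trans x<y (i₀<i₁ i))
  ... | other n₁ n₂ | hi refl = ≡.subst₂ Fin._<_ (sym (s-other i n₁ n₂)) (sym (s-hi i))
    (ℕₚ.≤∧≢⇒< (subst (toℕ x ℕ.≤_) (sym (Finₚ.toℕ-inject₁ i)) (ℕₚ.≤-pred x<y)) (n₁ ∘ Finₚ.toℕ-injective))
  ... | other n₁ n₂ | other n₃ n₄ = ≡.subst₂ Fin._<_ (sym (s-other i n₁ n₂)) (sym (s-other i n₃ n₄)) x<y

  -- pos₀ σ i and pos₁ σ i: the positions of the letters i and i + 1 in the
  -- word of σ.
  pos₀ pos₁ : 𝔖 (suc m) → Fin m → Fin (suc m)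
  pos₀ σ i = σ ⟨$⟩ˡ inject₁ i
  pos₁ σ i = σ ⟨$⟩ˡ suc i

  Inversion : 𝔖 (suc m) → Fin (suc m) → Fin (suc m) → Set
  Inversion σ a b = a Fin.< b × σ ⟨$⟩ʳ b Fin.< σ ⟨$⟩ʳ a

  inversion? : ∀ σ a b → Dec (Inversion σ a b)
  inversion? σ a b = (a Finₚ.<? b) ×-dec (σ ⟨$⟩ʳ b Finₚ.<? σ ⟨$⟩ʳ a)

  indicator : Bool → ℕ
  indicator b = if b then 1 else 0

  inversions : 𝔖 (suc m) → ℕ
  inversions σ = ∑ λ a → ∑ λ b → indicator (does (inversion? σ a b))

  inversions-cong : ∀ {σ τ} → σ ≈ₚ τ → inversions σ ≡ inversions τ
  inversions-cong {σ} {τ} e = sum-cong-≗ λ a → sum-cong-≗ λ b → cong indicator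
    (does-⇔ (mk⇔ (λ (p , q) → p , ≡.subst₂ Fin._<_ (e b) (e a) q)
                 (λ (p , q) → p , ≡.subst₂ Fin._<_ (sym (e b)) (sym (e a)) q))
            (inversion? σ a b) (inversion? τ a b))

  inversions-id : inversions Perm.id ≡ 0
  inversions-id = trans
    (sum-cong-≗ λ a → trans (sum-cong-≗ λ b →
       cong indicator (dec-false (inversion? Perm.id a b) λ (p , q) → ℕₚ.<-asym p q))
      (sum-replicate-zero (suc m)))
    (sum-replicate-zero (suc m))

  sum-bump : ∀ (f g : Fin (suc m) → ℕ) q → (∀ b → b ≢ q → f b ≡ g b) → f q ≡ suc (g q) →
             ∑ f ≡ suc (∑ g)
  sum-bump f g q same bump = trans (sum-remove {i = q} f)
    (trans (cong₂ ℕ._+_ bump (sum-cong-≗ λ j → same (punchIn q j) (Finₚ.punchInᵢ≢i q j)))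
           (cong suc (sym (sum-remove {i = q} g))))

  inversions-up : ∀ σ i → pos₀ σ i Fin.< pos₁ σ i → inversions (s i · σ) ≡ suc (inversions σ)
  inversions-up σ i p<q = sum-bump _ _ p
    (λ a a≢p → sum-cong-≗ λ b → cong indicator (does-same a b (a≢p ∘ proj₁)))
    (sum-bump _ _ q (λ b b≢q → cong indicator (does-same p b (b≢q ∘ proj₂)))
      (trans (cong indicator (dec-true (inversion? (s i · σ) p q) (p<q , new)))
             (cong (suc ∘ indicator) (sym (dec-false (inversion? σ p q) (λ (_ , r) → old r))))))
    where
    p = pos₀ σ i
    q = pos₁ σ i
    σp : σ ⟨$⟩ʳ p ≡ inject₁ i
    σp = Perm.inverseʳ σ
    σq : σ ⟨$⟩ʳ q ≡ suc i
    σq = Perm.inverseʳ σ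
    new : s i · σ ⟨$⟩ʳ q Fin.< s i · σ ⟨$⟩ʳ p
    new rewrite σp | σq | s-lo i | s-hi i = i₀<i₁ i
    old : ¬ (σ ⟨$⟩ʳ q Fin.< σ ⟨$⟩ʳ p)
    old r rewrite σp | σq = ℕₚ.<-asym r (i₀<i₁ i)
    at : ∀ {x} y → σ ⟨$⟩ʳ x ≡ y → x ≡ σ ⟨$⟩ˡ y
    at y e = trans (sym (Perm.inverseˡ σ)) (cong (σ ⟨$⟩ˡ_) e)
    flip-s : ∀ {x y} → s i ⟨$⟩ʳ x ≡ y → x ≡ s i ⟨$⟩ʳ y
    flip-s {x} e = trans (sym (s-invol i x)) (cong (s i ⟨$⟩ʳ_) e)
    does-same : ∀ a b → ¬ (a ≡ p × b ≡ q) → does (inversion? (s i · σ) a b) ≡ does (inversion? σ a b)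
    does-same a b ≢pq = does-⇔ (mk⇔
      (λ (a<b , r) → a<b , ≡.subst₂ Fin._<_ (s-invol i (σ ⟨$⟩ʳ b)) (s-invol i (σ ⟨$⟩ʳ a)) (s-mono i r λ (e , e′) →
          ≢pq (at _ (trans (flip-s e′) (s-hi i)) , at _ (trans (flip-s e) (s-lo i)))))
      (λ (a<b , r) → a<b , s-mono i r λ (e , e′) →
          ℕₚ.<-asym p<q (≡.subst₂ Fin._<_ (at _ e′) (at _ e) a<b)))
      (inversion? (s i · σ) a b) (inversion? σ a b)

  pos₀-s : ∀ σ i → pos₀ (s i · σ) i ≡ pos₁ σ i
  pos₀-s σ i = cong (σ ⟨$⟩ˡ_) (trans (s-inv i (inject₁ i)) (s-lo i))

  pos₁-s : ∀ σ i → pos₁ (s i · σ) i ≡ pos₀ σ i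
  pos₁-s σ i = cong (σ ⟨$⟩ˡ_) (trans (s-inv i (suc i)) (s-hi i))

  s·s : ∀ i (σ : 𝔖 (suc m)) → s i · (s i · σ) ≈ₚ σ
  s·s i σ x = s-invol i (σ ⟨$⟩ʳ x)

  inversions-down : ∀ σ i → pos₁ σ i Fin.< pos₀ σ i → inversions σ ≡ suc (inversions (s i · σ))
  inversions-down σ i q<p = trans (inversions-cong {σ} {s i · (s i · σ)} (λ x → sym (s·s i σ x)))
    (inversions-up (s i · σ) i (≡.subst₂ Fin._<_ (sym (pos₀-s σ i)) (sym (pos₁-s σ i)) q<p))

  pos-total : ∀ σ i → pos₀ σ i Fin.< pos₁ σ i ⊎ pos₁ σ i Fin.< pos₀ σ i
  pos-total σ i with Finₚ.<-cmp (pos₀ σ i) (pos₁ σ i)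
  ... | tri< p _ _ = inj₁ p
  ... | tri≈ _ e _ = ⊥-elim (Finₚ.<⇒≢ (i₀<i₁ i) (injˡ σ e))
  ... | tri> _ _ p = inj₂ p

  inversions-s≤ : ∀ σ i → inversions (s i · σ) ℕ.≤ suc (inversions σ)
  inversions-s≤ σ i with pos-total σ i
  ... | inj₁ p = ℕₚ.≤-reflexive (inversions-up σ i p)
  ... | inj₂ p = ℕₚ.≤-trans (ℕₚ.n≤1+n _) (ℕₚ.≤-trans (ℕₚ.≤-reflexive (sym (inversions-down σ i p))) (ℕₚ.n≤1+n _))

  inversions-product : ∀ v → inversions (product v) ℕ.≤ length v
  inversions-product [] = ℕₚ.≤-reflexive inversions-id
  inversions-product (i ∷ v) = ℕₚ.≤-trans (inversions-s≤ (product v) i) (ℕ.s≤s (inversions-product v))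

  increasing⇒≥ : ∀ {k} (f : Fin (suc k) → ℕ) → (∀ i → f (inject₁ i) ℕ.< f (suc i)) → ∀ x → toℕ x ℕ.≤ f x
  increasing⇒≥ f inc zero = ℕ.z≤n
  increasing⇒≥ {suc k} f inc (suc x) =
    ℕₚ.≤-<-trans (increasing⇒≥ (f ∘ inject₁) (inc ∘ inject₁) x) (inc x)

  increasing⇒id : ∀ σ → (∀ i → pos₀ σ i Fin.< pos₁ σ i) → Perm.id ≈ₚ σ
  increasing⇒id σ inc y = Finₚ.toℕ-injective (sym (<-rec _ step (toℕ y) y refl))
    where
    open import Data.Nat.Induction using (<-rec)
    σ≤ : ∀ y → toℕ (σ ⟨$⟩ʳ y) ℕ.≤ toℕ y
    σ≤ y = subst (λ z → toℕ (σ ⟨$⟩ʳ y) ℕ.≤ toℕ z) (Perm.inverseˡ σ)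
             (increasing⇒≥ (λ x → toℕ (σ ⟨$⟩ˡ x)) inc (σ ⟨$⟩ʳ y))
    step : ∀ n → (∀ {k} → k ℕ.< n → ∀ y → toℕ y ≡ k → toℕ (σ ⟨$⟩ʳ y) ≡ toℕ y) →
           ∀ y → toℕ y ≡ n → toℕ (σ ⟨$⟩ʳ y) ≡ toℕ y
    step n rec y refl with ℕₚ.m≤n⇒m<n∨m≡n (σ≤ y)
    ... | inj₂ e = e
    ... | inj₁ lt = cong toℕ (injʳ σ (Finₚ.toℕ-injective (rec lt (σ ⟨$⟩ʳ y) refl)))

  wordOfInversions : ∀ k σ → inversions σ ≡ k → ∃ λ w → product w ≈ₚ σ × length w ≡ k
  wordOfInversions k σ e with Finₚ.any? (λ i → pos₁ σ i Finₚ.<? pos₀ σ i)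
  wordOfInversions zero σ e | yes (i , q<p) with () ← trans (sym e) (inversions-down σ i q<p)
  wordOfInversions (suc k) σ e | yes (i , q<p)
    with w , w≈ , len ← wordOfInversions k (s i · σ) (ℕₚ.suc-injective (trans (sym (inversions-down σ i q<p)) e))
    = i ∷ w , (λ x → trans (cong (s i ⟨$⟩ʳ_) (w≈ x)) (s-invol i (σ ⟨$⟩ʳ x))) , cong suc len
  wordOfInversions k σ e | no none = [] , id≈σ , trans (sym inversions-id) (trans (inversions-cong {Perm.id} {σ} id≈σ) e)
    where
    id≈σ : Perm.id ≈ₚ σ
    id≈σ = increasing⇒id σ λ i → [ (λ p → p) , (λ q → ⊥-elim (none (i , q))) ]′ (pos-total σ i)

  reducedWord : ∀ σ → ∃ (IsReducedWord σ)
  reducedWord σ with w , w≈ , len ← wordOfInversions (inversions σ) σ refl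
    = w , w≈ , λ v v≈ → subst (ℕ._≤ length v) (trans (inversions-cong {product v} {σ} v≈) (sym len)) (inversions-product v)

-- Coxeter length: the length of a shortest word in the sᵢ with product σ.
ℓ : ∀ {m} → 𝔖 (suc m) → ℕ
ℓ σ = length (proj₁ (Length.reducedWord σ))

------------------------------------------------------------------------
-- Descents and the left weak order

infix 4 _∈DesL_ _∈DesR_ _⋖_ _≼_
_∈DesL_ _∈DesR_ : ∀ {m} → Fin m → 𝔖 (suc m) → Set
i ∈DesL σ = ℓ (s i · σ) ℕ.< ℓ σ
i ∈DesR σ = ℓ (σ · s i) ℕ.< ℓ σ

_⋖_ : ∀ {m} → 𝔖 (suc m) → 𝔖 (suc m) → Set
σ ⋖ τ = ∃ λ i → ¬ (i ∈DesL σ) × τ ≈ₚ s i · σ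

-- Left weak order: the reflexive-transitive closure of _⋖_, permutations being
-- compared pointwise.
data _≼_ {m} (σ : 𝔖 (suc m)) : 𝔖 (suc m) → Set where
  ≈⇒≼ : ∀ {τ} → σ ≈ₚ τ → σ ≼ τ
  _▻_ : ∀ {τ υ} → σ ≼ τ → τ ⋖ υ → σ ≼ υ

infix 4 _∈[_,_]
_∈[_,_] : ∀ {m} → 𝔖 (suc m) → 𝔖 (suc m) → 𝔖 (suc m) → Set
γ ∈[ σ , ρ ] = σ ≼ γ × γ ≼ ρ

[_,_]ᴸ : ∀ {m} → 𝔖 (suc m) → 𝔖 (suc m) → Setoid 0ℓ 0ℓ
[ σ , ρ ]ᴸ = record
  { Carrier = ∃ (_∈[ σ , ρ ])
  ; _≈_ = λ γ δ → proj₁ γ ≈ₚ proj₁ δ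
  ; isEquivalence = record
    { refl = λ _ → ≡.refl ; sym = λ e x → ≡.sym (e x) ; trans = λ e f x → ≡.trans (e x) (f x) }
  }

module WeakOrder {m : ℕ} where
  open ≡ using (refl; sym; trans; cong; subst)
  open Length {m} public

  ≈ₚ-refl : ∀ {σ : 𝔖 (suc m)} → σ ≈ₚ σ
  ≈ₚ-refl _ = refl

  ≈ₚ-sym : ∀ {σ τ : 𝔖 (suc m)} → σ ≈ₚ τ → τ ≈ₚ σ
  ≈ₚ-sym e x = sym (e x)

  ≈ₚ-trans : ∀ {σ τ υ : 𝔖 (suc m)} → σ ≈ₚ τ → τ ≈ₚ υ → σ ≈ₚ υ
  ≈ₚ-trans e f x = trans (e x) (f x)

  s·-cong : ∀ i {σ τ : 𝔖 (suc m)} → σ ≈ₚ τ → s i · σ ≈ₚ s i · τ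
  s·-cong i e x = cong (s i ⟨$⟩ʳ_) (e x)

  ℓ≡inversions : ∀ (σ : 𝔖 (suc m)) → ℓ σ ≡ inversions σ
  ℓ≡inversions σ =
    let w , w≈ , minimal = reducedWord σ
        v , v≈ , len = wordOfInversions (inversions σ) σ refl
    in ℕₚ.≤-antisym (subst (length w ℕ.≤_) len (minimal v v≈))
         (subst (ℕ._≤ length w) (inversions-cong {product w} {σ} w≈) (inversions-product w))

  ℓ-cong : ∀ {σ τ : 𝔖 (suc m)} → σ ≈ₚ τ → ℓ σ ≡ ℓ τ
  ℓ-cong {σ} {τ} e = trans (ℓ≡inversions σ) (trans (inversions-cong {σ} {τ} e) (sym (ℓ≡inversions τ)))

  ∈DesL⇒pos : ∀ {i} {σ : 𝔖 (suc m)} → i ∈DesL σ → pos₁ σ i Fin.< pos₀ σ i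
  ∈DesL⇒pos {i} {σ} d with pos-total σ i
  ... | inj₂ q = q
  ... | inj₁ p = ⊥-elim (ℕₚ.<-asym d (≡.subst₂ ℕ._<_ (sym (ℓ≡inversions σ)) (sym (ℓ≡inversions (s i · σ)))
                   (ℕₚ.≤-reflexive (sym (inversions-up σ i p)))))

  pos⇒∈DesL : ∀ {i} {σ : 𝔖 (suc m)} → pos₁ σ i Fin.< pos₀ σ i → i ∈DesL σ
  pos⇒∈DesL {i} {σ} p = ≡.subst₂ ℕ._<_ (sym (ℓ≡inversions (s i · σ))) (sym (ℓ≡inversions σ))
    (ℕₚ.≤-reflexive (sym (inversions-down σ i p)))

  pos⇒∉DesL : ∀ {i} {σ : 𝔖 (suc m)} → pos₀ σ i Fin.< pos₁ σ i → ¬ (i ∈DesL σ)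
  pos⇒∉DesL {i} {σ} p d = ℕₚ.<-asym p (∈DesL⇒pos {i} {σ} d)

  ∈DesL-cong : ∀ {i} {σ τ : 𝔖 (suc m)} → σ ≈ₚ τ → i ∈DesL σ → i ∈DesL τ
  ∈DesL-cong {i} {σ} {τ} e = ≡.subst₂ ℕ._<_ (ℓ-cong {s i · σ} {s i · τ} (s·-cong i {σ} {τ} e)) (ℓ-cong {σ} {τ} e)

  infix 4 _∈DesL?_ _≼?_ _∈[_,_]?
  _∈DesL?_ : ∀ i (σ : 𝔖 (suc m)) → Dec (i ∈DesL σ)
  i ∈DesL? σ = ℓ (s i · σ) ℕₚ.<? ℓ σ

  ⋖-s : ∀ {i} {σ : 𝔖 (suc m)} → ¬ (i ∈DesL σ) → σ ⋖ s i · σ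
  ⋖-s {i} n = i , n , λ _ → refl

  ≼-respʳ : ∀ {σ τ υ : 𝔖 (suc m)} → τ ≈ₚ υ → σ ≼ τ → σ ≼ υ
  ≼-respʳ {σ} {τ} {υ} e (≈⇒≼ f) = ≈⇒≼ (≈ₚ-trans {σ} {τ} {υ} f e)
  ≼-respʳ {σ} {τ} {υ} e (_▻_ {τ = δ} p (i , n , f)) =
    p ▻ (i , n , ≈ₚ-trans {υ} {τ} {s i · δ} (≈ₚ-sym {τ} {υ} e) f)

  ≼-cons : ∀ {σ τ υ : 𝔖 (suc m)} → σ ⋖ τ → τ ≼ υ → σ ≼ υ
  ≼-cons {σ} {τ} {υ} (i , n , f) (≈⇒≼ e) =
    ≈⇒≼ (λ _ → refl) ▻ (i , n , ≈ₚ-trans {υ} {τ} {s i · σ} (≈ₚ-sym {τ} {υ} e) f)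
  ≼-cons c (p ▻ d) = ≼-cons c p ▻ d

  ≼-respˡ : ∀ {σ τ υ : 𝔖 (suc m)} → σ ≈ₚ τ → σ ≼ υ → τ ≼ υ
  ≼-respˡ {σ} {τ} {υ} e (≈⇒≼ f) = ≈⇒≼ (≈ₚ-trans {τ} {σ} {υ} (≈ₚ-sym {σ} {τ} e) f)
  ≼-respˡ {σ} {τ} e (p ▻ c) = ≼-respˡ {σ} {τ} e p ▻ c

  ⋖⇒∈DesL : ∀ {i} {τ υ : 𝔖 (suc m)} → ¬ (i ∈DesL τ) → υ ≈ₚ s i · τ → i ∈DesL υ
  ⋖⇒∈DesL {i} {τ} {υ} n e = ∈DesL-cong {i} {s i · τ} {υ} (≈ₚ-sym {υ} {s i · τ} e)
    (pos⇒∈DesL {i} {s i · τ} ([ (λ p → ≡.subst₂ Fin._<_ (sym (pos₁-s τ i)) (sym (pos₀-s τ i)) p)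
                              , (λ q → ⊥-elim (n (pos⇒∈DesL {i} {τ} q))) ]′ (pos-total τ i)))

  -- Recursion on a bound for ℓ υ.
  ≼?-fuel : ∀ k (σ υ : 𝔖 (suc m)) → ℓ υ ℕ.≤ k → Dec (σ ≼ υ)
  ≼?-fuel k σ υ le with Finₚ.all? (λ x → σ ⟨$⟩ʳ x Finₚ.≟ υ ⟨$⟩ʳ x)
  ≼?-fuel k σ υ le | yes e = yes (≈⇒≼ e)
  ≼?-fuel zero σ υ le | no ≢ = no λ
    { (≈⇒≼ e) → ≢ e
    ; (_▻_ {τ} p (i , n , e)) → ℕₚ.n≮0 (ℕₚ.≤-trans (⋖⇒∈DesL {i} {τ} {υ} n e) le) }
  ≼?-fuel (suc k) σ υ le | no ≢ = map′ to from (Finₚ.any? λ i → below? i)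
    where
    below? : ∀ i → Dec (i ∈DesL υ × σ ≼ s i · υ)
    below? i with i ∈DesL? υ
    ... | no n = no (n ∘ proj₁)
    ... | yes d = map′ (d ,_) proj₂ (≼?-fuel k σ (s i · υ) (ℕₚ.≤-pred (ℕₚ.≤-trans d le)))
    to : (∃ λ i → i ∈DesL υ × σ ≼ s i · υ) → σ ≼ υ
    to (i , d , p) = p ▻ (i , up , λ x → sym (s·s i υ x))
      where
      up : ¬ (i ∈DesL s i · υ)
      up = pos⇒∉DesL {i} {s i · υ}
        (≡.subst₂ Fin._<_ (sym (pos₀-s υ i)) (sym (pos₁-s υ i)) (∈DesL⇒pos {i} {υ} d))
    from : σ ≼ υ → ∃ λ i → i ∈DesL υ × σ ≼ s i · υ
    from (≈⇒≼ e) = ⊥-elim (≢ e)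
    from (_▻_ {τ} p (i , n , e)) = i , ⋖⇒∈DesL {i} {τ} {υ} n e ,
      ≼-respʳ {σ} {τ} {s i · υ} (λ x → sym (trans (cong (s i ⟨$⟩ʳ_) (e x)) (s·s i τ x))) p

  _≼?_ : ∀ (σ υ : 𝔖 (suc m)) → Dec (σ ≼ υ)
  σ ≼? υ = ≼?-fuel (ℓ υ) σ υ ℕₚ.≤-refl

  _∈[_,_]? : ∀ γ (σ ρ : 𝔖 (suc m)) → Dec (γ ∈[ σ , ρ ])
  γ ∈[ σ , ρ ]? = (σ ≼? γ) ×-dec (γ ≼? ρ)

open WeakOrder using (_∈DesL?_; _∈[_,_]?)

------------------------------------------------------------------------
-- Modules over the 0-Hecke algebra

-- The free K-module on X: formal linear combinations, modulo the module axioms.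
module FreeModule {c ℓk x ℓx} (K : CommutativeRing c ℓk) (X : Setoid x ℓx) where
  private
    module K = CommutativeRing K
    module X = Setoid X

  infixl 6 _+_
  infixr 7 _⊛_
  infix  8 -_
  infix  4 _≈_

  data Carrier : Set (c ⊔ x) where
    ⟨_⟩ : X.Carrier → Carrier
    0ᶠ  : Carrier
    _+_ : Carrier → Carrier → Carrier
    -_  : Carrier → Carrier
    _⊛_ : K.Carrier → Carrier → Carrier

  data _≈_ : Carrier → Carrier → Set (c ⊔ ℓk ⊔ x ⊔ ℓx) where
    refl   : ∀ {u} → u ≈ u
    sym    : ∀ {u v} → u ≈ v → v ≈ u
    trans  : ∀ {u v w} → u ≈ v → v ≈ w → u ≈ w
    ⟨⟩-cong : ∀ {x y} → x X.≈ y → ⟨ x ⟩ ≈ ⟨ y ⟩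
    +-cong : ∀ {u u′ v v′} → u ≈ u′ → v ≈ v′ → u + v ≈ u′ + v′
    -‿cong : ∀ {u v} → u ≈ v → - u ≈ - v
    ⊛-cong : ∀ {a b u v} → a K.≈ b → u ≈ v → a ⊛ u ≈ b ⊛ v
    +-assoc     : ∀ u v w → (u + v) + w ≈ u + (v + w)
    +-comm      : ∀ u v → u + v ≈ v + u
    +-identityˡ : ∀ u → 0ᶠ + u ≈ u
    -‿inverseˡ  : ∀ u → - u + u ≈ 0ᶠ
    ⊛-distribˡ  : ∀ a u v → a ⊛ (u + v) ≈ a ⊛ u + a ⊛ v
    ⊛-distribʳ  : ∀ a b u → (a K.+ b) ⊛ u ≈ a ⊛ u + b ⊛ u
    ⊛-assoc     : ∀ a b u → (a K.* b) ⊛ u ≈ a ⊛ (b ⊛ u)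
    ⊛-identity  : ∀ u → K.1# ⊛ u ≈ u

  +-identityʳ : ∀ u → u + 0ᶠ ≈ u
  +-identityʳ u = trans (+-comm u 0ᶠ) (+-identityˡ u)

  -‿inverseʳ : ∀ u → u + - u ≈ 0ᶠ
  -‿inverseʳ u = trans (+-comm u (- u)) (-‿inverseˡ u)

  +-abelianGroup : AbelianGroup _ _
  +-abelianGroup = record
    { Carrier = Carrier ; _≈_ = _≈_ ; _∙_ = _+_ ; ε = 0ᶠ ; _⁻¹ = -_
    ; isAbelianGroup = record
      { isGroup = record
        { isMonoid = record
          { isSemigroup = record
            { isMagma = record
              { isEquivalence = record { refl = refl ; sym = sym ; trans = trans } ; ∙-cong = +-cong }
            ; assoc = +-assoc }
          ; identity = +-identityˡ , +-identityʳ }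
        ; inverse = -‿inverseˡ , -‿inverseʳ
        ; ⁻¹-cong = -‿cong }
      ; comm = +-comm } }

  open AbelianGroup +-abelianGroup public using (setoid; isCommutativeMonoid)
  open import Algebra.Properties.Group (AbelianGroup.group +-abelianGroup) public
    using () renaming (inverseˡ-unique to -‿unique; ⁻¹-involutive to neg-neg; ε⁻¹≈ε to -0≈0; identityˡ-unique to 0-unique)
  open import Algebra.Properties.AbelianGroup +-abelianGroup public
    using () renaming (⁻¹-∙-comm to -‿distrib)

  record Linear (F : Carrier → Carrier) : Set (c ⊔ ℓk ⊔ x ⊔ ℓx) where
    field
      F-cong : ∀ {u v} → u ≈ v → F u ≈ F v
      F-+    : ∀ u v → F (u + v) ≈ F u + F v
      F-⊛    : ∀ a u → F (a ⊛ u) ≈ a ⊛ F u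

    F-0 : F 0ᶠ ≈ 0ᶠ
    F-0 = 0-unique (F 0ᶠ) (F 0ᶠ) (trans (sym (F-+ 0ᶠ 0ᶠ)) (F-cong (+-identityˡ 0ᶠ)))

    F-neg : ∀ u → F (- u) ≈ - F u
    F-neg u = -‿unique (F (- u)) (F u) (trans (sym (F-+ (- u) u)) (trans (F-cong (-‿inverseˡ u)) F-0))

  open Linear

  linear-ext : ∀ {F G} → Linear F → Linear G → (∀ x → F ⟨ x ⟩ ≈ G ⟨ x ⟩) → ∀ u → F u ≈ G u
  linear-ext LF LG h ⟨ x ⟩ = h x
  linear-ext LF LG h 0ᶠ = trans (F-0 LF) (sym (F-0 LG))
  linear-ext LF LG h (u + v) = trans (F-+ LF u v)
    (trans (+-cong (linear-ext LF LG h u) (linear-ext LF LG h v)) (sym (F-+ LG u v)))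
  linear-ext LF LG h (- u) = trans (F-neg LF u) (trans (-‿cong (linear-ext LF LG h u)) (sym (F-neg LG u)))
  linear-ext LF LG h (a ⊛ u) = trans (F-⊛ LF a u) (trans (⊛-cong K.refl (linear-ext LF LG h u)) (sym (F-⊛ LG a u)))

  ∘-linear : ∀ {F G} → Linear F → Linear G → Linear (F ∘ G)
  ∘-linear LF LG = record
    { F-cong = F-cong LF ∘ F-cong LG
    ; F-+ = λ u v → trans (F-cong LF (F-+ LG u v)) (F-+ LF _ _)
    ; F-⊛ = λ a u → trans (F-cong LF (F-⊛ LG a u)) (F-⊛ LF a _) }

  ⊛-linear : ∀ a → Linear (a ⊛_)
  ⊛-linear a = record
    { F-cong = ⊛-cong K.refl
    ; F-+ = ⊛-distribˡ a
    ; F-⊛ = λ b u → trans (sym (⊛-assoc a b u)) (trans (⊛-cong (K.*-comm a b) refl) (⊛-assoc b a u)) }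

  +-linear : ∀ {F G} → Linear F → Linear G → Linear (λ u → F u + G u)
  +-linear {F} {G} LF LG = record
    { F-cong = λ e → +-cong (F-cong LF e) (F-cong LG e)
    ; F-+ = λ u v → trans (+-cong (F-+ LF u v) (F-+ LG u v)) (interchange (F u) (F v) (G u) (G v))
    ; F-⊛ = λ a u → trans (+-cong (F-⊛ LF a u) (F-⊛ LG a u)) (sym (⊛-distribˡ a _ _)) }
    where open import Algebra.Properties.CommutativeSemigroup
                        (AbelianGroup.commutativeSemigroup +-abelianGroup) using (interchange)

  neg-linear : ∀ {F} → Linear F → Linear (λ u → - F u)
  neg-linear {F} LF = record
    { F-cong = λ e → -‿cong (F-cong LF e)
    ; F-+ = λ u v → trans (-‿cong (F-+ LF u v)) (sym (-‿distrib _ _))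
    ; F-⊛ = λ a u → trans (-‿cong (F-⊛ LF a u)) (sym (F-neg (⊛-linear a) (F u))) }

  extend : (X.Carrier → Carrier) → Carrier → Carrier
  extend f ⟨ x ⟩   = f x
  extend f 0ᶠ      = 0ᶠ
  extend f (u + v) = extend f u + extend f v
  extend f (- u)   = - extend f u
  extend f (a ⊛ u) = a ⊛ extend f u

  extend-cong : ∀ {f} → (∀ {x y} → x X.≈ y → f x ≈ f y) → ∀ {u v} → u ≈ v → extend f u ≈ extend f v
  extend-cong f-cong refl        = refl
  extend-cong f-cong (sym p)     = sym (extend-cong f-cong p)
  extend-cong f-cong (trans p q) = trans (extend-cong f-cong p) (extend-cong f-cong q)
  extend-cong f-cong (⟨⟩-cong e) = f-cong e
  extend-cong f-cong (+-cong p q) = +-cong (extend-cong f-cong p) (extend-cong f-cong q)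
  extend-cong f-cong (-‿cong p)  = -‿cong (extend-cong f-cong p)
  extend-cong f-cong (⊛-cong e p) = ⊛-cong e (extend-cong f-cong p)
  extend-cong f-cong (+-assoc u v w) = +-assoc _ _ _
  extend-cong f-cong (+-comm u v) = +-comm _ _
  extend-cong f-cong (+-identityˡ u) = +-identityˡ _
  extend-cong f-cong (-‿inverseˡ u) = -‿inverseˡ _
  extend-cong f-cong (⊛-distribˡ a u v) = ⊛-distribˡ a _ _
  extend-cong f-cong (⊛-distribʳ a b u) = ⊛-distribʳ a b _
  extend-cong f-cong (⊛-assoc a b u) = ⊛-assoc a b _
  extend-cong f-cong (⊛-identity u) = ⊛-identity _

  extend-linear : ∀ {f} → (∀ {x y} → x X.≈ y → f x ≈ f y) → Linear (extend f)
  extend-linear f-cong = record { F-cong = extend-cong f-cong ; F-+ = λ _ _ → refl ; F-⊛ = λ _ _ → refl }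

-- The K-algebra with generators π̄ i and the 0-Hecke relations; ι embeds the
-- scalars.
module Hecke {c ℓk} (K : CommutativeRing c ℓk) (m : ℕ) where
  private module K = CommutativeRing K

  infixl 6 _+_
  infixl 7 _*_
  infix  8 -_
  infix  4 _≈_

  data Carrier : Set c where
    ι   : K.Carrier → Carrier
    π̄   : Fin m → Carrier
    _+_ : Carrier → Carrier → Carrier
    _*_ : Carrier → Carrier → Carrier
    -_  : Carrier → Carrier

  data _≈_ : Carrier → Carrier → Set (c ⊔ ℓk) where
    refl   : ∀ {x} → x ≈ x
    sym    : ∀ {x y} → x ≈ y → y ≈ x
    trans  : ∀ {x y z} → x ≈ y → y ≈ z → x ≈ z
    +-cong : ∀ {x x′ y y′} → x ≈ x′ → y ≈ y′ → x + y ≈ x′ + y′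
    *-cong : ∀ {x x′ y y′} → x ≈ x′ → y ≈ y′ → x * y ≈ x′ * y′
    -‿cong : ∀ {x y} → x ≈ y → - x ≈ - y
    +-assoc     : ∀ x y z → (x + y) + z ≈ x + (y + z)
    +-comm      : ∀ x y → x + y ≈ y + x
    +-identityˡ : ∀ x → ι K.0# + x ≈ x
    -‿inverseˡ  : ∀ x → - x + x ≈ ι K.0#
    *-assoc     : ∀ x y z → (x * y) * z ≈ x * (y * z)
    *-identityˡ : ∀ x → ι K.1# * x ≈ x
    *-identityʳ : ∀ x → x * ι K.1# ≈ x
    distribˡ    : ∀ x y z → x * (y + z) ≈ x * y + x * z
    distribʳ    : ∀ x y z → (y + z) * x ≈ y * x + z * x
    ι-cong    : ∀ {a b} → a K.≈ b → ι a ≈ ι b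
    ι-+       : ∀ a b → ι (a K.+ b) ≈ ι a + ι b
    ι-*       : ∀ a b → ι (a K.* b) ≈ ι a * ι b
    ι-central : ∀ a x → ι a * x ≈ x * ι a
    quadratic : ∀ i → π̄ i * π̄ i ≈ - π̄ i
    braid     : ∀ i j → toℕ j ≡ suc (toℕ i) → π̄ i * π̄ j * π̄ i ≈ π̄ j * π̄ i * π̄ j
    commute   : ∀ i j → 2 ℕ.≤ ℕ.∣ toℕ i - toℕ j ∣ → π̄ i * π̄ j ≈ π̄ j * π̄ i

  ring : Ring c (c ⊔ ℓk)
  ring = record
    { Carrier = Carrier ; _≈_ = _≈_ ; _+_ = _+_ ; _*_ = _*_ ; -_ = -_ ; 0# = ι K.0# ; 1# = ι K.1#
    ; isRing = record
      { +-isAbelianGroup = record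
        { isGroup = record
          { isMonoid = record
            { isSemigroup = record
              { isMagma = record
                { isEquivalence = record { refl = refl ; sym = sym ; trans = trans } ; ∙-cong = +-cong }
              ; assoc = +-assoc }
            ; identity = +-identityˡ , λ x → trans (+-comm _ _) (+-identityˡ x) }
          ; inverse = -‿inverseˡ , λ x → trans (+-comm _ _) (-‿inverseˡ x)
          ; ⁻¹-cong = -‿cong }
        ; comm = +-comm }
      ; *-cong = *-cong
      ; *-assoc = *-assoc
      ; *-identity = *-identityˡ , *-identityʳ
      ; distrib = distribˡ , distribʳ } }

-- The action on the free module with basis [ σ , ρ ]ᴸ.
module WeakBruhatModule {c ℓk} (K : CommutativeRing c ℓk) {m : ℕ} (σ ρ : 𝔖 (suc m)) where
  private
    module K = CommutativeRing K
    module H = Hecke K m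
  open FreeModule K [ σ , ρ ]ᴸ
  open WeakOrder {m} hiding (_∈DesL?_; _∈[_,_]?)

  actDec : ∀ i γ → Dec (i ∈DesL proj₁ γ) → Dec (s i · proj₁ γ ∈[ σ , ρ ]) → Carrier
  actDec i γ (yes _) _         = - ⟨ γ ⟩
  actDec i γ (no _)  (no _)    = 0ᶠ
  actDec i γ (no _)  (yes s·γ) = ⟨ s i · proj₁ γ , s·γ ⟩

  act : Fin m → ∃ (_∈[ σ , ρ ]) → Carrier
  act i γ = actDec i γ (i ∈DesL? proj₁ γ) (s i · proj₁ γ ∈[ σ , ρ ]?)

  ∈-cong : ∀ {γ δ} → γ ≈ₚ δ → γ ∈[ σ , ρ ] → δ ∈[ σ , ρ ]
  ∈-cong {γ} {δ} e (p , q) = ≼-respʳ {σ} {γ} {δ} e p , ≼-respˡ {γ} {δ} {ρ} e q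

  actDec-cong : ∀ i {γ δ} → proj₁ γ ≈ₚ proj₁ δ → ∀ d d′ e e′ → actDec i γ d e ≈ actDec i δ d′ e′
  actDec-cong i eq (yes d) (yes d′) e e′ = -‿cong (⟨⟩-cong eq)
  actDec-cong i {γ} {δ} eq (yes d) (no n′) e e′ = ⊥-elim (n′ (∈DesL-cong {i} {proj₁ γ} {proj₁ δ} eq d))
  actDec-cong i {γ} {δ} eq (no n) (yes d′) e e′ =
    ⊥-elim (n (∈DesL-cong {i} {proj₁ δ} {proj₁ γ} (≈ₚ-sym {proj₁ γ} {proj₁ δ} eq) d′))
  actDec-cong i eq (no n) (no n′) (no _) (no _) = refl
  actDec-cong i {γ} {δ} eq (no n) (no n′) (no ∉) (yes ∈) = ⊥-elim (∉
    (∈-cong {s i · proj₁ δ} {s i · proj₁ γ} (s·-cong i {proj₁ δ} {proj₁ γ} (≈ₚ-sym {proj₁ γ} {proj₁ δ} eq)) ∈))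
  actDec-cong i {γ} {δ} eq (no n) (no n′) (yes ∈) (no ∉) = ⊥-elim (∉
    (∈-cong {s i · proj₁ γ} {s i · proj₁ δ} (s·-cong i {proj₁ γ} {proj₁ δ} eq) ∈))
  actDec-cong i {γ} {δ} eq (no n) (no n′) (yes _) (yes _) =
    ⟨⟩-cong (s·-cong i {proj₁ γ} {proj₁ δ} eq)

  T : Fin m → Carrier → Carrier
  T i = extend (act i)

  T-linear : ∀ i → Linear (T i)
  T-linear i = extend-linear λ {γ} {δ} eq → actDec-cong i {γ} {δ} eq _ _ _ _

  open Linear

  -- The basis vector γ, or 0 when γ lies outside the interval
  embed : ∀ γ → Dec (γ ∈[ σ , ρ ]) → Carrier
  embed γ (yes p) = ⟨ γ , p ⟩
  embed γ (no _)  = 0ᶠ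

  ⟦_⟧ : 𝔖 (suc m) → Carrier
  ⟦ γ ⟧ = embed γ (γ ∈[ σ , ρ ]?)

  embed-cong : ∀ {γ δ} → γ ≈ₚ δ → ∀ d e → embed γ d ≈ embed δ e
  embed-cong eq (yes _) (yes _) = ⟨⟩-cong eq
  embed-cong {γ} {δ} eq (yes ∈) (no ∉) = ⊥-elim (∉ (∈-cong {γ} {δ} eq ∈))
  embed-cong {γ} {δ} eq (no ∉) (yes ∈) = ⊥-elim (∉ (∈-cong {δ} {γ} (≈ₚ-sym {γ} {δ} eq) ∈))
  embed-cong eq (no _) (no _) = refl

  ⟦⟧-cong : ∀ {γ δ} → γ ≈ₚ δ → ⟦ γ ⟧ ≈ ⟦ δ ⟧
  ⟦⟧-cong {γ} {δ} eq = embed-cong {γ} {δ} eq _ _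

  ⟨⟩≈⟦⟧ : ∀ γ → ⟨ γ ⟩ ≈ ⟦ proj₁ γ ⟧
  ⟨⟩≈⟦⟧ (γ , p) = embed-cong {γ} {γ} (λ _ → ≡.refl) (yes p) (γ ∈[ σ , ρ ]?)

  T-down : ∀ {i γ} → pos₁ γ i Fin.< pos₀ γ i → T i ⟦ γ ⟧ ≈ - ⟦ γ ⟧
  T-down {i} {γ} lt with γ ∈[ σ , ρ ]?
  ... | no _ = sym -0≈0
  ... | yes p with i ∈DesL? γ
  ...   | yes _ = refl
  ...   | no n = ⊥-elim (n (pos⇒∈DesL {i} {γ} lt))

  T-up : ∀ {i γ} → σ ≼ γ → pos₀ γ i Fin.< pos₁ γ i → T i ⟦ γ ⟧ ≈ ⟦ s i · γ ⟧
  T-up {i} {γ} σ≼γ lt with γ ∈[ σ , ρ ]?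
  T-up {i} {γ} σ≼γ lt | no ∉ with s i · γ ∈[ σ , ρ ]?
  ... | no _ = refl
  ... | yes (_ , p) = ⊥-elim (∉ (σ≼γ , ≼-cons (⋖-s {i} {γ} (pos⇒∉DesL {i} {γ} lt)) p))
  T-up {i} {γ} σ≼γ lt | yes p with i ∈DesL? γ
  ... | yes d = ⊥-elim (pos⇒∉DesL {i} {γ} lt d)
  ... | no n with s i · γ ∈[ σ , ρ ]?
  ...   | no _ = refl
  ...   | yes _ = refl

  ≼-up : ∀ {i γ} → σ ≼ γ → pos₀ γ i Fin.< pos₁ γ i → σ ≼ s i · γ
  ≼-up {i} {γ} σ≼γ lt = σ≼γ ▻ ⋖-s {i} {γ} (pos⇒∉DesL {i} {γ} lt)

  T-quadratic : ∀ i u → T i (T i u) ≈ - T i u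
  T-quadratic i = linear-ext (∘-linear (T-linear i) (T-linear i)) (neg-linear (T-linear i)) λ γ →
    trans (F-cong (T-linear i) (F-cong (T-linear i) (⟨⟩≈⟦⟧ γ)))
      (trans (at (proj₁ γ) (proj₁ (proj₂ γ))) (-‿cong (F-cong (T-linear i) (sym (⟨⟩≈⟦⟧ γ)))))
    where
    cases : ∀ γ → σ ≼ γ → pos₀ γ i Fin.< pos₁ γ i ⊎ pos₁ γ i Fin.< pos₀ γ i → T i (T i ⟦ γ ⟧) ≈ - T i ⟦ γ ⟧
    cases γ σ≼γ (inj₂ q) = trans (F-cong (T-linear i) (T-down {i} {γ} q)) (F-neg (T-linear i) ⟦ γ ⟧)
    cases γ σ≼γ (inj₁ p) = trans (F-cong (T-linear i) (T-up {i} {γ} σ≼γ p))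
      (trans (T-down {i} {s i · γ} (≡.subst₂ Fin._<_ (≡.sym (pos₁-s γ i)) (≡.sym (pos₀-s γ i)) p))
             (-‿cong (sym (T-up {i} {γ} σ≼γ p))))
    at : ∀ γ → σ ≼ γ → T i (T i ⟦ γ ⟧) ≈ - T i ⟦ γ ⟧
    at γ σ≼γ = cases γ σ≼γ (pos-total γ i)

  module Commute (i j : Fin m) (far : 2 ℕ.≤ ℕ.∣ toℕ i - toℕ j ∣) where
    private
      ∣n-1+n∣ : ∀ n → ℕ.∣ n - suc n ∣ ≡ 1
      ∣n-1+n∣ zero    = ≡.refl
      ∣n-1+n∣ (suc n) = ∣n-1+n∣ n

      i≢j : toℕ i ≢ toℕ j
      i≢j e with () ← ≡.subst (2 ℕ.≤_) (≡.trans (≡.cong (ℕ.∣ toℕ i -_∣) (≡.sym e)) (ℕₚ.∣n-n∣≡0 (toℕ i))) far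

      1+i≢j : suc (toℕ i) ≢ toℕ j
      1+i≢j e with ℕ.s≤s () ← ≡.subst (2 ℕ.≤_) (≡.trans (≡.cong (ℕ.∣ toℕ i -_∣) (≡.sym e)) (∣n-1+n∣ (toℕ i))) far

      1+j≢i : suc (toℕ j) ≢ toℕ i
      1+j≢i e with ℕ.s≤s () ← ≡.subst (2 ℕ.≤_) (≡.trans (ℕₚ.∣-∣-comm (toℕ i) (toℕ j))
        (≡.trans (≡.cong (ℕ.∣ toℕ j -_∣) (≡.sym e)) (∣n-1+n∣ (toℕ j)))) far

    fix-lo : s j ⟨$⟩ʳ inject₁ i ≡ inject₁ i
    fix-lo = s-other j (λ e → i≢j (≡.cong toℕ (Finₚ.inject₁-injective e)))
      (λ e → 1+j≢i (≡.trans (≡.sym (≡.cong toℕ e)) (Finₚ.toℕ-inject₁ i)))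

    fix-hi : s j ⟨$⟩ʳ suc i ≡ suc i
    fix-hi = s-other j (λ e → 1+i≢j (≡.trans (≡.cong toℕ e) (Finₚ.toℕ-inject₁ j)))
      (λ e → i≢j (≡.cong toℕ (Finₚ.suc-injective e)))

    pos₀-fix : ∀ γ → pos₀ (s j · γ) i ≡ pos₀ γ i
    pos₀-fix γ = ≡.cong (γ ⟨$⟩ˡ_) (≡.trans (s-inv j (inject₁ i)) fix-lo)

    pos₁-fix : ∀ γ → pos₁ (s j · γ) i ≡ pos₁ γ i
    pos₁-fix γ = ≡.cong (γ ⟨$⟩ˡ_) (≡.trans (s-inv j (suc i)) fix-hi)

    up : ∀ {γ} → pos₀ γ i Fin.< pos₁ γ i → pos₀ (s j · γ) i Fin.< pos₁ (s j · γ) i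
    up {γ} = ≡.subst₂ Fin._<_ (≡.sym (pos₀-fix γ)) (≡.sym (pos₁-fix γ))

    down : ∀ {γ} → pos₁ γ i Fin.< pos₀ γ i → pos₁ (s j · γ) i Fin.< pos₀ (s j · γ) i
    down {γ} = ≡.subst₂ Fin._<_ (≡.sym (pos₁-fix γ)) (≡.sym (pos₀-fix γ))

  T-commute : ∀ i j → 2 ℕ.≤ ℕ.∣ toℕ i - toℕ j ∣ → ∀ u → T i (T j u) ≈ T j (T i u)
  T-commute i j far = linear-ext (∘-linear Li Lj) (∘-linear Lj Li) λ γ →
    trans (F-cong Li (F-cong Lj (⟨⟩≈⟦⟧ γ)))
      (trans (at (proj₁ γ) (proj₁ (proj₂ γ))) (F-cong Lj (F-cong Li (sym (⟨⟩≈⟦⟧ γ)))))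
    where
    Li = T-linear i
    Lj = T-linear j
    module I = Commute i j far
    path : ∀ k l v {a b c} → s l ⟨$⟩ʳ v ≡ a → s k ⟨$⟩ʳ a ≡ b → s k ⟨$⟩ʳ v ≡ c → s l ⟨$⟩ʳ c ≡ b →
           s k ⟨$⟩ʳ (s l ⟨$⟩ʳ v) ≡ s l ⟨$⟩ʳ (s k ⟨$⟩ʳ v)
    path k l v e f g h = ≡.trans (≡.trans (≡.cong (s k ⟨$⟩ʳ_) e) f) (≡.sym (≡.trans (≡.cong (s l ⟨$⟩ʳ_) g) h))
    module J = Commute j i (≡.subst (2 ℕ.≤_) (ℕₚ.∣-∣-comm (toℕ i) (toℕ j)) far)

    on-values : ∀ v → s i ⟨$⟩ʳ (s j ⟨$⟩ʳ v) ≡ s j ⟨$⟩ʳ (s i ⟨$⟩ʳ v)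
    on-values v with view i v | view j v
    ... | lo ≡.refl | _ = path i j (inject₁ i) I.fix-lo (s-lo i) (s-lo i) I.fix-hi
    ... | hi ≡.refl | _ = path i j (suc i) I.fix-hi (s-hi i) (s-hi i) I.fix-lo
    ... | other _ _ | lo ≡.refl = path i j (inject₁ j) (s-lo j) J.fix-hi J.fix-lo (s-lo j)
    ... | other _ _ | hi ≡.refl = path i j (suc j) (s-hi j) J.fix-lo J.fix-hi (s-hi j)
    ... | other a b | other c d = path i j v (s-other j c d) (s-other i a b) (s-other i a b) (s-other j c d)

    perms : ∀ γ → s i · (s j · γ) ≈ₚ s j · (s i · γ)
    perms γ x = on-values (γ ⟨$⟩ʳ x)

    cases : ∀ γ → σ ≼ γ → pos₀ γ i Fin.< pos₁ γ i ⊎ pos₁ γ i Fin.< pos₀ γ i →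
            pos₀ γ j Fin.< pos₁ γ j ⊎ pos₁ γ j Fin.< pos₀ γ j → T i (T j ⟦ γ ⟧) ≈ T j (T i ⟦ γ ⟧)
    cases γ σ≼γ (inj₁ p) (inj₁ q) =
      trans (F-cong Li (T-up {j} {γ} σ≼γ q))
        (trans (T-up {i} {s j · γ} (≼-up {j} {γ} σ≼γ q) (I.up {γ} p))
          (trans (⟦⟧-cong {s i · (s j · γ)} {s j · (s i · γ)} (perms γ))
            (sym (trans (F-cong Lj (T-up {i} {γ} σ≼γ p))
                        (T-up {j} {s i · γ} (≼-up {i} {γ} σ≼γ p) (J.up {γ} q))))))
    cases γ σ≼γ (inj₁ p) (inj₂ q) =
      trans (F-cong Li (T-down {j} {γ} q)) (trans (F-neg Li ⟦ γ ⟧) (trans (-‿cong (T-up {i} {γ} σ≼γ p))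
        (sym (trans (F-cong Lj (T-up {i} {γ} σ≼γ p)) (T-down {j} {s i · γ} (J.down {γ} q))))))
    cases γ σ≼γ (inj₂ p) (inj₁ q) =
      trans (F-cong Li (T-up {j} {γ} σ≼γ q)) (trans (T-down {i} {s j · γ} (I.down {γ} p))
        (sym (trans (F-cong Lj (T-down {i} {γ} p)) (trans (F-neg Lj ⟦ γ ⟧) (-‿cong (T-up {j} {γ} σ≼γ q))))))
    cases γ σ≼γ (inj₂ p) (inj₂ q) =
      trans (F-cong Li (T-down {j} {γ} q)) (trans (F-neg Li ⟦ γ ⟧) (trans (-‿cong (T-down {i} {γ} p))
        (sym (trans (F-cong Lj (T-down {i} {γ} p)) (trans (F-neg Lj ⟦ γ ⟧) (-‿cong (T-down {j} {γ} q)))))))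

    at : ∀ γ → σ ≼ γ → T i (T j ⟦ γ ⟧) ≈ T j (T i ⟦ γ ⟧)
    at γ σ≼γ = cases γ σ≼γ (pos-total γ i) (pos-total γ j)

  T-braid : ∀ i j → toℕ j ≡ suc (toℕ i) → ∀ u → T i (T j (T i u)) ≈ T j (T i (T j u))
  T-braid i j next = linear-ext (∘-linear Li (∘-linear Lj Li)) (∘-linear Lj (∘-linear Li Lj)) λ γ →
    trans (F-cong Li (F-cong Lj (F-cong Li (⟨⟩≈⟦⟧ γ))))
      (trans (at (proj₁ γ) (proj₁ (proj₂ γ))) (F-cong Lj (F-cong Li (F-cong Lj (sym (⟨⟩≈⟦⟧ γ))))))
    where
    Li = T-linear i
    Lj = T-linear j

    hi≡lo : suc i ≡ inject₁ j
    hi≡lo = Finₚ.toℕ-injective (≡.trans (≡.sym next) (≡.sym (Finₚ.toℕ-inject₁ j)))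

    lo≢hi : inject₁ i ≢ suc j
    lo≢hi e = ℕₚ.<⇒≢ (ℕₚ.<-trans (i₀<i₁ i) (≡.subst (Fin._< suc j) (≡.sym hi≡lo) (i₀<i₁ j))) (≡.cong toℕ e)

    lo≢mid : inject₁ i ≢ inject₁ j
    lo≢mid e = Finₚ.<⇒≢ (i₀<i₁ i) (≡.trans e (≡.sym hi≡lo))

    hi≢mid : suc j ≢ suc i
    hi≢mid e = Finₚ.<⇒≢ (i₀<i₁ j) (≡.trans (≡.sym hi≡lo) (≡.sym e))

    si-mid : s i ⟨$⟩ʳ inject₁ j ≡ inject₁ i
    si-mid = ≡.trans (≡.cong (s i ⟨$⟩ʳ_) (≡.sym hi≡lo)) (s-hi i)

    si-lo : s i ⟨$⟩ʳ inject₁ i ≡ inject₁ j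
    si-lo = ≡.trans (s-lo i) hi≡lo

    si-hi : s i ⟨$⟩ʳ suc j ≡ suc j
    si-hi = s-other i (lo≢hi ∘ ≡.sym) hi≢mid

    sj-lo : s j ⟨$⟩ʳ inject₁ i ≡ inject₁ i
    sj-lo = s-other j lo≢mid lo≢hi

    path : ∀ k l v {a b c} → s k ⟨$⟩ʳ v ≡ a → s l ⟨$⟩ʳ a ≡ b → s k ⟨$⟩ʳ b ≡ c →
           s k ⟨$⟩ʳ (s l ⟨$⟩ʳ (s k ⟨$⟩ʳ v)) ≡ c
    path k l v e f g = ≡.trans (≡.cong (s k ⟨$⟩ʳ_) (≡.trans (≡.cong (s l ⟨$⟩ʳ_) e) f)) g

    on-values : ∀ v → s i ⟨$⟩ʳ (s j ⟨$⟩ʳ (s i ⟨$⟩ʳ v)) ≡ s j ⟨$⟩ʳ (s i ⟨$⟩ʳ (s j ⟨$⟩ʳ v))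
    on-values v with view i v | view j v
    ... | lo ≡.refl | _ = ≡.trans (path i j (inject₁ i) si-lo (s-lo j) si-hi) (≡.sym (path j i (inject₁ i) sj-lo si-lo (s-lo j)))
    ... | hi ≡.refl | _ = ≡.trans (path i j (suc i) (s-hi i) sj-lo (s-lo i))
      (≡.sym (path j i (suc i) (≡.trans (≡.cong (s j ⟨$⟩ʳ_) hi≡lo) (s-lo j)) si-hi (≡.trans (s-hi j) (≡.sym hi≡lo))))
    ... | other _ b | lo e = ⊥-elim (b (≡.trans e (≡.sym hi≡lo)))
    ... | other _ _ | hi ≡.refl = ≡.trans (path i j (suc j) si-hi (s-hi j) si-mid) (≡.sym (path j i (suc j) (s-hi j) si-mid sj-lo))
    ... | other a b | other c d = ≡.trans (path i j v (s-other i a b) (s-other j c d) (s-other i a b))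
      (≡.sym (path j i v (s-other j c d) (s-other i a b) (s-other j c d)))

    perms : ∀ γ → s i · (s j · (s i · γ)) ≈ₚ s j · (s i · (s j · γ))
    perms γ x = on-values (γ ⟨$⟩ʳ x)

    -- x, y, z are the positions of the letters i, i + 1, i + 2 in the word of γ.
    record Pos (γ : 𝔖 (suc m)) (x y z : Fin (suc m)) : Set where
      constructor pos
      field
        px : γ ⟨$⟩ˡ inject₁ i ≡ x
        py : γ ⟨$⟩ˡ inject₁ j ≡ y
        pz : γ ⟨$⟩ˡ suc j ≡ z

    open Pos

    pos-i : ∀ {γ x y z} → Pos γ x y z → Pos (s i · γ) y x z
    pos-i {γ} p .px = ≡.trans (≡.cong (γ ⟨$⟩ˡ_) (≡.trans (s-inv i (inject₁ i)) si-lo)) (py p)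
    pos-i {γ} p .py = ≡.trans (≡.cong (γ ⟨$⟩ˡ_) (≡.trans (s-inv i (inject₁ j)) si-mid)) (px p)
    pos-i {γ} p .pz = ≡.trans (≡.cong (γ ⟨$⟩ˡ_) (≡.trans (s-inv i (suc j)) si-hi)) (pz p)

    pos-j : ∀ {γ x y z} → Pos γ x y z → Pos (s j · γ) x z y
    pos-j {γ} p .px = ≡.trans (≡.cong (γ ⟨$⟩ˡ_) (≡.trans (s-inv j (inject₁ i)) sj-lo)) (px p)
    pos-j {γ} p .py = ≡.trans (≡.cong (γ ⟨$⟩ˡ_) (≡.trans (s-inv j (inject₁ j)) (s-lo j))) (pz p)
    pos-j {γ} p .pz = ≡.trans (≡.cong (γ ⟨$⟩ˡ_) (≡.trans (s-inv j (suc j)) (s-hi j))) (py p)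

    mid : ∀ {γ x y z} → Pos γ x y z → pos₁ γ i ≡ y
    mid {γ} p = ≡.trans (≡.cong (γ ⟨$⟩ˡ_) hi≡lo) (py p)

    up-i : ∀ {γ x y z} → Pos γ x y z → x Fin.< y → pos₀ γ i Fin.< pos₁ γ i
    up-i p = ≡.subst₂ Fin._<_ (≡.sym (px p)) (≡.sym (mid p))

    dn-i : ∀ {γ x y z} → Pos γ x y z → y Fin.< x → pos₁ γ i Fin.< pos₀ γ i
    dn-i p = ≡.subst₂ Fin._<_ (≡.sym (mid p)) (≡.sym (px p))

    up-j : ∀ {γ x y z} → Pos γ x y z → y Fin.< z → pos₀ γ j Fin.< pos₁ γ j
    up-j p = ≡.subst₂ Fin._<_ (≡.sym (py p)) (≡.sym (pz p))

    dn-j : ∀ {γ x y z} → Pos γ x y z → z Fin.< y → pos₁ γ j Fin.< pos₀ γ j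
    dn-j p = ≡.subst₂ Fin._<_ (≡.sym (pz p)) (≡.sym (py p))

    module _ (γ : 𝔖 (suc m)) (σ≼γ : σ ≼ γ) where
      γi  = s i · γ
      γj  = s j · γ
      γji = s j · γi
      γij = s i · γj

      pγ : Pos γ (pos₀ γ i) (pos₀ γ j) (pos₁ γ j)
      pγ = pos ≡.refl ≡.refl ≡.refl

      lo-hi : pos₀ γ i Fin.< pos₁ γ j ⊎ pos₁ γ j Fin.< pos₀ γ i
      lo-hi with ℕₚ.<-cmp (toℕ (pos₀ γ i)) (toℕ (pos₁ γ j))
      ... | tri< p _ _ = inj₁ p
      ... | tri≈ _ e _ = ⊥-elim (lo≢hi (injˡ γ (Finₚ.toℕ-injective e)))
      ... | tri> _ _ p = inj₂ p

      Ti-dn : ∀ δ {x y z} → Pos δ x y z → y Fin.< x → ∀ {u} → u ≈ ⟦ δ ⟧ → T i u ≈ - ⟦ δ ⟧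
      Ti-dn δ p lt e = trans (F-cong Li e) (T-down {i} {δ} (dn-i p lt))

      Tj-dn : ∀ δ {x y z} → Pos δ x y z → z Fin.< y → ∀ {u} → u ≈ ⟦ δ ⟧ → T j u ≈ - ⟦ δ ⟧
      Tj-dn δ p lt e = trans (F-cong Lj e) (T-down {j} {δ} (dn-j p lt))

      Ti-dn⁻ : ∀ δ {x y z} → Pos δ x y z → y Fin.< x → ∀ {u} → u ≈ - ⟦ δ ⟧ → T i u ≈ ⟦ δ ⟧
      Ti-dn⁻ δ p lt e = trans (F-cong Li e) (trans (F-neg Li ⟦ δ ⟧) (trans (-‿cong (T-down {i} {δ} (dn-i p lt))) (neg-neg ⟦ δ ⟧)))

      Tj-dn⁻ : ∀ δ {x y z} → Pos δ x y z → z Fin.< y → ∀ {u} → u ≈ - ⟦ δ ⟧ → T j u ≈ ⟦ δ ⟧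
      Tj-dn⁻ δ p lt e = trans (F-cong Lj e) (trans (F-neg Lj ⟦ δ ⟧) (trans (-‿cong (T-down {j} {δ} (dn-j p lt))) (neg-neg ⟦ δ ⟧)))

      Ti-up : ∀ δ {x y z} → σ ≼ δ → Pos δ x y z → x Fin.< y → ∀ {u} → u ≈ ⟦ δ ⟧ → T i u ≈ ⟦ s i · δ ⟧
      Ti-up δ b p lt e = trans (F-cong Li e) (T-up {i} {δ} b (up-i p lt))

      Tj-up : ∀ δ {x y z} → σ ≼ δ → Pos δ x y z → y Fin.< z → ∀ {u} → u ≈ ⟦ δ ⟧ → T j u ≈ ⟦ s j · δ ⟧
      Tj-up δ b p lt e = trans (F-cong Lj e) (T-up {j} {δ} b (up-j p lt))

      Ti-up⁻ : ∀ δ {x y z} → σ ≼ δ → Pos δ x y z → x Fin.< y → ∀ {u} → u ≈ - ⟦ δ ⟧ → T i u ≈ - ⟦ s i · δ ⟧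
      Ti-up⁻ δ b p lt e = trans (F-cong Li e) (trans (F-neg Li ⟦ δ ⟧) (-‿cong (T-up {i} {δ} b (up-i p lt))))

      Tj-up⁻ : ∀ δ {x y z} → σ ≼ δ → Pos δ x y z → y Fin.< z → ∀ {u} → u ≈ - ⟦ δ ⟧ → T j u ≈ - ⟦ s j · δ ⟧
      Tj-up⁻ δ b p lt e = trans (F-cong Lj e) (trans (F-neg Lj ⟦ δ ⟧) (-‿cong (T-up {j} {δ} b (up-j p lt))))

      pi  = pos-i pγ
      pj  = pos-j pγ
      pji = pos-j pi
      pij = pos-i pj

      cases : pos₀ γ i Fin.< pos₁ γ i ⊎ pos₁ γ i Fin.< pos₀ γ i →
              pos₀ γ j Fin.< pos₁ γ j ⊎ pos₁ γ j Fin.< pos₀ γ j →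
              pos₀ γ i Fin.< pos₁ γ j ⊎ pos₁ γ j Fin.< pos₀ γ i →
              T i (T j (T i ⟦ γ ⟧)) ≈ T j (T i (T j ⟦ γ ⟧))
      cases (inj₁ x<y′) (inj₁ y<z) _ = trans
          (Ti-up γji (≼-up {j} {γi} σ≼γi (up-j pi x<z)) pji y<z (Tj-up γi σ≼γi pi x<z (Ti-up γ σ≼γ pγ x<y refl)))
          (trans (⟦⟧-cong {s i · γji} {s j · γij} (perms γ))
            (sym (Tj-up γij (≼-up {i} {γj} σ≼γj (up-i pj x<z)) pij x<y (Ti-up γj σ≼γj pj x<z (Tj-up γ σ≼γ pγ y<z refl)))))
        where
        x<y = ≡.subst (pos₀ γ i Fin.<_) (mid pγ) x<y′
        x<z = ℕₚ.<-trans x<y y<z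
        σ≼γi = ≼-up {i} {γ} σ≼γ x<y′
        σ≼γj = ≼-up {j} {γ} σ≼γ y<z
      cases (inj₂ y<x′) (inj₁ y<z) (inj₁ x<z) = trans
          (Ti-up⁻ γj σ≼γj pj x<z (Tj-up⁻ γ σ≼γ pγ y<z (Ti-dn γ pγ y<x refl)))
          (sym (Tj-dn γij pij y<x (Ti-up γj σ≼γj pj x<z (Tj-up γ σ≼γ pγ y<z refl))))
        where
        y<x = ≡.subst (Fin._< pos₀ γ i) (mid pγ) y<x′
        σ≼γj = ≼-up {j} {γ} σ≼γ y<z
      cases (inj₂ y<x′) (inj₁ y<z) (inj₂ z<x) = trans
          (Ti-dn⁻ γj pj z<x (Tj-up⁻ γ σ≼γ pγ y<z (Ti-dn γ pγ y<x refl)))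
          (sym (Tj-dn⁻ γj pj y<z (Ti-dn γj pj z<x (Tj-up γ σ≼γ pγ y<z refl))))
        where
        y<x = ≡.subst (Fin._< pos₀ γ i) (mid pγ) y<x′
      cases (inj₁ x<y′) (inj₂ z<y) (inj₁ x<z) = trans
          (Ti-dn γji pji z<y (Tj-up γi σ≼γi pi x<z (Ti-up γ σ≼γ pγ x<y refl)))
          (sym (Tj-up⁻ γi σ≼γi pi x<z (Ti-up⁻ γ σ≼γ pγ x<y (Tj-dn γ pγ z<y refl))))
        where
        x<y = ≡.subst (pos₀ γ i Fin.<_) (mid pγ) x<y′
        σ≼γi = ≼-up {i} {γ} σ≼γ x<y′
      cases (inj₁ x<y′) (inj₂ z<y) (inj₂ z<x) = trans
          (Ti-dn⁻ γi pi x<y (Tj-dn γi pi z<x (Ti-up γ σ≼γ pγ x<y refl)))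
          (sym (Tj-dn⁻ γi pi z<x (Ti-up⁻ γ σ≼γ pγ x<y (Tj-dn γ pγ z<y refl))))
        where
        x<y = ≡.subst (pos₀ γ i Fin.<_) (mid pγ) x<y′
      cases (inj₂ y<x′) (inj₂ z<y) _ = trans
          (Ti-dn γ pγ y<x (Tj-dn⁻ γ pγ z<y (Ti-dn γ pγ y<x refl)))
          (sym (Tj-dn γ pγ z<y (Ti-dn⁻ γ pγ y<x (Tj-dn γ pγ z<y refl))))
        where
        y<x = ≡.subst (Fin._< pos₀ γ i) (mid pγ) y<x′

      at : T i (T j (T i ⟦ γ ⟧)) ≈ T j (T i (T j ⟦ γ ⟧))
      at = cases (pos-total γ i) (pos-total γ j) lo-hi

  infixr 7 _∙_
  _∙_ : H.Carrier → Carrier → Carrier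
  H.ι a     ∙ u = a ⊛ u
  H.π̄ i     ∙ u = T i u
  (x H.+ y) ∙ u = x ∙ u + y ∙ u
  (x H.* y) ∙ u = x ∙ (y ∙ u)
  (H.- x)   ∙ u = - (x ∙ u)

  ∙-linear : ∀ x → Linear (x ∙_)
  ∙-linear (H.ι a) = ⊛-linear a
  ∙-linear (H.π̄ i) = T-linear i
  ∙-linear (x H.+ y) = +-linear (∙-linear x) (∙-linear y)
  ∙-linear (x H.* y) = ∘-linear (∙-linear x) (∙-linear y)
  ∙-linear (H.- x) = neg-linear (∙-linear x)

  ⊛-zeroˡ : ∀ u → K.0# ⊛ u ≈ 0ᶠ
  ⊛-zeroˡ u = 0-unique (K.0# ⊛ u) (K.0# ⊛ u)
    (trans (sym (⊛-distribʳ K.0# K.0# u)) (⊛-cong (K.+-identityˡ K.0#) refl))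

  ∙-congʳ : ∀ {x y} → x H.≈ y → ∀ u → x ∙ u ≈ y ∙ u
  ∙-congʳ H.refl u = refl
  ∙-congʳ (H.sym p) u = sym (∙-congʳ p u)
  ∙-congʳ (H.trans p q) u = trans (∙-congʳ p u) (∙-congʳ q u)
  ∙-congʳ (H.+-cong p q) u = +-cong (∙-congʳ p u) (∙-congʳ q u)
  ∙-congʳ (H.*-cong {x′ = x′} {y = y} p q) u = trans (∙-congʳ p (y ∙ u)) (F-cong (∙-linear x′) (∙-congʳ q u))
  ∙-congʳ (H.-‿cong p) u = -‿cong (∙-congʳ p u)
  ∙-congʳ (H.+-assoc x y z) u = +-assoc _ _ _
  ∙-congʳ (H.+-comm x y) u = +-comm _ _
  ∙-congʳ (H.+-identityˡ x) u = trans (+-cong (⊛-zeroˡ u) refl) (+-identityˡ _)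
  ∙-congʳ (H.-‿inverseˡ x) u = trans (-‿inverseˡ _) (sym (⊛-zeroˡ u))
  ∙-congʳ (H.*-assoc x y z) u = refl
  ∙-congʳ (H.*-identityˡ x) u = ⊛-identity _
  ∙-congʳ (H.*-identityʳ x) u = F-cong (∙-linear x) (⊛-identity u)
  ∙-congʳ (H.distribˡ x y z) u = F-+ (∙-linear x) _ _
  ∙-congʳ (H.distribʳ x y z) u = refl
  ∙-congʳ (H.ι-cong e) u = ⊛-cong e refl
  ∙-congʳ (H.ι-+ a b) u = ⊛-distribʳ a b u
  ∙-congʳ (H.ι-* a b) u = ⊛-assoc a b u
  ∙-congʳ (H.ι-central a x) u = sym (F-⊛ (∙-linear x) a u)
  ∙-congʳ (H.quadratic i) u = T-quadratic i u
  ∙-congʳ (H.braid i j next) u = T-braid i j next u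
  ∙-congʳ (H.commute i j far) u = T-commute i j far u

  leftModule : LeftModule H.ring _ _
  leftModule = record
    { Carrierᴹ = Carrier ; _≈ᴹ_ = _≈_ ; _+ᴹ_ = _+_ ; _*ₗ_ = _∙_ ; 0ᴹ = 0ᶠ ; -ᴹ_ = -_
    ; isLeftModule = record
      { isLeftSemimodule = record
        { +ᴹ-isCommutativeMonoid = isCommutativeMonoid
        ; isPreleftSemimodule = record
          { *ₗ-cong = λ {x} {y} {u} {v} p q → trans (∙-congʳ p u) (F-cong (∙-linear y) q)
          ; *ₗ-zeroˡ = ⊛-zeroˡ
          ; *ₗ-distribʳ = λ _ _ _ → refl
          ; *ₗ-identityˡ = ⊛-identity
          ; *ₗ-assoc = λ _ _ _ → refl
          ; *ₗ-zeroʳ = λ x → F-0 (∙-linear x)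
          ; *ₗ-distribˡ = λ x → F-+ (∙-linear x) } }
      ; -ᴹ‿cong = -‿cong
      ; -ᴹ‿inverse = -‿inverseˡ , -‿inverseʳ } }

------------------------------------------------------------------------
-- The longest element w₁(S)

permutations : ∀ n → List (𝔖 n)
permutations zero    = Perm.id ∷ []
permutations (suc n) =
  List.concatMap (λ j → List.map (Perm.insert zero j) (permutations n)) (List.allFin (suc n))

permutations-complete : ∀ {n} (σ : 𝔖 n) → Any (_≈ₚ σ) (permutations n)
permutations-complete {zero}  σ = here λ ()
permutations-complete {suc n} σ =
  Anyₚ.concatMap⁺ (λ j → List.map (Perm.insert zero j) (permutations n)) (Any.map (λ { ≡.refl → rest }) (∈-allFin (σ ⟨$⟩ʳ zero)))
  where
  open import Data.List.Membership.Propositional.Properties using (∈-allFin)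
  insert-cong : ∀ j {τ υ : 𝔖 n} → τ ≈ₚ υ → Perm.insert zero j τ ≈ₚ Perm.insert zero j υ
  insert-cong j e zero    = ≡.refl
  insert-cong j e (suc k) = ≡.cong (punchIn j) (e k)
  rest : Any (_≈ₚ σ) (List.map (Perm.insert zero (σ ⟨$⟩ʳ zero)) (permutations n))
  rest = Anyₚ.map⁺ (Any.map
    (λ {τ} e x → ≡.trans (insert-cong (σ ⟨$⟩ʳ zero) {τ} {Perm.remove zero σ} e x) (Perm.insert-remove zero σ x))
    (permutations-complete (Perm.remove zero σ)))

DesR⊆ : ∀ {m} → Subset m → 𝔖 (suc m) → Set
DesR⊆ S z = ∀ i → i ∈DesR z → i ∈ S

DesR⊆? : ∀ {m} (S : Subset m) z → Dec (DesR⊆ S z)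
DesR⊆? S z = Finₚ.all? λ i → (ℓ (z · s i) ℕₚ.<? ℓ z) →-dec (i ∈? S)

w₁ : ∀ {m} → Subset m → 𝔖 (suc m)
w₁ S = argmax ℓ Perm.id (List.filter (DesR⊆? S) (permutations _))

w₁-DesR⊆ : ∀ {m} (S : Subset m) → DesR⊆ S (w₁ S)
w₁-DesR⊆ {m} S = argmax-all ℓ id-DesR⊆ (Allₚ.all-filter (DesR⊆? S) (permutations (suc m)))
  where
  open WeakOrder {m}
  id-DesR⊆ : DesR⊆ S Perm.id
  id-DesR⊆ i lt with () ← ≡.subst (ℓ (Perm.id · s i) ℕ.<_) (≡.trans (ℓ≡inversions Perm.id) inversions-id) lt

any-filter : ∀ {A : Set} {P Q R : A → Set} {B : Set} (P? : ∀ x → Dec (P x)) →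
             (∀ {x} → R x → P x) → (∀ {x} → R x → Q x → B) →
             ∀ {xs} → Any R xs → All Q (List.filter P? xs) → B
any-filter P? R⇒P use {x ∷ xs} (here r) all with P? x | all
... | yes _ | q ∷ _ = use r q
... | no ¬p | _     = ⊥-elim (¬p (R⇒P r))
any-filter P? R⇒P use {x ∷ xs} (there a) all with P? x | all
... | yes _ | _ ∷ qs = any-filter P? R⇒P use a qs
... | no _  | qs     = any-filter P? R⇒P use a qs

w₁-longest : ∀ {m} (S : Subset m) z → DesR⊆ S z → ℓ z ℕ.≤ ℓ (w₁ S)
w₁-longest {m} S z z⊆ = any-filter (DesR⊆? S)
  (λ {τ} e → ⊆-cong {τ} e) (λ {τ} e → ≡.subst (ℕ._≤ ℓ (w₁ S)) (ℓ-cong {τ} {z} e))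
  (permutations-complete z) (f[xs]≤f[argmax] Perm.id (List.filter (DesR⊆? S) (permutations (suc m))))
  where
  open WeakOrder {m}
  ⊆-cong : ∀ {τ} → τ ≈ₚ z → DesR⊆ S τ
  ⊆-cong {τ} e i d = z⊆ i (≡.subst₂ ℕ._<_ (ℓ-cong {τ · s i} {z · s i} (λ x → e (s i ⟨$⟩ʳ x))) (ℓ-cong {τ} {z} e) d)

------------------------------------------------------------------------
-- Compositions and the filling T″

record Composition (n : ℕ) : Set where
  field
    parts    : List ℕ
    positive : All (1 ℕ.≤_) parts
    total    : sum parts ≡ n

open Composition

_ʳ : ∀ {n} → Composition n → Composition n
(α ʳ) .parts    = List.reverse (parts α)
(α ʳ) .positive = ↭ₚ.All-resp-↭ (↭-sym (↭ₚ.↭-reverse (parts α))) (positive α)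
(α ʳ) .total    = ≡.trans (sum-↭ (↭ₚ.↭-reverse (parts α))) (total α)

-- α₁, α₁ + α₂, …, α₁ + ⋯ + αₗ₋₁
partialSums : List ℕ → List ℕ
partialSums as = List.map (λ k → sum (List.take (suc k) as)) (List.upTo (length as ℕ.∸ 1))

set : ∀ {m} → Composition (suc m) → Subset m
set α = Vec.tabulate λ i → does (suc (toℕ i) ∈ᴸ? partialSums (parts α))

PeakParts : List ℕ → Set
PeakParts as = ∀ (i : Fin (length as)) → suc (toℕ i) ℕ.< length as → List.lookup as i ≢ 1

IsPeak : ∀ {n} → Composition n → Set
IsPeak α = PeakParts (parts α)

-- The number l - 1 or l of boxes in column 2, according to whether αₗ = 1.  Peak
-- compositions have a box there in each of the rows 1, …, l - 1.
height₂ : List ℕ → ℕ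
height₂ []           = 0
height₂ (a ∷ [])     = if does (a ℕₚ.≟ 1) then 0 else 1
height₂ (_ ∷ b ∷ as) = suc (height₂ (b ∷ as))

odds evens : ℕ → List ℕ
odds  = List.applyUpTo (λ k → 1 ℕ.+ 2 ℕ.* k)
evens = List.applyUpTo (λ k → 2 ℕ.+ 2 ℕ.* k)

-- Columns 1 and 2 (listed bottom to top) cut into rows.
firstColumns : List ℕ → List ℕ → List (List ℕ)
firstColumns []       _        = []
firstColumns (a ∷ as) []       = (a ∷ []) ∷ firstColumns as []
firstColumns (a ∷ as) (b ∷ bs) = (a ∷ b ∷ []) ∷ firstColumns as bs

-- The numbers of {1, …, n} that are not used, increasingly.
remaining : ℕ → List ℕ → List ℕ
remaining n used = List.filter (λ x → ¬? (x ∈ᴸ? used)) (List.applyUpTo suc n)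

cut : List ℕ → List ℕ → List (List ℕ)
cut []       _  = []
cut (k ∷ ks) xs = List.take k xs ∷ cut ks (List.drop k xs)

-- The rows of the filling, bottom row first.  The remaining numbers are cut into
-- the rest of the rows starting from the top row, hence the two reversals.
T″ : ∀ {n} → Composition n → List (List ℕ)
T″ {n} α = List.zipWith _++_
    (firstColumns col₁ col₂)
    (List.reverse (cut (List.reverse (List.map (ℕ._∸ 2) (parts α))) (remaining n (col₁ ++ col₂))))
  where
  col₁ = odds (length (parts α))
  col₂ = evens (height₂ (parts α))

wLT : List (List ℕ) → List ℕ
wLT rows = List.concat (List.reverse rows)

word : ∀ {n} → 𝔖 n → List ℕ
word σ = List.tabulate λ i → suc (toℕ (σ ⟨$⟩ʳ i))

fromWord : ∀ {n xs} → xs ↭ List.applyUpTo suc n → ∃ λ (σ : 𝔖 n) → word σ ≡ xs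
fromWord {n} {xs} p = σ , tabulate-lookup-cast xs (≡.sym len) (λ i → suc (toℕ (σ ⟨$⟩ʳ i))) values
  where
  open import Data.List.Relation.Binary.Permutation.Setoid (≡.setoid ℕ) using (onIndices)
  open import Data.List.Relation.Binary.Permutation.Setoid.Properties (≡.setoid ℕ) using (onIndices-lookup)
  len : n ≡ length xs
  len = ≡.trans (≡.sym (Listₚ.length-applyUpTo suc n)) (≡.sym (↭ₚ.↭-length p))
  q = ↭.↭⇒↭ₛ p
  σ : 𝔖 n
  σ = Perm.cast-id len ∘ₚ onIndices q ∘ₚ Perm.cast-id (Listₚ.length-applyUpTo suc n)
  values : ∀ i → suc (toℕ (σ ⟨$⟩ʳ i)) ≡ List.lookup xs (Fin.cast len i)
  values i = ≡.trans (≡.cong suc (Finₚ.toℕ-cast (Listₚ.length-applyUpTo suc n) (onIndices q ⟨$⟩ʳ Fin.cast len i)))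
    (≡.sym (≡.trans (onIndices-lookup q (Fin.cast len i)) (Listₚ.lookup-applyUpTo suc n _)))
  tabulate-lookup-cast : ∀ {n} (xs : List ℕ) (e : length xs ≡ n) (f : Fin n → ℕ) →
    (∀ i → f i ≡ List.lookup xs (Fin.cast (≡.sym e) i)) → List.tabulate f ≡ xs
  tabulate-lookup-cast xs ≡.refl f h = ≡.trans
    (Listₚ.tabulate-cong (λ i → ≡.trans (h i) (≡.cong (List.lookup xs) (Finₚ.cast-is-id ≡.refl i))))
    (Listₚ.tabulate-lookup xs)

module T″-Permutation where
  open ≡ using (refl; sym; trans; cong; cong₂; subst)
  open import Data.List.Relation.Unary.Unique.Propositional using (Unique)
  import Data.List.Relation.Unary.Unique.Propositional.Properties as Uniqueₚ
  open import Data.List.Membership.Propositional.Properties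
    using (∈-applyUpTo⁺; ∈-applyUpTo⁻; ∈-++⁻; ∈-++⁺ˡ; ∈-++⁺ʳ; ∈-filter⁺; ∈-filter⁻)
  open import Data.List.Membership.Propositional.Properties.WithK using (unique∧set⇒bag)
  open import Data.List.Relation.Binary.BagAndSetEquality using (∼bag⇒↭)

  concat-↭ : ∀ {xss yss : List (List ℕ)} → xss ↭ yss → List.concat xss ↭ List.concat yss
  concat-↭ ↭.refl = ↭-refl
  concat-↭ (↭.prep x p) = ↭ₚ.++⁺ˡ x (concat-↭ p)
  concat-↭ {_ ∷ _ ∷ xss} {_ ∷ _ ∷ yss} (↭.swap x y p) =
    ↭-trans (↭ₚ.++⁺ˡ x (↭ₚ.++⁺ˡ y (concat-↭ p)))
      (↭-trans (↭.↭-reflexive (sym (Listₚ.++-assoc x y _)))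
        (↭-trans (↭ₚ.++⁺ʳ _ (↭ₚ.++-comm x y)) (↭.↭-reflexive (Listₚ.++-assoc y x _))))
  concat-↭ (↭.trans p q) = ↭-trans (concat-↭ p) (concat-↭ q)

  interchange-↭ : ∀ (as bs cs ds : List ℕ) → (as ++ bs) ++ (cs ++ ds) ↭ (as ++ cs) ++ (bs ++ ds)
  interchange-↭ as bs cs ds =
    ↭-trans (↭.↭-reflexive (Listₚ.++-assoc as bs _))
      (↭-trans (↭ₚ.++⁺ˡ as (↭-trans (↭.↭-reflexive (sym (Listₚ.++-assoc bs cs ds)))
          (↭-trans (↭ₚ.++⁺ʳ ds (↭ₚ.++-comm bs cs)) (↭.↭-reflexive (Listₚ.++-assoc cs bs ds)))))
        (↭.↭-reflexive (sym (Listₚ.++-assoc as cs _))))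

  zipWith-↭ : ∀ (xss yss : List (List ℕ)) → length xss ≡ length yss →
    List.concat (List.zipWith _++_ xss yss) ↭ List.concat xss ++ List.concat yss
  zipWith-↭ [] [] _ = ↭-refl
  zipWith-↭ (xs ∷ xss) (ys ∷ yss) e =
    ↭-trans (↭ₚ.++⁺ˡ (xs ++ ys) (zipWith-↭ xss yss (ℕₚ.suc-injective e)))
            (interchange-↭ xs ys (List.concat xss) (List.concat yss))

  firstColumns-length : ∀ as bs → length (firstColumns as bs) ≡ length as
  firstColumns-length [] bs = refl
  firstColumns-length (a ∷ as) [] = cong suc (firstColumns-length as [])
  firstColumns-length (a ∷ as) (b ∷ bs) = cong suc (firstColumns-length as bs)

  firstColumns-↭ : ∀ as bs → length bs ℕ.≤ length as → List.concat (firstColumns as bs) ↭ as ++ bs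
  firstColumns-↭ [] [] _ = ↭-refl
  firstColumns-↭ (a ∷ as) [] _ = ↭.prep a (firstColumns-↭ as [] ℕ.z≤n)
  firstColumns-↭ (a ∷ as) (b ∷ bs) (ℕ.s≤s le) =
    ↭.prep a (↭-trans (↭.prep b (firstColumns-↭ as bs le)) (↭-sym (↭ₚ.shift b as bs)))

  cut-length : ∀ ks xs → length (cut ks xs) ≡ length ks
  cut-length [] xs = refl
  cut-length (k ∷ ks) xs = cong suc (cut-length ks (List.drop k xs))

  cut-concat : ∀ ks xs → sum ks ≡ length xs → List.concat (cut ks xs) ≡ xs
  cut-concat [] [] _ = refl
  cut-concat (k ∷ ks) xs e = trans
    (cong (List.take k xs ++_) (cut-concat ks (List.drop k xs)
      (sym (trans (Listₚ.length-drop k xs) (trans (cong (ℕ._∸ k) (sym e)) (ℕₚ.m+n∸m≡n k _))))))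
    (Listₚ.take++drop≡id k xs)

  height₂≤ : ∀ as → height₂ as ℕ.≤ length as
  height₂≤ [] = ℕ.z≤n
  height₂≤ (a ∷ []) with does (a ℕₚ.≟ 1)
  ... | true = ℕ.z≤n
  ... | false = ℕₚ.≤-refl
  height₂≤ (_ ∷ b ∷ as) = ℕ.s≤s (height₂≤ (b ∷ as))

  ≤height₂ : ∀ as → length as ℕ.≤ suc (height₂ as)
  ≤height₂ [] = ℕ.z≤n
  ≤height₂ (a ∷ []) = ℕ.s≤s ℕ.z≤n
  ≤height₂ (_ ∷ b ∷ as) = ℕ.s≤s (≤height₂ (b ∷ as))

  count : ∀ as → All (1 ℕ.≤_) as → PeakParts as →
          (length as ℕ.+ height₂ as) ℕ.+ sum (List.map (ℕ._∸ 2) as) ≡ sum as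
  count [] _ _ = refl
  count (zero ∷ []) (() ∷ _) _
  count (suc zero ∷ []) _ _ = refl
  count (suc (suc a) ∷ []) _ _ = refl
  count (zero ∷ b ∷ as) (() ∷ _) _
  count (suc zero ∷ b ∷ as) _ pk = ⊥-elim (pk zero (ℕ.s≤s (ℕ.s≤s ℕ.z≤n)) refl)
  count (suc (suc a) ∷ b ∷ as) (_ ∷ pos) pk = begin
    (suc l ℕ.+ suc h) ℕ.+ (a ℕ.+ r)      ≡⟨ cong (λ t → suc t ℕ.+ (a ℕ.+ r)) (ℕₚ.+-suc l h) ⟩
    suc (suc ((l ℕ.+ h) ℕ.+ (a ℕ.+ r)))  ≡⟨ cong (2 ℕ.+_) (ℕₚ.+-assoc (l ℕ.+ h) a r) ⟨
    suc (suc (((l ℕ.+ h) ℕ.+ a) ℕ.+ r))  ≡⟨ cong (λ t → suc (suc (t ℕ.+ r))) (ℕₚ.+-comm (l ℕ.+ h) a) ⟩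
    suc (suc ((a ℕ.+ (l ℕ.+ h)) ℕ.+ r))  ≡⟨ cong (2 ℕ.+_) (ℕₚ.+-assoc a (l ℕ.+ h) r) ⟩
    suc (suc (a ℕ.+ ((l ℕ.+ h) ℕ.+ r)))  ≡⟨ cong (λ t → suc (suc (a ℕ.+ t)))
                                              (count (b ∷ as) pos (λ i lt → pk (suc i) (ℕ.s≤s lt))) ⟩
    suc (suc (a ℕ.+ sum (b ∷ as)))  ∎
    where
    open ≡.≡-Reasoning
    l = length (b ∷ as)
    h = height₂ (b ∷ as)
    r = sum (List.map (ℕ._∸ 2) (b ∷ as))

  remaining-↭ : ∀ n used → Unique used → (∀ {x} → x ∈ᴸ used → x ∈ᴸ List.applyUpTo suc n) →
                used ++ remaining n used ↭ List.applyUpTo suc n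
  remaining-↭ n used unique within = ∼bag⇒↭ (unique∧set⇒bag
    (Uniqueₚ.++⁺ unique (Uniqueₚ.filter⁺ _ all-unique) (λ (u , r) → proj₂ (∈-filter⁻ unused? {xs = all} r) u))
    all-unique
    (mk⇔ (λ x∈ → [ within , (λ r → proj₁ (∈-filter⁻ unused? {xs = all} r)) ]′ (∈-++⁻ used x∈))
         (λ x∈ → split _ x∈ (_ ∈ᴸ? used))))
    where
    all = List.applyUpTo suc n
    unused? = λ x → ¬? (x ∈ᴸ? used)
    all-unique : Unique all
    all-unique = Uniqueₚ.applyUpTo⁺₁ suc n (λ i<j _ e → ℕₚ.<⇒≢ i<j (ℕₚ.suc-injective e))
    split : ∀ x → x ∈ᴸ all → Dec (x ∈ᴸ used) → x ∈ᴸ used ++ remaining n used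
    split x x∈ (yes u) = ∈-++⁺ˡ u
    split x x∈ (no ¬u) = ∈-++⁺ʳ used (∈-filter⁺ unused? x∈ ¬u)

  columns-unique : ∀ l h → Unique (odds l ++ evens h)
  columns-unique l h = Uniqueₚ.++⁺
    (Uniqueₚ.applyUpTo⁺₁ _ l (λ i<j _ e → ℕₚ.<⇒≢ i<j (ℕₚ.*-cancelˡ-≡ _ _ 2 (ℕₚ.suc-injective e))))
    (Uniqueₚ.applyUpTo⁺₁ _ h (λ i<j _ e → ℕₚ.<⇒≢ i<j (ℕₚ.*-cancelˡ-≡ _ _ 2 (ℕₚ.suc-injective (ℕₚ.suc-injective e)))))
    disjoint
    where
    disjoint : ∀ {x} → ¬ (x ∈ᴸ odds l × x ∈ᴸ evens h)
    disjoint (o , e) with i , _ , refl ← ∈-applyUpTo⁻ (λ k → 1 ℕ.+ 2 ℕ.* k) o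
                        | j , _ , e′ ← ∈-applyUpTo⁻ (λ k → 2 ℕ.+ 2 ℕ.* k) e =
      ℕₚ.even≢odd i j (ℕₚ.suc-injective e′)

  columns-within : ∀ n as → length as ℕ.+ height₂ as ℕ.≤ n →
                   ∀ {x} → x ∈ᴸ odds (length as) ++ evens (height₂ as) → x ∈ᴸ List.applyUpTo suc n
  columns-within n as l+h≤n x∈ with ∈-++⁻ (odds (length as)) x∈
  ... | inj₁ o with i , i<l , refl ← ∈-applyUpTo⁻ (λ k → 1 ℕ.+ 2 ℕ.* k) o =
    ∈-applyUpTo⁺ suc (ℕₚ.≤-trans (ℕₚ.≤-trans bound (ℕₚ.+-mono-≤ i<l (ℕₚ.≤-pred (ℕₚ.≤-trans i<l (≤height₂ as))))) l+h≤n)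
    where
    bound : 1 ℕ.+ 2 ℕ.* i ℕ.≤ suc i ℕ.+ i
    bound = ℕₚ.≤-reflexive (cong (λ t → suc (i ℕ.+ t)) (ℕₚ.+-identityʳ i))
  ... | inj₂ e with i , i<h , refl ← ∈-applyUpTo⁻ (λ k → 2 ℕ.+ 2 ℕ.* k) e =
    ∈-applyUpTo⁺ suc (ℕₚ.≤-trans (ℕₚ.≤-trans bound (ℕₚ.+-mono-≤ (ℕₚ.≤-trans i<h (height₂≤ as)) i<h)) l+h≤n)
    where
    bound : 2 ℕ.+ 2 ℕ.* i ℕ.≤ suc i ℕ.+ suc i
    bound = ℕₚ.≤-reflexive (cong suc (trans (cong (λ t → suc (i ℕ.+ t)) (ℕₚ.+-identityʳ i)) (sym (ℕₚ.+-suc i i))))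

  wLT-↭ : ∀ {n} (α : Composition n) → IsPeak α → wLT (T″ α) ↭ List.applyUpTo suc n
  wLT-↭ {n} α pk =
    ↭-trans (concat-↭ (↭ₚ.↭-reverse (T″ α)))
    (↭-trans (zipWith-↭ (firstColumns col₁ col₂) (List.reverse (cut ks rest)) lengths)
    (↭-trans (↭ₚ.++⁺
        (firstColumns-↭ col₁ col₂ (≡.subst₂ ℕ._≤_ (sym len₂) (sym len₁) (height₂≤ as)))
        (↭-trans (concat-↭ (↭ₚ.↭-reverse (cut ks rest))) (↭.↭-reflexive (cut-concat ks rest sum-ks))))
    used-rest))
    where
    as = parts α
    col₁ = odds (length as)
    col₂ = evens (height₂ as)
    rest = remaining n (col₁ ++ col₂)
    ks = List.reverse (List.map (ℕ._∸ 2) as)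
    len₁ : length col₁ ≡ length as
    len₁ = Listₚ.length-applyUpTo _ (length as)
    len₂ : length col₂ ≡ height₂ as
    len₂ = Listₚ.length-applyUpTo _ (height₂ as)
    counted : (length as ℕ.+ height₂ as) ℕ.+ sum (List.map (ℕ._∸ 2) as) ≡ n
    counted = trans (count as (positive α) pk) (total α)
    used-rest : (col₁ ++ col₂) ++ rest ↭ List.applyUpTo suc n
    used-rest = remaining-↭ n (col₁ ++ col₂) (columns-unique (length as) (height₂ as))
      (columns-within n as (subst (length as ℕ.+ height₂ as ℕ.≤_) counted (ℕₚ.m≤m+n _ _)))
    lengths : length (firstColumns col₁ col₂) ≡ length (List.reverse (cut ks rest))
    lengths = trans (firstColumns-length col₁ col₂) (trans len₁ (sym
      (trans (Listₚ.length-reverse (cut ks rest)) (trans (cut-length ks rest)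
        (trans (Listₚ.length-reverse (List.map (ℕ._∸ 2) as)) (Listₚ.length-map (ℕ._∸ 2) as))))))
    sum-ks : sum ks ≡ length rest
    sum-ks = ℕₚ.+-cancelˡ-≡ (length as ℕ.+ height₂ as) _ _ (begin
      (length as ℕ.+ height₂ as) ℕ.+ sum ks
        ≡⟨ cong ((length as ℕ.+ height₂ as) ℕ.+_) (sum-↭ (↭ₚ.↭-reverse (List.map (ℕ._∸ 2) as))) ⟩
      (length as ℕ.+ height₂ as) ℕ.+ sum (List.map (ℕ._∸ 2) as)
        ≡⟨ counted ⟩
      n
        ≡⟨ Listₚ.length-applyUpTo suc n ⟨
      length (List.applyUpTo suc n)
        ≡⟨ ↭ₚ.↭-length used-rest ⟨
      length ((col₁ ++ col₂) ++ rest)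
        ≡⟨ trans (Listₚ.length-++ (col₁ ++ col₂)) (cong (ℕ._+ length rest) (Listₚ.length-++ col₁)) ⟩
      (length col₁ ℕ.+ length col₂) ℕ.+ length rest
        ≡⟨ cong₂ (λ a b → (a ℕ.+ b) ℕ.+ length rest) len₁ len₂ ⟩
      (length as ℕ.+ height₂ as) ℕ.+ length rest ∎)
      where open ≡.≡-Reasoning

open T″-Permutation using (wLT-↭)

-- The permutation whose word is wLT (T″ α).
wLT-T″ : ∀ {n} (α : Composition n) → IsPeak α → 𝔖 n
wLT-T″ α pk = proj₁ (fromWord (wLT-↭ α pk))

word-wLT-T″ : ∀ {n} (α : Composition n) (pk : IsPeak α) → word (wLT-T″ α pk) ≡ wLT (T″ α)
word-wLT-T″ α pk = proj₂ (fromWord (wLT-↭ α pk))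

------------------------------------------------------------------------
-- Indecomposability

module _ {r ℓr} {R : Ring r ℓr} {a ℓa : Level} where

  IsZero : LeftModule R a ℓa → Set _
  IsZero M = ∀ u → u ≈ᴹ 0ᴹ
    where open LeftModule M

  infix 4 _≅_
  _≅_ : LeftModule R a ℓa → LeftModule R a ℓa → Set _
  M ≅ N = ∃ λ f → IsLeftModuleIsomorphism f
    where open Morphism.LeftModuleMorphisms (LeftModule.rawLeftModule M) (LeftModule.rawLeftModule N)

  -- Summands at the levels of M suffice: the image of an idempotent e of M can
  -- be taken to be the carrier of M with x ~ y when e x ≈ e y.
  Indecomposable : LeftModule R a ℓa → Set _
  Indecomposable M = ¬ IsZero M × (∀ A B → M ≅ A ⊕ B → IsZero A ⊎ IsZero B)

-- Hₙ(0) for n = suc m.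
H₀ : ℕ → Ring 0ℓ 0ℓ
H₀ m = Hecke.ring ℂ-commutativeRing m

B̄ : ∀ {m} → 𝔖 (suc m) → 𝔖 (suc m) → LeftModule (H₀ m) 0ℓ 0ℓ
B̄ σ ρ = WeakBruhatModule.leftModule ℂ-commutativeRing σ ρ

Qʳ : ∀ {m} (α : Composition (suc m)) → IsPeak α → LeftModule (H₀ m) 0ℓ 0ℓ
Qʳ α pk = B̄ (wLT-T″ α pk) (w₁ (set (α ʳ)))

{-# OPTIONS --safe #-}
-- Write S for set(αʳ).  Every row of T″ is increasing, and its first letter is larger than that
-- of the row below; hence DesR(wLT(T″)) = S, so wLT(T″) ≼ w₁(S), and every γ in the interval
-- has DesR(γ) ⊇ S.
--
-- The simple Hₙ(0)-modules are one-dimensional, and ℂ w₁(S) is the only simple submodule: if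
-- v is a simultaneous eigenvector of the π̄ᵢ and γ is a shortest permutation in its support,
-- then DesL(γ) is the set of i with π̄ᵢ v = - v, and along a chain from γ to w₁(S) the
-- coefficient of v is constant and all steps avoid DesL(γ).  Thus γ and w₁(S) agree up to
-- permuting letters within the classes cut out by DesL(γ), on each of which γ is increasing;
-- as γ descends at all positions in S, this forces γ = w₁(S).
--
-- So a projection e onto a direct summand scales w₁(S) by an idempotent of ℂ, hence by 0 or 1,
-- and e or 1 - e kills the socle.  An endomorphism killing the socle has no fixed vectors: this
-- is shown by descending induction on the lengths in the support, without deciding whether a
-- complex number is zero.
module Submission where

open import Defs
open import Algebra.Bundles using (AbelianGroup; CommutativeRing; Ring)
open import Algebra.Module.Bundles using (LeftModule)
open import Algebra.Module.Construct.DirectProduct using () renaming (leftModule to _⊕_)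
import Algebra.Module.Morphism.Structures as Morphism
open import Data.Bool.Base using (true; false; if_then_else_)
open import Data.Empty using (⊥; ⊥-elim)
open import Data.Fin.Base as Fin using (Fin; zero; suc; toℕ; inject₁)
open import Data.Fin.Permutation as Perm using (_⟨$⟩ʳ_; _⟨$⟩ˡ_) renaming (_≈_ to _≈ₚ_)
import Data.Fin.Properties as Finₚ
open import Data.Fin.Subset using (Subset; _∈_; _∉_)
open import Data.Fin.Subset.Properties using (_∈?_)
open import Data.List.Base as List using (List; []; _∷_; _++_; length)
open import Data.List.Membership.Propositional using () renaming (_∈_ to _∈ᴸ_; _∉_ to _∉ᴸ_)
open import Data.List.Membership.Propositional.Properties
  using (∈-allFin; ∈-map⁺; ∈-map⁻; ∈-upTo⁺; ∈-upTo⁻; ∈-applyUpTo⁺; ∈-applyUpTo⁻; ∈-++⁺ˡ; ∈-++⁺ʳ; ∈-filter⁻)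
import Data.List.Properties as Listₚ
open import Data.List.Relation.Binary.Permutation.Propositional.Properties using (↭-length; ↭-reverse)
open import Data.List.Relation.Binary.Pointwise as Pointwise using (Pointwise; []; _∷_)
open import Data.List.Relation.Unary.All as All using (All; []; _∷_)
import Data.List.Relation.Unary.All.Properties as Allₚ
open import Data.List.Relation.Unary.AllPairs using (AllPairs; []; _∷_)
import Data.List.Relation.Unary.AllPairs.Properties as AllPairsₚ
open import Data.List.Relation.Unary.Any using (Any; here; there)
open import Data.Nat.Base as ℕ using (ℕ; zero; suc)
open import Data.Nat.ListAction using (sum)
open import Data.Nat.ListAction.Properties using (sum-++; sum-↭)
import Data.Nat.Properties as ℕₚ
open import Data.Product.Base using (∃; _×_; _,_; proj₁; proj₂)
open import Data.Rational as Rat using (ℚ; 0ℚ; 1ℚ; ½)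
import Data.Rational.Properties as ℚₚ
open import Data.Sum.Base using (_⊎_; inj₁; inj₂; [_,_]′)
open import Data.Vec.Base as Vec using ([]; _∷_)
import Data.Vec.Properties as Vecₚ
open import Function.Base using (_∘_; id)
open import Function.Bundles using (mk⇔)
open import Level using (Level; _⊔_)
open import Relation.Binary.Definitions using (tri<; tri≈; tri>)
open import Relation.Binary.PropositionalEquality as ≡ using (_≡_; _≢_)
open import Relation.Nullary using (¬_; Dec; yes; no; does)
open import Relation.Nullary.Decidable using (¬?; dec-true; does-⇔)
open import Data.List.Membership.DecPropositional ℕₚ._≟_ using () renaming (_∈?_ to _∈ᴸ?_)

-- Right descents and the longest element w₁(S)

module RightDescents {m : ℕ} where
  open ≡ using (sym; trans; cong; subst₂)
  open WeakOrder {m}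
  open import Algebra.Properties.CommutativeMonoid.Sum ℕₚ.+-0-commutativeMonoid
    using (sum-cong-≗; sum-permute; ∑-comm) renaming (sum to ∑)

  -- The pair (a, b) is an inversion of `σ` exactly when (σ b, σ a) is one of its inverse. Both sums
  -- are reindexed along `σ` and then exchanged.
  inversions-flip : ∀ (σ : 𝔖 (suc m)) → inversions (Perm.flip σ) ≡ inversions σ
  inversions-flip σ = begin
    ∑ (λ x → ∑ (λ y → ind (Perm.flip σ) x y))
      ≡⟨ sum-permute (λ x → ∑ (λ y → ind (Perm.flip σ) x y)) σ ⟩
    ∑ (λ b → ∑ (λ y → ind (Perm.flip σ) (σ ⟨$⟩ʳ b) y))
      ≡⟨ sum-cong-≗ (λ b → sum-permute (λ y → ind (Perm.flip σ) (σ ⟨$⟩ʳ b) y) σ) ⟩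
    ∑ (λ b → ∑ (λ a → ind (Perm.flip σ) (σ ⟨$⟩ʳ b) (σ ⟨$⟩ʳ a)))
      ≡⟨ sum-cong-≗ (λ b → sum-cong-≗ (λ a → cong indicator (same a b))) ⟩
    ∑ (λ b → ∑ (λ a → ind σ a b))
      ≡⟨ ∑-comm (λ b a → ind σ a b) ⟩
    ∑ (λ a → ∑ (λ b → ind σ a b)) ∎
    where
    open ≡.≡-Reasoning
    ind : 𝔖 (suc m) → Fin (suc m) → Fin (suc m) → ℕ
    ind τ a b = indicator (does (inversion? τ a b))
    same : ∀ a b → does (inversion? (Perm.flip σ) (σ ⟨$⟩ʳ b) (σ ⟨$⟩ʳ a)) ≡ does (inversion? σ a b)
    same a b = does-⇔ (mk⇔
      (λ (p , q) → subst₂ Fin._<_ (Perm.inverseˡ σ) (Perm.inverseˡ σ) q , p)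
      (λ (p , q) → q , subst₂ Fin._<_ (sym (Perm.inverseˡ σ)) (sym (Perm.inverseˡ σ)) p))
      (inversion? (Perm.flip σ) (σ ⟨$⟩ʳ b) (σ ⟨$⟩ʳ a)) (inversion? σ a b)

  ℓ-flip : ∀ (σ : 𝔖 (suc m)) → ℓ (Perm.flip σ) ≡ ℓ σ
  ℓ-flip σ = trans (ℓ≡inversions (Perm.flip σ)) (trans (inversions-flip σ) (sym (ℓ≡inversions σ)))

  -- `s i · Perm.flip σ` is the inverse of `σ · s i`, so right descents of `σ` become left descents
  -- of its inverse.
  ℓ-·s : ∀ (σ : 𝔖 (suc m)) i → ℓ (s i · Perm.flip σ) ≡ ℓ (σ · s i)
  ℓ-·s σ i = trans
    (ℓ-cong {s i · Perm.flip σ} {Perm.flip (σ · s i)} (λ x → sym (s-inv i (σ ⟨$⟩ˡ x))))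
    (ℓ-flip (σ · s i))

  ∈DesR⇒> : ∀ {i} {σ : 𝔖 (suc m)} → i ∈DesR σ → σ ⟨$⟩ʳ suc i Fin.< σ ⟨$⟩ʳ inject₁ i
  ∈DesR⇒> {i} {σ} d = ∈DesL⇒pos {i} {Perm.flip σ} (subst₂ ℕ._<_ (sym (ℓ-·s σ i)) (sym (ℓ-flip σ)) d)

  >⇒∈DesR : ∀ {i} {σ : 𝔖 (suc m)} → σ ⟨$⟩ʳ suc i Fin.< σ ⟨$⟩ʳ inject₁ i → i ∈DesR σ
  >⇒∈DesR {i} {σ} lt = subst₂ ℕ._<_ (ℓ-·s σ i) (ℓ-flip σ) (pos⇒∈DesL {i} {Perm.flip σ} lt)

-- Blocks of positions cut out by a subset S

module Blocks where
  open ≡ using (refl; cong)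

  -- The index of the block of the position p; the cut i ∈ S lies between inject₁ i and suc i.
  block : ∀ {m} → Subset m → Fin (suc m) → ℕ
  block S       zero    = 0
  block (b ∷ S) (suc p) = (if b then 1 else 0) ℕ.+ block S p

  block-∈ : ∀ {m} {S : Subset m} {i} → i ∈ S → block S (suc i) ≡ suc (block S (inject₁ i))
  block-∈ {i = zero}  Vec.here = refl
  block-∈ {S = false ∷ S} {suc i} (Vec.there p) = block-∈ p
  block-∈ {S = true ∷ S} {suc i} (Vec.there p) = cong suc (block-∈ p)

  block-∉ : ∀ {m} {S : Subset m} {i} → i ∉ S → block S (suc i) ≡ block S (inject₁ i)
  block-∉ {S = true ∷ S}  {zero}  n = ⊥-elim (n Vec.here)
  block-∉ {S = false ∷ S} {zero}  n = refl
  block-∉ {S = b ∷ S} {suc i} n = cong ((if b then 1 else 0) ℕ.+_) (block-∉ (n ∘ Vec.there))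

  block-mono : ∀ {m} (S : Subset m) {p q} → p Fin.≤ q → block S p ℕ.≤ block S q
  block-mono S {zero} _ = ℕ.z≤n
  block-mono (b ∷ S) {suc p} {suc q} (ℕ.s≤s p≤q) = ℕₚ.+-monoʳ-≤ (if b then 1 else 0) (block-mono S p≤q)

  -- The block index grows only at cuts; the recursion returns the first cut from `p` on.
  cut-between : ∀ {m} (S : Subset m) {p q} → block S p ℕ.< block S q →
                ∃ λ c → c ∈ S × p Fin.≤ inject₁ c × suc c Fin.≤ q
  cut-between (true ∷ S)  {zero}  {suc q} _  = zero , Vec.here , ℕ.z≤n , ℕ.s≤s ℕ.z≤n
  cut-between (false ∷ S) {zero}  {suc q} lt with c , c∈ , _ , c<q ← cut-between S {zero} {q} lt =
    suc c , Vec.there c∈ , ℕ.z≤n , ℕ.s≤s c<q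
  cut-between (b ∷ S) {suc p} {suc q} lt
    with c , c∈ , p≤c , c<q ← cut-between S {p} {q} (ℕₚ.+-cancelˡ-< (if b then 1 else 0) _ _ lt) =
    suc c , Vec.there c∈ , ℕ.s≤s p≤c , ℕ.s≤s c<q

  -- Inside one block every step to the next position avoids `S`, so the local increases chain.
  increasing-within : ∀ {m} (S : Subset m) (f : Fin (suc m) → ℕ) →
    (∀ i → i ∉ S → f (inject₁ i) ℕ.< f (suc i)) →
    ∀ {p q} → p Fin.< q → block S p ≡ block S q → f p ℕ.< f q
  increasing-within (true ∷ S)  f inc {zero} {suc q} p<q ()
  increasing-within (false ∷ S) f inc {zero} {suc zero} p<q e = inc zero λ ()
  increasing-within (false ∷ S) f inc {zero} {suc q@(suc _)} p<q e = ℕₚ.<-trans (inc zero λ ())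
    (increasing-within S (f ∘ suc) (λ i n → inc (suc i) λ { (Vec.there p) → n p }) {zero} {q} (ℕ.s≤s ℕ.z≤n) e)
  increasing-within (b ∷ S) f inc {suc p} {suc q} (ℕ.s≤s p<q) e =
    increasing-within S (f ∘ suc) (λ i n → inc (suc i) λ { (Vec.there p) → n p }) p<q
      (ℕₚ.+-cancelˡ-≡ (if b then 1 else 0) _ _ e)

  -- Applied with `_≥_` to the blocks, and with `_≤_` to the positions, of consecutive letters.
  stepwise : ∀ {R : ℕ → ℕ → Set} → (∀ {k} → R k k) → (∀ {k l n} → R k l → R l n → R k n) →
             ∀ {m} (f : Fin (suc m) → ℕ) {x y} → x Fin.≤ y →
             (∀ i → toℕ x ℕ.≤ toℕ i → toℕ i ℕ.< toℕ y → R (f (inject₁ i)) (f (suc i))) → R (f x) (f y)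
  stepwise {R} rfl tr f {zero} {zero} _ h = rfl
  stepwise {R} rfl tr {suc m} f {zero} {suc y} _ h = tr (h zero ℕ.z≤n (ℕ.s≤s ℕ.z≤n))
    (stepwise {R} rfl tr (f ∘ suc) {zero} {y} ℕ.z≤n λ i _ lt → h (suc i) ℕ.z≤n (ℕ.s≤s lt))
  stepwise {R} rfl tr {suc m} f {suc x} {suc y} (ℕ.s≤s x≤y) h =
    stepwise {R} rfl tr (f ∘ suc) x≤y λ i le lt → h (suc i) (ℕ.s≤s le) (ℕ.s≤s lt)

open Blocks

-- The longest permutation with right descents in S

module LongestElement {m : ℕ} (S : Subset m) (w : 𝔖 (suc m)) (w-DesR⊆ : DesR⊆ S w)
                      (w-longest : ∀ z → DesR⊆ S z → ℓ z ℕ.≤ ℓ w) where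
  open ≡ using (refl; sym; trans; cong; subst; subst₂)
  open WeakOrder {m}
  open RightDescents {m}

  -- `Within` is the inclusion of the right descents in `S`, in terms of letters. `Stuck` says that
  -- exchanging the letters i and i + 1 from different blocks never gains length.
  Within Stuck : 𝔖 (suc m) → Set
  Within z = ∀ i → i ∉ S → z ⟨$⟩ʳ inject₁ i Fin.< z ⟨$⟩ʳ suc i
  Stuck z = ∀ i → block S (pos₁ z i) ℕ.≤ block S (pos₀ z i)

  at-pos : ∀ (z : 𝔖 (suc m)) {x y} → z ⟨$⟩ʳ x ≡ y → x ≡ z ⟨$⟩ˡ y
  at-pos z e = trans (sym (Perm.inverseˡ z)) (cong (z ⟨$⟩ˡ_) e)

  within⇒DesR⊆ : ∀ {z} → Within z → DesR⊆ S z
  within⇒DesR⊆ {z} zw i d with i ∈? S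
  ... | yes p = p
  ... | no n = ⊥-elim (ℕₚ.<-asym (zw i n) (∈DesR⇒> {i} {z} d))

  DesR⊆⇒within : ∀ {z} → DesR⊆ S z → Within z
  DesR⊆⇒within {z} d i n with Finₚ.<-cmp (z ⟨$⟩ʳ inject₁ i) (z ⟨$⟩ʳ suc i)
  ... | tri< lt _ _ = lt
  ... | tri≈ _ e _ = ⊥-elim (Finₚ.<⇒≢ (i₀<i₁ i) (injʳ z e))
  ... | tri> _ _ gt = ⊥-elim (n (d i (>⇒∈DesR {i} {z} gt)))

  ascent : ∀ z i → block S (pos₀ z i) ℕ.< block S (pos₁ z i) → pos₀ z i Fin.< pos₁ z i
  ascent z i lt with pos-total z i
  ... | inj₁ p = p
  ... | inj₂ q = ⊥-elim (ℕₚ.<⇒≱ lt (block-mono S (ℕₚ.<⇒≤ q)))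

  -- Left multiplication by `s i` changes only the order of the letters i and i + 1. These lie in
  -- different blocks here, whereas `Within` compares neighbours of one block.
  climb-within : ∀ z i → Within z → block S (pos₀ z i) ℕ.< block S (pos₁ z i) → Within (s i · z)
  climb-within z i zw lt c c∉ = s-mono i (zw c c∉) λ (e , e′) →
    ℕₚ.<⇒≢ lt (subst₂ (λ p q → block S p ≡ block S q) (at-pos z e) (at-pos z e′) (sym (block-∉ c∉)))

  ℓ-climb : ∀ z i → block S (pos₀ z i) ℕ.< block S (pos₁ z i) → ℓ (s i · z) ≡ suc (ℓ z)
  ℓ-climb z i lt = trans (ℓ≡inversions (s i · z))
    (trans (inversions-up z i (ascent z i lt)) (cong suc (sym (ℓ≡inversions z))))

  ℓ≤ : ∀ {z} → Within z → ℓ z ℕ.≤ ℓ w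
  ℓ≤ {z} zw = w-longest z (within⇒DesR⊆ {z} zw)

  w-within : Within w
  w-within = DesR⊆⇒within {w} w-DesR⊆

  w-stuck : Stuck w
  w-stuck i = ℕₚ.≮⇒≥ λ lt → ℕₚ.<⇒≱ (ℕₚ.≤-reflexive (sym (ℓ-climb w i lt)))
    (ℓ≤ {s i · w} (climb-within w i w-within lt))

  -- `k` bounds the number of steps left: each step adds one to the length, which cannot pass `ℓ w`.
  climb : ∀ k z → Within z → ℓ w ℕ.≤ k ℕ.+ ℓ z → ∃ λ z′ → z ≼ z′ × Within z′ × Stuck z′
  climb k z zw le with Finₚ.any? (λ i → block S (pos₀ z i) ℕₚ.<? block S (pos₁ z i))
  ... | no none = z , ≈⇒≼ (λ _ → refl) , zw , λ i → ℕₚ.≮⇒≥ λ lt → none (i , lt)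
  climb zero z zw le | yes (i , lt) = ⊥-elim (ℕₚ.<⇒≱ (ℕₚ.≤-reflexive (sym (ℓ-climb z i lt)))
    (ℕₚ.≤-trans (ℓ≤ {s i · z} (climb-within z i zw lt)) le))
  climb (suc k) z zw le | yes (i , lt)
    with z′ , p , w′ , st ← climb k (s i · z) (climb-within z i zw lt)
           (subst (ℓ w ℕ.≤_) (trans (sym (ℕₚ.+-suc k (ℓ z))) (cong (k ℕ.+_) (sym (ℓ-climb z i lt)))) le) =
    z′ , ≼-cons (⋖-s {i} {z} (pos⇒∉DesL {i} {z} (ascent z i lt))) p , w′ , st

  module Arranged (z : 𝔖 (suc m)) (within : Within z) (stuck : Stuck z) where

    block-pos : ∀ {p q} → z ⟨$⟩ʳ p Fin.≤ z ⟨$⟩ʳ q → block S q ℕ.≤ block S p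
    block-pos le = subst₂ ℕ._≤_ (cong (block S) (Perm.inverseˡ z)) (cong (block S) (Perm.inverseˡ z))
      (stepwise {ℕ._≥_} ℕₚ.≤-refl (λ p q → ℕₚ.≤-trans q p) (λ x → block S (z ⟨$⟩ˡ x)) le (λ i _ _ → stuck i))

    across : ∀ {p q} → block S p ℕ.< block S q → z ⟨$⟩ʳ q Fin.< z ⟨$⟩ʳ p
    across lt = ℕₚ.≰⇒> λ le → ℕₚ.<⇒≱ lt (block-pos le)

    inside : ∀ {p q} → block S p ≡ block S q → p Fin.< q → z ⟨$⟩ʳ p Fin.< z ⟨$⟩ʳ q
    inside e lt = increasing-within S (λ p → toℕ (z ⟨$⟩ʳ p)) within lt e

  -- Under both conditions the letters decrease from block to block and increase inside each, so the
  -- relative order of two letters is fixed by their positions.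
  stuck-unique : ∀ {y z} → Within y → Stuck y → Within z → Stuck z → y ≈ₚ z
  stuck-unique {y} {z} yw ys zw zs x =
    trans (increasing⇒id (z · Perm.flip y) increasing (y ⟨$⟩ʳ x)) (cong (z ⟨$⟩ʳ_) (Perm.inverseˡ y))
    where
    module Y = Arranged y yw ys
    module Z = Arranged z zw zs
    transfer : ∀ p q → z ⟨$⟩ʳ p Fin.< z ⟨$⟩ʳ q → y ⟨$⟩ʳ p Fin.< y ⟨$⟩ʳ q
    transfer p q zp<zq with ℕₚ.<-cmp (block S p) (block S q) | Finₚ.<-cmp p q
    ... | tri< lt _ _ | _ = ⊥-elim (ℕₚ.<-asym zp<zq (Z.across lt))
    ... | tri> _ _ gt | _ = Y.across gt
    ... | tri≈ _ e _ | tri< lt _ _ = Y.inside e lt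
    ... | tri≈ _ e _ | tri≈ _ refl _ = ⊥-elim (ℕₚ.<-irrefl refl zp<zq)
    ... | tri≈ _ e _ | tri> _ _ gt = ⊥-elim (ℕₚ.<-asym zp<zq (Z.inside (sym e) gt))
    increasing : ∀ i → y ⟨$⟩ʳ (z ⟨$⟩ˡ inject₁ i) Fin.< y ⟨$⟩ʳ (z ⟨$⟩ˡ suc i)
    increasing i = transfer _ _ (subst₂ Fin._<_ (sym (Perm.inverseʳ z)) (sym (Perm.inverseʳ z)) (i₀<i₁ i))

  -- Climbing from `z` ends at a stuck permutation satisfying `Within`, and `w` is the only one.
  ≼w : ∀ {z} → Within z → z ≼ w
  ≼w {z} zw with z′ , p , w′ , st ← climb (ℓ w) z zw (ℕₚ.m≤m+n _ _) =
    ≼-respʳ {z} {z′} {w} (stuck-unique {z′} {w} w′ st w-within w-stuck) p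

  -- Chains in the left weak order up to w₁(S)

  Cutting : 𝔖 (suc m) → Set
  Cutting z = ∀ {c} → c ∈ S → z ⟨$⟩ʳ suc c Fin.< z ⟨$⟩ʳ inject₁ c

  -- A cover by `s i` could undo the descent at `c` only if the letters there were i + 1 and i; but
  -- then i would already be a left descent of the lower permutation.
  cutting-up : ∀ {σ γ} → σ ≼ γ → Cutting σ → Cutting γ
  cutting-up (≈⇒≼ e) cut {c} c∈ = subst₂ Fin._<_ (e (suc c)) (e (inject₁ c)) (cut c∈)
  cutting-up {σ} (_▻_ {τ} p (i , n , e)) cut {c} c∈ =
    subst₂ Fin._<_ (sym (e (suc c))) (sym (e (inject₁ c)))
      (s-mono i (cutting-up p cut c∈) λ (e₀ , e₁) → n (pos⇒∈DesL {i} {τ}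
        (subst₂ Fin._<_ (at-pos τ e₁) (at-pos τ e₀) (i₀<i₁ c))))

  -- No letter j ∈ DesL γ separates γ(p) from τ(p).
  Track : 𝔖 (suc m) → 𝔖 (suc m) → Set
  Track γ τ = ∀ p j → j ∈DesL γ →
    (toℕ (γ ⟨$⟩ʳ p) ℕ.≤ toℕ j → toℕ (τ ⟨$⟩ʳ p) ℕ.≤ toℕ j) ×
    (toℕ (τ ⟨$⟩ʳ p) ℕ.≤ toℕ j → toℕ (γ ⟨$⟩ʳ p) ℕ.≤ toℕ j)

  -- `s i` moves only the letters i and i + 1, which lie on the same side of the threshold j when i
  -- differs from j.
  s-threshold : ∀ {i j : Fin m} → i ≢ j → ∀ x →
    (toℕ x ℕ.≤ toℕ j → toℕ (s i ⟨$⟩ʳ x) ℕ.≤ toℕ j) × (toℕ (s i ⟨$⟩ʳ x) ℕ.≤ toℕ j → toℕ x ℕ.≤ toℕ j)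
  s-threshold {i} {j} i≢j x = forth x , λ le → subst (λ y → toℕ y ℕ.≤ toℕ j) (s-invol i x) (forth (s i ⟨$⟩ʳ x) le)
    where
    forth : ∀ x → toℕ x ℕ.≤ toℕ j → toℕ (s i ⟨$⟩ʳ x) ℕ.≤ toℕ j
    forth x le with view i x
    ... | lo refl = subst (λ y → toℕ y ℕ.≤ toℕ j) (sym (s-lo i))
      (ℕₚ.≤∧≢⇒< (subst (ℕ._≤ toℕ j) (Finₚ.toℕ-inject₁ i) le) (i≢j ∘ Finₚ.toℕ-injective))
    ... | hi refl = subst (λ y → toℕ y ℕ.≤ toℕ j) (sym (s-hi i)) (ℕₚ.≤-trans (ℕₚ.<⇒≤ (i₀<i₁ i)) le)
    ... | other n₁ n₂ = subst (λ y → toℕ y ℕ.≤ toℕ j) (sym (s-other i n₁ n₂)) le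

  track-refl : ∀ {γ τ} → γ ≈ₚ τ → Track γ τ
  track-refl e p j _ = subst (λ y → toℕ y ℕ.≤ toℕ j) (e p) , subst (λ y → toℕ y ℕ.≤ toℕ j) (sym (e p))

  track-step : ∀ {γ τ υ i} → Track γ τ → ¬ (i ∈DesL γ) → υ ≈ₚ s i · τ → Track γ υ
  track-step {γ} {τ} {υ} {i} t n e p j j∈ =
    (λ le → subst (λ y → toℕ y ℕ.≤ toℕ j) (sym (e p)) (proj₁ thr (proj₁ (t p j j∈) le))) ,
    (λ le → proj₂ (t p j j∈) (proj₂ thr (subst (λ y → toℕ y ℕ.≤ toℕ j) (e p) le)))
    where
    thr = s-threshold {i} {j} (λ { refl → n j∈ }) (τ ⟨$⟩ʳ p)

  -- Suppose i is a descent of w₁ but not of γ.  The letters i + 1 and i lie in different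
  -- blocks of w, and w has only letters from the DesL γ-class of i around the cut between
  -- them; hence γ is increasing across that cut.
  track-descent : ∀ {γ} → Cutting γ → (∀ j → j ∈DesL γ → j ∈DesL w) → Track γ w →
                  ∀ {i} → i ∈DesL w → i ∈DesL γ
  track-descent {γ} cut ⊆w track {i} i∈w with i ∈DesL? γ
  ... | yes i∈ = i∈
  ... | no i∉ = ⊥-elim (contra (cut-between S bp<bq))
    where
    b = block S
    open Arranged w w-within w-stuck
    wpos : ∀ {v} → w ⟨$⟩ʳ (w ⟨$⟩ˡ v) ≡ v
    wpos = Perm.inverseʳ w
    p = pos₁ w i
    q = pos₀ w i
    descent-blocks : ∀ j → j ∈DesL w → b (pos₁ w j) ℕ.< b (pos₀ w j)
    descent-blocks j d = ℕₚ.≤∧≢⇒< (w-stuck j) λ e → ℕₚ.<-asym (i₀<i₁ j)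
      (subst₂ Fin._<_ wpos wpos (inside e (∈DesL⇒pos {j} {w} d)))
    bp<bq : b p ℕ.< b q
    bp<bq = descent-blocks i i∈w
    separated : ∀ {c} → p Fin.≤ inject₁ c → suc c Fin.≤ q → ∀ j → j ∈DesL γ →
                toℕ (w ⟨$⟩ʳ suc c) ℕ.≤ toℕ j → toℕ j ℕ.< toℕ (w ⟨$⟩ʳ inject₁ c) → ⊥
    separated {c} p≤c c<q j j∈ below above with ℕₚ.<-cmp (toℕ i) (toℕ j)
    ... | tri≈ _ e _ = i∉ (subst (_∈DesL γ) (sym (Finₚ.toℕ-injective e)) j∈)
    -- Smaller letters lie in later or equal blocks. With `p≤c` here, and `c<q` in the next case,
    -- the letter j would be in a block no later than that of j + 1, against `descent-blocks`.
    ... | tri< i<j _ _ = ℕₚ.<⇒≱ (descent-blocks j (⊆w j j∈)) (ℕₚ.≤-trans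
      (block-pos (subst₂ ℕ._≤_ (sym (cong toℕ wpos)) (sym (trans (cong toℕ wpos) (Finₚ.toℕ-inject₁ j))) i<j))
      (ℕₚ.≤-trans (block-mono S p≤c) (block-pos (subst (ℕ._≤ toℕ (w ⟨$⟩ʳ inject₁ c)) (sym (cong toℕ wpos)) above))))
    ... | tri> _ _ j<i = ℕₚ.<⇒≱ (descent-blocks j (⊆w j j∈)) (ℕₚ.≤-trans
      (block-pos (subst (toℕ (w ⟨$⟩ʳ suc c) ℕ.≤_) (sym (trans (cong toℕ wpos) (Finₚ.toℕ-inject₁ j))) below))
      (ℕₚ.≤-trans (block-mono S c<q)
        (block-pos (subst₂ ℕ._≤_ (sym (cong toℕ wpos)) (sym (trans (cong toℕ wpos) (Finₚ.toℕ-inject₁ i))) j<i))))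
    contra : (∃ λ c → c ∈ S × p Fin.≤ inject₁ c × suc c Fin.≤ q) → ⊥
    -- Without a left descent of `γ` between the letters at `suc c` and `inject₁ c`, positions would
    -- increase weakly from the smaller letter to the larger, which `cut` contradicts.
    contra (c , c∈ , p≤c , c<q) = ℕₚ.<⇒≱ (i₀<i₁ c) (subst₂ Fin._≤_ (Perm.inverseˡ γ) (Perm.inverseˡ γ)
      (stepwise {ℕ._≤_} ℕₚ.≤-refl ℕₚ.≤-trans (λ x → toℕ (γ ⟨$⟩ˡ x)) (ℕₚ.<⇒≤ (cut c∈)) free))
      where
      free : ∀ j → toℕ (γ ⟨$⟩ʳ suc c) ℕ.≤ toℕ j → toℕ j ℕ.< toℕ (γ ⟨$⟩ʳ inject₁ c) →
             toℕ (pos₀ γ j) ℕ.≤ toℕ (pos₁ γ j)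
      free j ≤j j< with pos-total γ j
      ... | inj₁ lt = ℕₚ.<⇒≤ lt
      ... | inj₂ gt = ⊥-elim (separated p≤c c<q j j∈ (proj₁ (track (suc c) j j∈) ≤j)
          (ℕₚ.≰⇒> λ le → ℕₚ.<⇒≱ j< (proj₂ (track (inject₁ c) j j∈) le)))
        where j∈ = pos⇒∈DesL {j} {γ} gt

-- Coefficients with respect to the basis

module Coefficients {c ℓk : Level} (K : CommutativeRing c ℓk) {m : ℕ} (σ ρ : 𝔖 (suc m)) where
  private module K = CommutativeRing K
  open import Algebra.Properties.Ring K.ring using (-0#≈0#; -‿+-comm)
  open import Algebra.Properties.CommutativeSemigroup K.+-commutativeSemigroup using (interchange)
  open FreeModule K [ σ , ρ ]ᴸ
  open Linear
  open WeakBruhatModule K σ ρ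
  open WeakOrder {m}

  infix 4 _≟ₚ_
  _≟ₚ_ : (γ δ : 𝔖 (suc m)) → Dec (γ ≈ₚ δ)
  γ ≟ₚ δ = Finₚ.all? λ x → γ ⟨$⟩ʳ x Finₚ.≟ δ ⟨$⟩ʳ x

  bracket : {P : Set} → Dec P → K.Carrier
  bracket (yes _) = K.1#
  bracket (no _)  = K.0#

  bracket-cong : {P Q : Set} (d : Dec P) (e : Dec Q) → (P → Q) → (Q → P) → bracket d K.≈ bracket e
  bracket-cong (yes _) (yes _) _ _ = K.refl
  bracket-cong (yes p) (no n) f _ = ⊥-elim (n (f p))
  bracket-cong (no n) (yes q) _ g = ⊥-elim (n (g q))
  bracket-cong (no _) (no _) _ _ = K.refl

  bracket-no : {P : Set} (d : Dec P) → ¬ P → bracket d K.≈ K.0#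
  bracket-no (yes p) n = ⊥-elim (n p)
  bracket-no (no _) _ = K.refl

  bracket-yes : {P : Set} (d : Dec P) → P → bracket d K.≈ K.1#
  bracket-yes (yes _) _ = K.refl
  bracket-yes (no n) p = ⊥-elim (n p)

  coef : 𝔖 (suc m) → Carrier → K.Carrier
  coef δ ⟨ x ⟩   = bracket (proj₁ x ≟ₚ δ)
  coef δ 0ᶠ      = K.0#
  coef δ (u + v) = coef δ u K.+ coef δ v
  coef δ (- u)   = K.- coef δ u
  coef δ (a ⊛ u) = a K.* coef δ u

  coef-cong : ∀ δ {u v} → u ≈ v → coef δ u K.≈ coef δ v
  coef-cong δ refl = K.refl
  coef-cong δ (sym p) = K.sym (coef-cong δ p)
  coef-cong δ (trans p q) = K.trans (coef-cong δ p) (coef-cong δ q)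
  coef-cong δ (⟨⟩-cong {x} {y} e) = bracket-cong (proj₁ x ≟ₚ δ) (proj₁ y ≟ₚ δ)
    (λ f i → ≡.trans (≡.sym (e i)) (f i)) (λ f i → ≡.trans (e i) (f i))
  coef-cong δ (+-cong p q) = K.+-cong (coef-cong δ p) (coef-cong δ q)
  coef-cong δ (-‿cong p) = K.-‿cong (coef-cong δ p)
  coef-cong δ (⊛-cong e p) = K.*-cong e (coef-cong δ p)
  coef-cong δ (+-assoc u v w) = K.+-assoc _ _ _
  coef-cong δ (+-comm u v) = K.+-comm _ _
  coef-cong δ (+-identityˡ u) = K.+-identityˡ _
  coef-cong δ (-‿inverseˡ u) = K.-‿inverseˡ _
  coef-cong δ (⊛-distribˡ a u v) = K.distribˡ _ _ _
  coef-cong δ (⊛-distribʳ a b u) = K.distribʳ _ _ _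
  coef-cong δ (⊛-assoc a b u) = K.*-assoc _ _ _
  coef-cong δ (⊛-identity u) = K.*-identityˡ _

  -- Vectors are formal expressions up to `_≈_`; with one field per operation, functionals are
  -- compared by recursion on the expression.
  record Functional (F : Carrier → K.Carrier) : Set (c ⊔ ℓk) where
    field
      0-homo   : F 0ᶠ K.≈ K.0#
      +-homo   : ∀ u v → F (u + v) K.≈ F u K.+ F v
      neg-homo : ∀ u → F (- u) K.≈ K.- F u
      ⊛-homo   : ∀ a u → F (a ⊛ u) K.≈ a K.* F u

  functional-ext : ∀ {F G} → Functional F → Functional G →
                   (∀ x → F ⟨ x ⟩ K.≈ G ⟨ x ⟩) → ∀ u → F u K.≈ G u
  functional-ext {F} {G} LF LG h = go
    where
    module F = Functional LF
    module G = Functional LG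
    go : ∀ u → F u K.≈ G u
    go ⟨ x ⟩ = h x
    go 0ᶠ = K.trans F.0-homo (K.sym G.0-homo)
    go (u + v) = K.trans (F.+-homo u v) (K.trans (K.+-cong (go u) (go v)) (K.sym (G.+-homo u v)))
    go (- u) = K.trans (F.neg-homo u) (K.trans (K.-‿cong (go u)) (K.sym (G.neg-homo u)))
    go (a ⊛ u) = K.trans (F.⊛-homo a u) (K.trans (K.*-congˡ (go u)) (K.sym (G.⊛-homo a u)))

  zero-functional : Functional (λ _ → K.0#)
  zero-functional = record
    { 0-homo = K.refl ; +-homo = λ _ _ → K.sym (K.+-identityˡ _)
    ; neg-homo = λ _ → K.sym -0#≈0# ; ⊛-homo = λ a _ → K.sym (K.zeroʳ a) }

  coef-functional : ∀ δ → Functional (coef δ)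
  coef-functional δ = record
    { 0-homo = K.refl ; +-homo = λ _ _ → K.refl ; neg-homo = λ _ → K.refl ; ⊛-homo = λ _ _ → K.refl }

  coef-T-functional : ∀ δ i → Functional (λ u → coef δ (T i u))
  coef-T-functional δ i = record
    { 0-homo = K.refl ; +-homo = λ _ _ → K.refl ; neg-homo = λ _ → K.refl ; ⊛-homo = λ _ _ → K.refl }

  +-functional : ∀ {F G} → Functional F → Functional G → Functional (λ u → F u K.+ G u)
  +-functional {F} {G} LF LG = record
    { 0-homo = K.trans (K.+-cong F.0-homo G.0-homo) (K.+-identityˡ _)
    ; +-homo = λ u v → K.trans (K.+-cong (F.+-homo u v) (G.+-homo u v)) (interchange _ _ _ _)
    ; neg-homo = λ u → K.trans (K.+-cong (F.neg-homo u) (G.neg-homo u)) (-‿+-comm _ _)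
    ; ⊛-homo = λ a u → K.trans (K.+-cong (F.⊛-homo a u) (G.⊛-homo a u)) (K.sym (K.distribˡ _ _ _)) }
    where
    module F = Functional LF
    module G = Functional LG

  coef-outside : ∀ {δ} → ¬ (δ ∈[ σ , ρ ]) → ∀ u → coef δ u K.≈ K.0#
  coef-outside {δ} ∉ = functional-ext (coef-functional δ) zero-functional λ (x , x∈) →
    bracket-no (x ≟ₚ δ) λ e → ∉ (∈-cong {x} {δ} e x∈)

  ∉DesL-s : ∀ {i} {δ : 𝔖 (suc m)} → i ∈DesL δ → ¬ (i ∈DesL s i · δ)
  ∉DesL-s {i} {δ} d = pos⇒∉DesL {i} {s i · δ}
    (≡.subst₂ Fin._<_ (≡.sym (pos₀-s δ i)) (≡.sym (pos₁-s δ i)) (∈DesL⇒pos {i} {δ} d))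

  flip-s : ∀ i {x δ : 𝔖 (suc m)} → s i · x ≈ₚ δ → x ≈ₚ s i · δ
  flip-s i {x} e j = ≡.trans (≡.sym (s·s i x j)) (≡.cong (s i ⟨$⟩ʳ_) (e j))

  flip-s⁻ : ∀ i {x δ : 𝔖 (suc m)} → x ≈ₚ s i · δ → s i · x ≈ₚ δ
  flip-s⁻ i {δ = δ} e j = ≡.trans (≡.cong (s i ⟨$⟩ʳ_) (e j)) (s·s i δ j)

  -- Each basis vector occurring in `T i u` has i as a left descent: `T i` negates such a vector,
  -- moves up to one, or gives zero.
  coef-T-ascent : ∀ {i δ} → ¬ (i ∈DesL δ) → ∀ u → coef δ (T i u) K.≈ K.0#
  coef-T-ascent {i} {δ} n = functional-ext (coef-T-functional δ i) zero-functional λ x →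
    on-basis x (i ∈DesL? proj₁ x) (s i · proj₁ x ∈[ σ , ρ ]?)
    where
    on-basis : ∀ x d e → coef δ (actDec i x d e) K.≈ K.0#
    on-basis (x , _) (yes d) _ =
      K.trans (K.-‿cong (bracket-no (x ≟ₚ δ) λ e → n (∈DesL-cong {i} {x} {δ} e d))) -0#≈0#
    on-basis x (no _) (no _) = K.refl
    on-basis (x , _) (no n′) (yes _) = bracket-no (s i · x ≟ₚ δ) λ e →
      n (⋖⇒∈DesL {i} {x} {δ} n′ (≈ₚ-sym {s i · x} {δ} e))

  -- Two basis vectors contribute at `δ`: `δ` itself with factor -1, cancelled by the added
  -- `coef δ u`, and `s i · δ`, which `T i` sends to `δ`.
  coef-T-descent : ∀ {i δ} → i ∈DesL δ → δ ∈[ σ , ρ ] → ∀ u →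
                   coef δ (T i u) K.+ coef δ u K.≈ coef (s i · δ) u
  coef-T-descent {i} {δ} d δ∈ = functional-ext
    (+-functional (coef-T-functional δ i) (coef-functional δ)) (coef-functional (s i · δ)) λ x →
    on-basis x (i ∈DesL? proj₁ x) (s i · proj₁ x ∈[ σ , ρ ]?)
    where
    apart : ∀ {x} → ¬ (i ∈DesL x) → ¬ (x ≈ₚ δ)
    apart {x} n e = n (∈DesL-cong {i} {δ} {x} (≈ₚ-sym {x} {δ} e) d)
    on-basis : ∀ x d e → coef δ (actDec i x d e) K.+ coef δ ⟨ x ⟩ K.≈ coef (s i · δ) ⟨ x ⟩
    on-basis (x , _) (yes d′) _ = K.trans (K.-‿inverseˡ _) (K.sym (bracket-no (x ≟ₚ s i · δ) λ e →
      ∉DesL-s {i} {δ} d (∈DesL-cong {i} {x} {s i · δ} e d′)))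
    on-basis (x , _) (no n) (no ∉) = K.trans (K.+-identityˡ _) (K.trans (bracket-no (x ≟ₚ δ) (apart {x} n))
      (K.sym (bracket-no (x ≟ₚ s i · δ) λ e →
        ∉ (∈-cong {δ} {s i · x} (≈ₚ-sym {s i · x} {δ} (flip-s⁻ i {x} {δ} e)) δ∈))))
    on-basis (x , _) (no n) (yes _) = K.trans (K.+-congˡ (bracket-no (x ≟ₚ δ) (apart {x} n)))
      (K.trans (K.+-identityʳ _)
        (bracket-cong (s i · x ≟ₚ δ) (x ≟ₚ s i · δ) (flip-s i {x} {δ}) (flip-s⁻ i {x} {δ})))

  eraseDec : ∀ {x} {P : Set} → Dec P → x ∈[ σ , ρ ] → Carrier
  eraseDec (yes _) _ = 0ᶠ
  eraseDec {x} (no _) x∈ = ⟨ x , x∈ ⟩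

  eraseDec-cong : ∀ {x y} {P Q : Set} (d : Dec P) (e : Dec Q) (x∈ : x ∈[ σ , ρ ]) (y∈ : y ∈[ σ , ρ ]) →
                  (P → Q) → (Q → P) → x ≈ₚ y → eraseDec d x∈ ≈ eraseDec e y∈
  eraseDec-cong (yes _) (yes _) _ _ _ _ _ = refl
  eraseDec-cong (yes p) (no n) _ _ f _ _ = ⊥-elim (n (f p))
  eraseDec-cong (no n) (yes q) _ _ _ g _ = ⊥-elim (n (g q))
  eraseDec-cong (no _) (no _) _ _ _ _ e = ⟨⟩-cong e

  erase : 𝔖 (suc m) → Carrier → Carrier
  erase γ = extend λ (x , x∈) → eraseDec (x ≟ₚ γ) x∈

  erase-linear : ∀ γ → Linear (erase γ)
  erase-linear γ = extend-linear λ { {x , x∈} {y , y∈} e → eraseDec-cong (x ≟ₚ γ) (y ≟ₚ γ) x∈ y∈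
    (λ f i → ≡.trans (≡.sym (e i)) (f i)) (λ f i → ≡.trans (e i) (f i)) e }

  -- The zero test works one basis vector at a time: if the coefficient at γ vanishes, then
  -- u ≈ erase γ u.
  erase-split : ∀ γ u → u ≈ coef γ u ⊛ ⟦ γ ⟧ + erase γ u
  erase-split γ = linear-ext id-linear (+-linear coef-linear (erase-linear γ)) λ (x , x∈) → on-basis x x∈ (x ≟ₚ γ)
    where
    id-linear : Linear (λ u → u)
    id-linear = record { F-cong = λ e → e ; F-+ = λ _ _ → refl ; F-⊛ = λ _ _ → refl }
    coef-linear : Linear (λ u → coef γ u ⊛ ⟦ γ ⟧)
    coef-linear = record
      { F-cong = λ e → ⊛-cong (coef-cong γ e) refl
      ; F-+ = λ u v → ⊛-distribʳ _ _ _
      ; F-⊛ = λ a u → ⊛-assoc _ _ _ }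
    on-basis : ∀ x x∈ (d : Dec (x ≈ₚ γ)) → ⟨ x , x∈ ⟩ ≈ bracket d ⊛ ⟦ γ ⟧ + eraseDec d x∈
    on-basis x x∈ (yes e) = trans (⟨⟩≈⟦⟧ (x , x∈)) (trans (⟦⟧-cong {x} {γ} e)
      (sym (trans (+-identityʳ _) (⊛-identity _))))
    on-basis x x∈ (no _) = sym (trans (+-cong (⊛-zeroˡ _) refl) (+-identityˡ _))

  eraseAll : List (𝔖 (suc m)) → Carrier → Carrier
  eraseAll []       u = u
  eraseAll (γ ∷ γs) u = eraseAll γs (erase γ u)

  eraseAll-linear : ∀ γs → Linear (eraseAll γs)
  eraseAll-linear [] = record { F-cong = λ e → e ; F-+ = λ _ _ → refl ; F-⊛ = λ _ _ → refl }
  eraseAll-linear (γ ∷ γs) = ∘-linear (eraseAll-linear γs) (erase-linear γ)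

  eraseAll-fixed : ∀ γs u → (∀ δ → coef δ u K.≈ K.0#) → u ≈ eraseAll γs u
  eraseAll-fixed [] u _ = refl
  eraseAll-fixed (γ ∷ γs) u zeros = trans fixed (eraseAll-fixed γs (erase γ u)
    λ δ → K.trans (K.sym (coef-cong δ fixed)) (zeros δ))
    where
    fixed : u ≈ erase γ u
    fixed = trans (erase-split γ u)
      (trans (+-cong (trans (⊛-cong (zeros γ) refl) (⊛-zeroˡ _)) refl) (+-identityˡ _))

  eraseAll-basis : ∀ γs x (x∈ : x ∈[ σ , ρ ]) → Any (_≈ₚ x) γs → eraseAll γs ⟨ x , x∈ ⟩ ≈ 0ᶠ
  eraseAll-basis (γ ∷ γs) x x∈ any = cases (x ≟ₚ γ) any
    where
    cases : ∀ (d : Dec (x ≈ₚ γ)) → Any (_≈ₚ x) (γ ∷ γs) → eraseAll γs (eraseDec d x∈) ≈ 0ᶠ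
    cases (yes _) _ = F-0 (eraseAll-linear γs)
    cases (no n) (here e) = ⊥-elim (n (≈ₚ-sym {γ} {x} e))
    cases (no n) (there a) = eraseAll-basis γs x x∈ a

  -- Vanishing coefficients let `u` pass every erasure unchanged, while erasing all permutations
  -- kills each basis vector.
  coef-zero : ∀ u → (∀ δ → coef δ u K.≈ K.0#) → u ≈ 0ᶠ
  coef-zero u zeros = trans (eraseAll-fixed all u zeros)
    (linear-ext (eraseAll-linear all) constant (λ (x , x∈) → eraseAll-basis all x x∈ (permutations-complete x)) u)
    where
    all = permutations (suc m)
    constant : Linear (λ _ → 0ᶠ)
    constant = record { F-cong = λ _ → refl ; F-+ = λ _ _ → sym (+-identityˡ _) ; F-⊛ = λ a _ → sym (F-0 (⊛-linear a)) }

-- The socle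

-- With `A` the vanishing of a coefficient, this lets an argument over all indices stop early
-- without deciding whether the coefficient vanishes.
∀-⊎ : ∀ {n} {a b : Level} {A : Set a} {B : Fin n → Set b} → (∀ i → A ⊎ B i) → A ⊎ (∀ i → B i)
∀-⊎ {zero} f = inj₂ λ ()
∀-⊎ {suc n} f with f zero | ∀-⊎ (f ∘ suc)
... | inj₁ a | _ = inj₁ a
... | inj₂ _ | inj₁ a = inj₁ a
... | inj₂ b | inj₂ bs = inj₂ λ { zero → b ; (suc i) → bs i }

module Socle {c ℓk : Level} (K : CommutativeRing c ℓk) {m : ℕ} (S : Subset m) (w : 𝔖 (suc m)) (w-DesR⊆ : DesR⊆ S w)
             (w-longest : ∀ z → DesR⊆ S z → ℓ z ℕ.≤ ℓ w)
             (σ : 𝔖 (suc m)) (σ-cutting : LongestElement.Cutting S w w-DesR⊆ w-longest σ) (σ≼w : σ ≼ w) where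
  private module K = CommutativeRing K
  open import Algebra.Properties.Ring K.ring using (-0#≈0#; -‿involutive)
  open FreeModule K [ σ , w ]ᴸ
  open import Algebra.Properties.Group (AbelianGroup.group +-abelianGroup) using (x∙y⁻¹≈ε⇒x≈y; inverseˡ-unique)
  open Linear
  open WeakBruhatModule K σ w
  open WeakOrder {m}
  open Coefficients K σ w
  open LongestElement S w w-DesR⊆ w-longest

  ≼-trans : ∀ {γ δ τ : 𝔖 (suc m)} → γ ≼ δ → δ ≼ τ → γ ≼ τ
  ≼-trans {γ} {δ} {τ} p (≈⇒≼ e) = ≼-respʳ {γ} {δ} {τ} e p
  ≼-trans p (q ▻ c) = ≼-trans p q ▻ c

  ℓ-mono : ∀ {γ τ : 𝔖 (suc m)} → γ ≼ τ → ℓ γ ℕ.≤ ℓ τ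
  ℓ-mono {γ} {τ} (≈⇒≼ e) = ℕₚ.≤-reflexive (ℓ-cong {γ} {τ} e)
  ℓ-mono {τ = υ} (_▻_ {τ} p (i , n , e)) = ℕₚ.≤-trans (ℓ-mono p) (ℕₚ.<⇒≤
    (≡.subst (ℕ._< ℓ υ) (ℓ-cong {s i · υ} {τ} (λ x → ≡.sym (flip-s i {τ} {υ} (≈ₚ-sym {υ} {s i · τ} e) x)))
      (⋖⇒∈DesL {i} {τ} {υ} n e)))

  top : ∃ (_∈[ σ , w ])
  top = w , σ≼w , ≈⇒≼ (λ _ → ≡.refl)

  coef-congˡ : ∀ {γ δ} → γ ≈ₚ δ → ∀ u → coef γ u K.≈ coef δ u
  coef-congˡ {γ} {δ} e = functional-ext (coef-functional γ) (coef-functional δ) λ (x , _) →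
    bracket-cong (x ≟ₚ γ) (x ≟ₚ δ) (λ f i → ≡.trans (f i) (e i)) (λ f i → ≡.trans (f i) (≡.sym (e i)))

  neg-zero : ∀ {a} → K.- a K.≈ K.0# → a K.≈ K.0#
  neg-zero {a} e = K.trans (K.sym (-‿involutive a)) (K.trans (K.-‿cong e) -0#≈0#)

  cancelˡ : ∀ {a b} → a K.≈ K.0# → a K.+ b K.≈ K.0# → b K.≈ K.0#
  cancelˡ {a} {b} p q = K.trans (K.sym (K.+-identityˡ b)) (K.trans (K.+-congʳ (K.sym p)) q)

  cancelʳ : ∀ {a b} → b K.≈ K.0# → a K.+ b K.≈ K.0# → a K.≈ K.0#
  cancelʳ {a} {b} p q = cancelˡ p (K.trans (K.+-comm b a) q)

  -- Simultaneous eigenvectors, zero included; the values -1 and 0 come from the quadratic relation.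
  Eigen : Carrier → Set _
  Eigen v = ∀ i → T i v ≈ - v ⊎ T i v ≈ 0ᶠ

  coef-T≈- : ∀ {i δ} v → T i v ≈ - v → ¬ (i ∈DesL δ) → coef δ v K.≈ K.0#
  coef-T≈- {i} {δ} v e n = neg-zero (K.trans (K.sym (coef-cong δ e)) (coef-T-ascent {i} {δ} n v))

  coef-T≈0 : ∀ {i δ} v → T i v ≈ 0ᶠ → i ∈DesL δ → δ ∈[ σ , w ] → coef δ v K.≈ coef (s i · δ) v
  coef-T≈0 {i} {δ} v e d δ∈ = K.trans (K.sym (K.trans (K.+-congʳ (coef-cong δ e)) (K.+-identityˡ _)))
    (coef-T-descent {i} {δ} d δ∈ v)

  -- Coefficients of an eigenvector along a chain

  module EigenCoefficient (v : Carrier) (eigen : Eigen v) (γ : 𝔖 (suc m)) (γ∈ : γ ∈[ σ , w ]) where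

    Agree : Fin m → Set _
    Agree i = (i ∈DesL γ × T i v ≈ - v) ⊎ (¬ (i ∈DesL γ) × T i v ≈ 0ᶠ)

    -- Where the descents of `γ` and the eigenvalues of `v` disagree, the coefficient vanishes:
    -- directly for eigenvalue -1, through the shorter `s i · γ` for eigenvalue 0.
    agree : (∀ i → i ∈DesL γ → coef (s i · γ) v K.≈ K.0#) → ∀ i → coef γ v K.≈ K.0# ⊎ Agree i
    agree below i with i ∈DesL? γ | eigen i
    ... | yes d | inj₁ e = inj₂ (inj₁ (d , e))
    ... | no n  | inj₂ e = inj₂ (inj₂ (n , e))
    ... | yes d | inj₂ e = inj₁ (K.trans (coef-T≈0 {i} {γ} v e d γ∈) (below i d))
    ... | no n  | inj₁ e = inj₁ (coef-T≈- {i} {γ} v e n)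

    module _ (agreeing : ∀ i → Agree i) where

      -- The last component remembers whether the chain has moved; if so, its last step supplies a
      -- left descent of `τ` that `γ` lacks.
      Along : 𝔖 (suc m) → Set _
      Along τ = coef γ v K.≈ coef τ v × Track γ τ × (γ ≈ₚ τ ⊎ ∃ λ i → i ∈DesL τ × ¬ (i ∈DesL γ))

      along : ∀ {τ} → γ ≼ τ → τ ≼ w → coef γ v K.≈ K.0# ⊎ Along τ
      along {τ} (≈⇒≼ e) _ = inj₂ (coef-congˡ {γ} {τ} e v , track-refl {γ} {τ} e , inj₁ e)
      along {υ} (_▻_ {τ} p (i , n , e)) υ≼w = [ inj₁ , step (agreeing i) ]′ (along p (≼-cons (i , n , e) υ≼w))
        where
        i∈υ : i ∈DesL υ
        i∈υ = ⋖⇒∈DesL {i} {τ} {υ} n e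
        step : Agree i → Along τ → coef γ v K.≈ K.0# ⊎ Along υ
        -- Here i is no left descent of `τ` although its eigenvalue is -1, so the coefficient
        -- carried along the chain is zero.
        step (inj₁ (_ , T≈-)) (same , _) = inj₁ (K.trans same (coef-T≈- {i} {τ} v T≈- n))
        step (inj₂ (n′ , T≈0)) (same , track , _) = inj₂
          ( K.trans same (K.trans (coef-congˡ {τ} {s i · υ} (flip-s i {τ} {υ} (≈ₚ-sym {υ} {s i · τ} e)) v)
              (K.sym (coef-T≈0 {i} {υ} v T≈0 i∈υ (≼-trans (proj₁ γ∈) (p ▻ (i , n , e)) , υ≼w))))
          , track-step {γ} {τ} {υ} {i} track n′ e
          , inj₂ (i , i∈υ , n′) )

      -- Eigenvalue -1 at a non-descent of `w` kills the coefficient at `w`, and with it the one at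
      -- `γ`.
      descents-in-w : coef γ v K.≈ coef w v → ∀ j → coef γ v K.≈ K.0# ⊎ (j ∈DesL γ → j ∈DesL w)
      descents-in-w same j with j ∈DesL? w | agreeing j
      ... | yes d | _ = inj₂ λ _ → d
      ... | no n | inj₁ (_ , T≈-) = inj₁ (K.trans same (coef-T≈- {j} {w} v T≈- n))
      ... | no n | inj₂ (n′ , _) = inj₂ λ d → ⊥-elim (n′ d)

      agreeing-zero : ¬ (γ ≈ₚ w) → coef γ v K.≈ K.0#
      agreeing-zero γ≉w = [ id , at-top ]′ (along (proj₂ γ∈) (≈⇒≼ λ _ → ≡.refl))
        where
        at-top : Along w → coef γ v K.≈ K.0#
        at-top (_ , _ , inj₁ e) = ⊥-elim (γ≉w e)
        at-top (same , track , inj₂ (i , i∈w , i∉γ)) = [ id , (λ ⊆w → ⊥-elim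
          (i∉γ (track-descent {γ} (cutting-up (proj₁ γ∈) σ-cutting) ⊆w track i∈w))) ]′ (∀-⊎ (descents-in-w same))

  eigen-coef : ∀ {v} → Eigen v → ∀ k γ → ℓ γ ℕ.< k → ¬ (γ ≈ₚ w) → coef γ v K.≈ K.0#
  eigen-coef {v} eigen (suc k) γ (ℕ.s≤s ℓγ≤k) γ≉w = cases (γ ∈[ σ , w ]?)
    where
    cases : Dec (γ ∈[ σ , w ]) → coef γ v K.≈ K.0#
    cases (no γ∉) = coef-outside {γ} γ∉ v
    cases (yes γ∈) = [ id , (λ ag → agreeing-zero ag γ≉w) ]′ (∀-⊎ (agree below))
      where
      open EigenCoefficient v eigen γ γ∈
      below : ∀ i → i ∈DesL γ → coef (s i · γ) v K.≈ K.0#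
      -- `s i · γ` is shorter than `γ`, which lies below `w`; hence it is not `w`.
      below i d = eigen-coef eigen k (s i · γ) (ℕₚ.≤-trans d ℓγ≤k) λ e →
        ℕₚ.<⇒≱ d (≡.subst (ℓ γ ℕ.≤_) (≡.sym (ℓ-cong {s i · γ} {w} e)) (ℓ-mono (proj₂ γ∈)))

  socle : ∀ {v} → Eigen v → v ≈ coef w v ⊛ ⟨ top ⟩
  socle {v} eigen = x∙y⁻¹≈ε⇒x≈y v _ (coef-zero (v + - (coef w v ⊛ ⟨ top ⟩)) λ δ → cases δ (w ≟ₚ δ))
    where
    cases : ∀ δ (d : Dec (w ≈ₚ δ)) → coef δ v K.+ K.- (coef w v K.* bracket d) K.≈ K.0#
    cases δ (yes e) = K.trans (K.+-cong (K.sym (coef-congˡ {w} {δ} e v)) (K.-‿cong (K.*-identityʳ _))) (K.-‿inverseʳ _)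
    cases δ (no n) = K.trans (K.+-cong (eigen-coef eigen (suc (ℓ δ)) δ ℕₚ.≤-refl λ e → n (≈ₚ-sym {δ} {w} e))
      (K.trans (K.-‿cong (K.zeroʳ _)) -0#≈0#)) (K.+-identityˡ _)

  -- Endomorphisms that vanish on the socle

  module KillsTop (E : Carrier → Carrier) (E-linear : Linear E) (E-T : ∀ i u → E (T i u) ≈ T i (E u))
                  (E-top : E ⟨ top ⟩ ≈ 0ᶠ) where

    Fixed : Carrier → Set _
    Fixed v = E v ≈ v

    -- Support in lengths above `ℓ w` minus d, written without truncated subtraction; a smaller d is
    -- the stronger condition.
    Low : ℕ → Carrier → Set _
    Low d v = ∀ δ → ℓ δ ℕ.+ d ℕ.≤ ℓ w → coef δ v K.≈ K.0#

    fixed-T : ∀ i {u} → Fixed u → Fixed (T i u)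
    fixed-T i {u} fx = trans (E-T i u) (F-cong (T-linear i) fx)

    fixed-+ : ∀ {u v} → Fixed u → Fixed v → Fixed (u + v)
    fixed-+ {u} {v} p q = trans (F-+ E-linear u v) (+-cong p q)

    fixed-neg : ∀ {u} → Fixed u → Fixed (- u)
    fixed-neg {u} p = trans (F-neg E-linear u) (-‿cong p)

    -- On the graded piece of lowest length every T i is diagonal, so that the projections Q
    -- cut out the part of v with the same left descents as γ; it is an eigenvector because
    -- the next piece is already known to vanish.
    module Step (d : ℕ) (next : ∀ v → Fixed v → Low d v → v ≈ 0ᶠ)
                (v : Carrier) (v-fixed : Fixed v) (v-low : Low (suc d) v)
                (γ : 𝔖 (suc m)) (γ-lead : ℓ γ ℕ.+ d ℕ.≤ ℓ w) where

      -- The term at `s i · δ` in `coef-T-descent` has smaller length, where `Low (suc d)` makes it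
      -- vanish.
      T-descent : ∀ {i u δ} → Low (suc d) u → ℓ δ ℕ.+ d ℕ.≤ ℓ w → i ∈DesL δ → coef δ (T i u) K.+ coef δ u K.≈ K.0#
      T-descent {i} {u} {δ} low le i∈ = cases (δ ∈[ σ , w ]?)
        where
        cases : Dec (δ ∈[ σ , w ]) → coef δ (T i u) K.+ coef δ u K.≈ K.0#
        cases (no δ∉) = K.trans (K.+-cong (coef-outside {δ} δ∉ (T i u)) (coef-outside {δ} δ∉ u)) (K.+-identityˡ _)
        cases (yes δ∈) = K.trans (coef-T-descent {i} {δ} i∈ δ∈ u) (low (s i · δ)
          (ℕₚ.≤-trans (ℕₚ.≤-reflexive (ℕₚ.+-suc _ d)) (ℕₚ.≤-trans (ℕₚ.+-monoˡ-≤ d i∈) le)))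

      T-zero : ∀ {i u δ} → Low (suc d) u → ℓ δ ℕ.+ d ℕ.≤ ℓ w → coef δ u K.≈ K.0# → coef δ (T i u) K.≈ K.0#
      T-zero {i} {u} {δ} low le z = cases (i ∈DesL? δ)
        where
        cases : Dec (i ∈DesL δ) → coef δ (T i u) K.≈ K.0#
        cases (yes i∈) = cancelʳ z (T-descent {i} {u} {δ} low le i∈)
        cases (no i∉) = coef-T-ascent {i} {δ} i∉ u

      weaken : ∀ (δ : 𝔖 (suc m)) → ℓ δ ℕ.+ suc d ℕ.≤ ℓ w → ℓ δ ℕ.+ d ℕ.≤ ℓ w
      weaken δ le = ℕₚ.≤-trans (ℕₚ.+-monoʳ-≤ (ℓ δ) (ℕₚ.n≤1+n d)) le

      Q : ∀ i → Dec (i ∈DesL γ) → Carrier → Carrier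
      Q i (yes _) u = - T i u
      Q i (no _)  u = T i u + u

      Q-fixed : ∀ i j {u} → Fixed u → Fixed (Q i j u)
      Q-fixed i (yes _) fx = fixed-neg (fixed-T i fx)
      Q-fixed i (no _) fx = fixed-+ (fixed-T i fx) fx

      Q-zero : ∀ i j {u} δ → Low (suc d) u → ℓ δ ℕ.+ d ℕ.≤ ℓ w → coef δ u K.≈ K.0# → coef δ (Q i j u) K.≈ K.0#
      Q-zero i (yes _) {u} δ low le z = K.trans (K.-‿cong (T-zero {i} {u} {δ} low le z)) -0#≈0#
      Q-zero i (no _) {u} δ low le z = K.trans (K.+-cong (T-zero {i} {u} {δ} low le z) z) (K.+-identityˡ _)

      Q-low : ∀ i j {u} → Low (suc d) u → Low (suc d) (Q i j u)
      Q-low i j {u} low δ le = Q-zero i j {u} δ low (weaken δ le) (low δ le)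

      Q-same : ∀ i j {u} → Low (suc d) u → coef γ (Q i j u) K.≈ coef γ u
      Q-same i (yes i∈) {u} low = K.trans (K.-‿cong (K.trans (K.sym (K.trans (K.+-congˡ (K.-‿inverseʳ _)) (K.+-identityʳ _)))
        (K.trans (K.sym (K.+-assoc _ _ _)) (K.trans (K.+-congʳ (T-descent {i} {u} {γ} low γ-lead i∈)) (K.+-identityˡ _)))))
        (-‿involutive _)
      Q-same i (no i∉) {u} low = K.trans (K.+-congʳ (coef-T-ascent {i} {γ} i∉ u)) (K.+-identityˡ _)

      Disagree : Fin m → 𝔖 (suc m) → Set
      Disagree i δ = (i ∈DesL γ × ¬ (i ∈DesL δ)) ⊎ (¬ (i ∈DesL γ) × i ∈DesL δ)

      Q-disagree : ∀ i j {u} δ → Low (suc d) u → ℓ δ ℕ.+ d ℕ.≤ ℓ w → Disagree i δ → coef δ (Q i j u) K.≈ K.0#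
      Q-disagree i (yes _) {u} δ low le (inj₁ (_ , i∉)) = K.trans (K.-‿cong (coef-T-ascent {i} {δ} i∉ u)) -0#≈0#
      Q-disagree i (yes i∈) δ low le (inj₂ (i∉ , _)) = ⊥-elim (i∉ i∈)
      Q-disagree i (no i∉) δ low le (inj₁ (i∈ , _)) = ⊥-elim (i∉ i∈)
      Q-disagree i (no _) {u} δ low le (inj₂ (_ , i∈)) = T-descent {i} {u} {δ} low le i∈

      project : List (Fin m) → Carrier
      project []       = v
      project (i ∷ is) = Q i (i ∈DesL? γ) (project is)

      project-fixed : ∀ is → Fixed (project is)
      project-fixed [] = v-fixed
      project-fixed (i ∷ is) = Q-fixed i (i ∈DesL? γ) (project-fixed is)

      project-low : ∀ is → Low (suc d) (project is)
      project-low [] = v-low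
      project-low (i ∷ is) = Q-low i (i ∈DesL? γ) (project-low is)

      project-same : ∀ is → coef γ (project is) K.≈ coef γ v
      project-same [] = K.refl
      project-same (i ∷ is) = K.trans (Q-same i (i ∈DesL? γ) (project-low is)) (project-same is)

      -- Each projection clears the permutations of lowest length that disagree at its index, and
      -- those applied afterwards keep a cleared coefficient zero.
      project-disagree : ∀ {i} is δ → ℓ δ ℕ.+ d ℕ.≤ ℓ w → i ∈ᴸ is → Disagree i δ → coef δ (project is) K.≈ K.0#
      project-disagree (i ∷ is) δ le (here ≡.refl) dis = Q-disagree i (i ∈DesL? γ) δ (project-low is) le dis
      project-disagree (i ∷ is) δ le (there i∈) dis =
        Q-zero i (i ∈DesL? γ) δ (project-low is) le (project-disagree is δ le i∈ dis)

      v′ : Carrier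
      v′ = project (List.allFin m)

      v′-disagree : ∀ i δ → ℓ δ ℕ.+ d ℕ.≤ ℓ w → Disagree i δ → coef δ v′ K.≈ K.0#
      v′-disagree i δ le = project-disagree (List.allFin m) δ le (∈-allFin i)

      v′-fixed : Fixed v′
      v′-fixed = project-fixed (List.allFin m)

      v′-low : Low (suc d) v′
      v′-low = project-low (List.allFin m)

      v′-eigen : Eigen v′
      v′-eigen i = cases (i ∈DesL? γ)
        where
        cases : Dec (i ∈DesL γ) → T i v′ ≈ - v′ ⊎ T i v′ ≈ 0ᶠ
        -- The sum is fixed and vanishes on the lowest piece too: by `T-descent` where i is a
        -- descent, and elsewhere because `v′` has been projected.
        cases (yes i∈) = inj₁ (inverseˡ-unique (T i v′) v′
          (next (T i v′ + v′) (fixed-+ (fixed-T i v′-fixed) v′-fixed) λ δ le → low δ le (i ∈DesL? δ)))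
          where
          low : ∀ δ → ℓ δ ℕ.+ d ℕ.≤ ℓ w → Dec (i ∈DesL δ) → coef δ (T i v′) K.+ coef δ v′ K.≈ K.0#
          low δ le (yes i∈δ) = T-descent {i} {v′} {δ} v′-low le i∈δ
          low δ le (no i∉δ) = K.trans (K.+-cong (coef-T-ascent {i} {δ} i∉δ v′)
            (v′-disagree i δ le (inj₁ (i∈ , i∉δ)))) (K.+-identityˡ _)
        cases (no i∉) = inj₂ (next (T i v′) (fixed-T i v′-fixed) λ δ le → low δ le (i ∈DesL? δ))
          where
          low : ∀ δ → ℓ δ ℕ.+ d ℕ.≤ ℓ w → Dec (i ∈DesL δ) → coef δ (T i v′) K.≈ K.0#
          low δ le (yes i∈δ) = T-zero {i} {v′} {δ} v′-low le (v′-disagree i δ le (inj₂ (i∉ , i∈δ)))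
          low δ le (no i∉δ) = coef-T-ascent {i} {δ} i∉δ v′

      -- A fixed eigenvector equals its own image, and it is a multiple of `top`, which `E` kills.
      v′≈0 : v′ ≈ 0ᶠ
      v′≈0 = trans (sym v′-fixed) (trans (F-cong E-linear (socle v′-eigen))
        (trans (F-⊛ E-linear _ _) (trans (⊛-cong K.refl E-top) (F-0 (⊛-linear _)))))

      lead-zero : coef γ v K.≈ K.0#
      lead-zero = K.trans (K.sym (project-same (List.allFin m))) (coef-cong γ v′≈0)

    kill : ∀ d v → Fixed v → Low d v → v ≈ 0ᶠ
    kill zero v _ low = coef-zero v λ δ → cases δ (δ ∈[ σ , w ]?)
      where
      cases : ∀ δ → Dec (δ ∈[ σ , w ]) → coef δ v K.≈ K.0#
      cases δ (yes (_ , δ≼w)) = low δ (≡.subst (ℕ._≤ ℓ w) (≡.sym (ℕₚ.+-identityʳ (ℓ δ))) (ℓ-mono δ≼w))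
      cases δ (no δ∉) = coef-outside {δ} δ∉ v
    -- The induction hypothesis serves twice: inside `Step` it makes `v′` an eigenvector, and once
    -- `lead-zero` has improved the bound on `v` it finishes.
    kill (suc d) v fx low = kill d v fx (Step.lead-zero d (kill d) v fx low)

    fixed-zero : ∀ {v} → Fixed v → v ≈ 0ᶠ
    -- For d = ℓ w + 1 no length satisfies the premise of `Low`.
    fixed-zero {v} fx = kill (suc (ℓ w)) v fx λ δ le → ⊥-elim (ℕₚ.<⇒≱ (ℕₚ.m≤n+m (suc (ℓ w)) (ℓ δ)) le)

-- Idempotents of ℂ

module GaussianIdempotent {c ℓ : Level} (R : CommutativeRing c ℓ) where
  open CommutativeRing R
  open import Algebra.Properties.Ring ring using (+-cancelʳ)
  open import Algebra.Solver.Ring.NaturalCoefficients.Default commutativeSemiring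
    using (solve; _:=_; _:+_; _:*_; con)

  -- If c = x + y i is idempotent and t = 1 - x, then 0 = c (1 - c) and hence c ∣1 - c∣² = 0.
  module _ (x y : Carrier) (re : x * x - y * y ≈ x) (im : x * y + y * x ≈ y) where
    t : Carrier
    t = 1# - x

    t+x≈1 : t + x ≈ 1#
    t+x≈1 = trans (+-assoc _ _ _) (trans (+-congˡ (-‿inverseˡ x)) (+-identityʳ _))

    re₀ : x * t + y * y ≈ 0#
    re₀ = +-cancelʳ (x * x) _ _ (begin
      (x * t + y * y) + x * x      ≈⟨ solve 3 (λ x t y → (x :* t :+ y :* y) :+ x :* x := x :* (t :+ x) :+ y :* y) refl x t y ⟩
      x * (t + x) + y * y          ≈⟨ +-congʳ (trans (*-congˡ t+x≈1) (*-identityʳ x)) ⟩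
      x + y * y                    ≈⟨ +-congʳ re ⟨
      (x * x - y * y) + y * y      ≈⟨ trans (+-assoc _ _ _) (trans (+-congˡ (-‿inverseˡ _)) (+-comm _ _)) ⟩
      0# + x * x                   ∎)
      where open import Relation.Binary.Reasoning.Setoid setoid

    im₀ : y * t ≈ x * y
    im₀ = +-cancelʳ (y * x) _ _ (trans (sym (distribˡ y t x)) (trans (*-congˡ t+x≈1) (trans (*-identityʳ y) (sym im))))

    x-norm : x * (t * t + y * y) ≈ 0#
    x-norm = begin
      x * (t * t + y * y)          ≈⟨ solve 3 (λ x t y → x :* (t :* t :+ y :* y) := t :* (x :* t) :+ y :* (x :* y)) refl x t y ⟩
      t * (x * t) + y * (x * y)    ≈⟨ +-congˡ (*-congˡ im₀) ⟨
      t * (x * t) + y * (y * t)    ≈⟨ solve 3 (λ x t y → t :* (x :* t) :+ y :* (y :* t) := t :* (x :* t :+ y :* y)) refl x t y ⟩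
      t * (x * t + y * y)          ≈⟨ trans (*-congˡ re₀) (zeroʳ t) ⟩
      0#                           ∎
      where open import Relation.Binary.Reasoning.Setoid setoid

    y-norm : y * (t * t + y * y) ≈ 0#
    y-norm = begin
      y * (t * t + y * y)          ≈⟨ solve 2 (λ t y → y :* (t :* t :+ y :* y) := t :* (y :* t) :+ y :* (y :* y)) refl t y ⟩
      t * (y * t) + y * (y * y)    ≈⟨ +-congʳ (*-congˡ im₀) ⟩
      t * (x * y) + y * (y * y)    ≈⟨ solve 3 (λ x t y → t :* (x :* y) :+ y :* (y :* y) := y :* (x :* t :+ y :* y)) refl x t y ⟩
      y * (x * t + y * y)          ≈⟨ trans (*-congˡ re₀) (zeroʳ y) ⟩
      0#                           ∎
      where open import Relation.Binary.Reasoning.Setoid setoid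

module Complement {c ℓ : Level} (R : CommutativeRing c ℓ) where
  open CommutativeRing R
  open import Algebra.Properties.Ring ring using (x[y-z]≈xy-xz; [y-z]x≈yx-zx; -0#≈0#)
  open import Algebra.Properties.Group +-group using (x∙y⁻¹≈ε⇒x≈y)
  open import Relation.Binary.Reasoning.Setoid setoid

  complement-idempotent : ∀ e → e * e ≈ e → (1# - e) * (1# - e) ≈ 1# - e
  complement-idempotent e ee = begin
    (1# - e) * (1# - e)             ≈⟨ x[y-z]≈xy-xz _ _ _ ⟩
    (1# - e) * 1# - (1# - e) * e    ≈⟨ +-cong (*-identityʳ _) (-‿cong vanish) ⟩
    (1# - e) - 0#                   ≈⟨ trans (+-congˡ -0#≈0#) (+-identityʳ _) ⟩
    1# - e                          ∎
    where
    vanish : (1# - e) * e ≈ 0#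
    vanish = trans ([y-z]x≈yx-zx e 1# e) (trans (+-cong (*-identityˡ e) (-‿cong ee)) (-‿inverseʳ e))

  complement-zero : ∀ e → 1# - e ≈ 0# → e ≈ 1#
  complement-zero e p = sym (x∙y⁻¹≈ε⇒x≈y 1# e p)

module ComplexIdempotent where
  open ℝ
  private
    module R = CommutativeRing ℝ-commutativeRing
    module C = CommutativeRing ℂ-commutativeRing
  open Rat using (_+_; _*_; -_; _-_; ∣_∣; _≤_; _<_; positive; nonNegative; nonPositive)
  open Real using (Eventually)
  open Complement ℂ-commutativeRing

  -- An approximation of the real part within ¼, compared with ½, shows that c or 1 - c has real
  -- part eventually at most ¾.
  ¼ ¾ : ℚ
  ¼ = ½ * ½
  ¾ = ½ + ¼

  square≥0 : ∀ y → 0ℚ ≤ y * y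
  square≥0 y with ℚₚ.≤-total 0ℚ y
  ... | inj₁ 0≤y = ℚₚ.nonNegative⁻¹ (y * y) ⦃ ℚₚ.nonNeg*nonNeg⇒nonNeg y ⦃ nonNegative 0≤y ⦄ y ⦃ nonNegative 0≤y ⦄ ⦄
  ... | inj₂ y≤0 = ℚₚ.nonNegative⁻¹ (y * y) ⦃ ℚₚ.nonPos*nonPos⇒nonPos y ⦃ nonPositive y≤0 ⦄ y ⦃ nonPositive y≤0 ⦄ ⦄

  p≤∣p∣ : ∀ p → p ≤ ∣ p ∣
  p≤∣p∣ p with ℚₚ.≤-total 0ℚ p
  ... | inj₁ 0≤p = ℚₚ.≤-reflexive (≡.sym (ℚₚ.0≤p⇒∣p∣≡p 0≤p))
  ... | inj₂ p≤0 = ℚₚ.≤-trans p≤0 (ℚₚ.0≤∣p∣ p)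

  norm-bound : ∀ x y → x ≤ ¾ → ¼ * ¼ ≤ (1ℚ - x) * (1ℚ - x) + y * y
  norm-bound x y x≤¾ = begin
    ¼ * ¼                          ≤⟨ ℚₚ.*-monoʳ-≤-nonNeg ¼ ¼≤t ⟩
    t * ¼                          ≤⟨ ℚₚ.*-monoˡ-≤-nonNeg t ⦃ nonNegative (ℚₚ.≤-trans (ℚₚ.nonNegative⁻¹ ¼) ¼≤t) ⦄ ¼≤t ⟩
    t * t                          ≡⟨ ℚₚ.+-identityʳ (t * t) ⟨
    t * t + 0ℚ                     ≤⟨ ℚₚ.+-monoʳ-≤ (t * t) (square≥0 y) ⟩
    t * t + y * y                  ∎
    where
    open ℚₚ.≤-Reasoning
    t = 1ℚ - x
    ¼≤t : ¼ ≤ t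
    ¼≤t = ℚₚ.+-monoʳ-≤ 1ℚ (ℚₚ.neg-antimono-≤ x≤¾)

  -- A factor bounded below by ε is cancelled without an inverse: precision δ ε for the product
  -- gives precision δ for `x`.
  cancel-apart : ∀ {ε} → 0ℚ < ε → ∀ x r → Eventually (λ n → ε ≤ seq r n) → x R.* r R.≈ R.0# → x R.≈ R.0#
  cancel-apart {ε} 0<ε x r (N , r≥) xr≈0 δ 0<δ =
    let M , close = xr≈0 (δ * ε) (ℚₚ.positive⁻¹ (δ * ε) ⦃ ℚₚ.pos*pos⇒pos δ ⦃ positive 0<δ ⦄ ε ⦃ positive 0<ε ⦄ ⦄)
    in M ℕ.⊔ N , λ n n≥ → ℚₚ.*-cancelʳ-<-nonNeg ε ⦃ nonNegative (ℚₚ.<⇒≤ 0<ε) ⦄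
      (bound n (close n (ℕₚ.m⊔n≤o⇒m≤o M N n≥)) (r≥ n (ℕₚ.m⊔n≤o⇒n≤o M N n≥)))
    where
    bound : ∀ n → ∣ seq x n * seq r n - 0ℚ ∣ < δ * ε → ε ≤ seq r n → ∣ seq x n - 0ℚ ∣ * ε < δ * ε
    bound n close r≥ = begin-strict
      ∣ a - 0ℚ ∣ * ε      ≡⟨ ≡.cong (λ z → ∣ z ∣ * ε) (ℚₚ.+-identityʳ a) ⟩
      ∣ a ∣ * ε           ≤⟨ ℚₚ.*-monoˡ-≤-nonNeg ∣ a ∣ ⦃ ℚₚ.∣-∣-nonNeg a ⦄ (ℚₚ.≤-trans r≥ (p≤∣p∣ b)) ⟩
      ∣ a ∣ * ∣ b ∣       ≡⟨ ℚₚ.∣p*q∣≡∣p∣*∣q∣ a b ⟨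
      ∣ a * b ∣           ≡⟨ ≡.cong ∣_∣ (ℚₚ.+-identityʳ (a * b)) ⟨
      ∣ a * b - 0ℚ ∣      <⟨ close ⟩
      δ * ε               ∎
      where
      open ℚₚ.≤-Reasoning
      a = seq x n
      b = seq r n

  small-idempotent : ∀ c → c C.* c C.≈ c → Eventually (λ n → seq (proj₁ c) n ≤ ¾) → c C.≈ C.0#
  small-idempotent (x , y) (re , im) (N , x≤) =
    cancel-apart 0<ε x r apart (x-norm x y re im) , cancel-apart 0<ε y r apart (y-norm x y re im)
    where
    open GaussianIdempotent ℝ-commutativeRing
    r = (R.1# R.- x) R.* (R.1# R.- x) R.+ y R.* y
    0<ε : 0ℚ < ¼ * ¼
    0<ε = ℚₚ.positive⁻¹ (¼ * ¼)
    apart : Eventually (λ n → ¼ * ¼ ≤ seq r n)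
    apart = N , λ n le → norm-bound (seq x n) (seq y n) (x≤ n le)

  -- Real numbers cannot be compared effectively, but comparing one rational approximation with ½
  -- selects which of c and 1 - c is shown to vanish.
  idempotent : ∀ c → c C.* c C.≈ c → c C.≈ C.0# ⊎ c C.≈ C.1#
  idempotent c@(x , _) cc = cases (isCauchy x ¼ (ℚₚ.positive⁻¹ ¼))
    where
    cases : (∃ λ N → ∀ m n → N ℕ.≤ m → N ℕ.≤ n → ∣ seq x m - seq x n ∣ < ¼) → c C.≈ C.0# ⊎ c C.≈ C.1#
    cases (N , close) with ℚₚ.≤-total (seq x N) ½
    ... | inj₁ q≤½ = inj₁ (small-idempotent c cc (N , λ n le →
      ≡.subst (_≤ ¾) (≡.trans (ℚₚ.+-comm (seq x N) (seq x n - seq x N)) (ℚ-id.sub-add (seq x n) (seq x N)))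
        (ℚₚ.+-mono-≤ q≤½ (ℚₚ.≤-trans (p≤∣p∣ _) (ℚₚ.<⇒≤ (close n N le ℕₚ.≤-refl))))))
    ... | inj₂ ½≤q = inj₂ (complement-zero c (small-idempotent (C.1# C.- c) (complement-idempotent c cc)
      (N , λ n le → ≡.subst (_≤ ¾) (ℚ-id.telescope 1ℚ (seq x N) (seq x n))
        (ℚₚ.+-mono-≤ {1ℚ - seq x N} {½} (ℚₚ.+-monoʳ-≤ 1ℚ (ℚₚ.neg-antimono-≤ ½≤q))
          (ℚₚ.≤-trans (p≤∣p∣ _) (ℚₚ.<⇒≤ (close N n ℕₚ.≤-refl le)))))))

  1≉0 : ¬ (C.1# C.≈ C.0#)
  1≉0 (e , _) with N , f ← e 1ℚ (ℚₚ.positive⁻¹ 1ℚ) = ℚₚ.<-irrefl ≡.refl (f N ℕₚ.≤-refl)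

-- Direct summands

module Projection {r ℓr a ℓa : Level} {R : Ring r ℓr} (M A B : LeftModule R a ℓa) (iso : M ≅ A ⊕ B) where
  private
    module M = LeftModule M
    module A = LeftModule A
    module B = LeftModule B
    f = proj₁ iso
  open Morphism.LeftModuleMorphisms M.rawLeftModule (LeftModule.rawLeftModule (A ⊕ B))
  open IsLeftModuleIsomorphism (proj₂ iso)

  e : M.Carrierᴹ → M.Carrierᴹ
  e u = proj₁ (surjective (proj₁ (f u) , B.0ᴹ))

  f-e : ∀ u → proj₁ (f (e u)) A.≈ᴹ proj₁ (f u) × proj₂ (f (e u)) B.≈ᴹ B.0ᴹ
  f-e u = proj₂ (surjective (proj₁ (f u) , B.0ᴹ)) M.≈ᴹ-refl

  -- As `f` is injective, `e u` is determined by its image, the A-component of `f u` with 0 in B;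
  -- the laws for `e` are thus checked in the direct sum.
  e-unique : ∀ {u v} → proj₁ (f u) A.≈ᴹ proj₁ (f v) → proj₂ (f v) B.≈ᴹ B.0ᴹ → e u M.≈ᴹ v
  e-unique {u} p q = injective (A.≈ᴹ-trans (proj₁ (f-e u)) p , B.≈ᴹ-trans (proj₂ (f-e u)) (B.≈ᴹ-sym q))

  e-cong : ∀ {u v} → u M.≈ᴹ v → e u M.≈ᴹ e v
  e-cong {u} {v} p = e-unique (A.≈ᴹ-trans (proj₁ (⟦⟧-cong p)) (A.≈ᴹ-sym (proj₁ (f-e v)))) (proj₂ (f-e v))

  e-+ : ∀ u v → e (u M.+ᴹ v) M.≈ᴹ e u M.+ᴹ e v
  e-+ u v = e-unique
    (A.≈ᴹ-trans (proj₁ (+ᴹ-homo u v)) (A.≈ᴹ-trans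
      (A.+ᴹ-cong (A.≈ᴹ-sym (proj₁ (f-e u))) (A.≈ᴹ-sym (proj₁ (f-e v)))) (A.≈ᴹ-sym (proj₁ (+ᴹ-homo (e u) (e v))))))
    (B.≈ᴹ-trans (proj₂ (+ᴹ-homo (e u) (e v)))
      (B.≈ᴹ-trans (B.+ᴹ-cong (proj₂ (f-e u)) (proj₂ (f-e v))) (B.+ᴹ-identityˡ _)))

  e-*ₗ : ∀ x u → e (x M.*ₗ u) M.≈ᴹ x M.*ₗ e u
  e-*ₗ x u = e-unique
    (A.≈ᴹ-trans (proj₁ (*ₗ-homo x u)) (A.≈ᴹ-trans
      (A.*ₗ-congˡ (A.≈ᴹ-sym (proj₁ (f-e u)))) (A.≈ᴹ-sym (proj₁ (*ₗ-homo x (e u))))))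
    (B.≈ᴹ-trans (proj₂ (*ₗ-homo x (e u))) (B.≈ᴹ-trans (B.*ₗ-congˡ (proj₂ (f-e u))) (B.*ₗ-zeroʳ x)))

  e-idempotent : ∀ u → e (e u) M.≈ᴹ e u
  e-idempotent u = e-unique A.≈ᴹ-refl (proj₂ (f-e u))

  e≈0⇒A-zero : (∀ u → e u M.≈ᴹ M.0ᴹ) → IsZero A
  e≈0⇒A-zero h x = A.≈ᴹ-trans (A.≈ᴹ-sym (proj₁ (proj₂ preimage M.≈ᴹ-refl)))
    (A.≈ᴹ-trans (A.≈ᴹ-sym (proj₁ (f-e u))) (A.≈ᴹ-trans (proj₁ (⟦⟧-cong (h u))) (proj₁ 0ᴹ-homo)))
    where
    preimage = surjective (x , B.0ᴹ)
    u = proj₁ preimage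

  e≈id⇒B-zero : (∀ u → e u M.≈ᴹ u) → IsZero B
  e≈id⇒B-zero h x = B.≈ᴹ-trans (B.≈ᴹ-sym (proj₂ (proj₂ preimage M.≈ᴹ-refl)))
    (B.≈ᴹ-trans (B.≈ᴹ-sym (proj₂ (⟦⟧-cong (h u)))) (proj₂ (f-e u)))
    where
    preimage = surjective (A.0ᴹ , x)
    u = proj₁ preimage

-- Indecomposability of an interval module ending at w₁(S)

module LowerInterval {c ℓk : Level} (K : CommutativeRing c ℓk)
    (K-idempotent : ∀ a → CommutativeRing._≈_ K (CommutativeRing._*_ K a a) a →
                    CommutativeRing._≈_ K a (CommutativeRing.0# K) ⊎ CommutativeRing._≈_ K a (CommutativeRing.1# K))
    (K-nontrivial : ¬ CommutativeRing._≈_ K (CommutativeRing.1# K) (CommutativeRing.0# K))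
    {m : ℕ} (S : Subset m) (w : 𝔖 (suc m)) (w-DesR⊆ : DesR⊆ S w)
    (w-longest : ∀ z → DesR⊆ S z → ℓ z ℕ.≤ ℓ w)
    (σ : 𝔖 (suc m)) (σ-cutting : LongestElement.Cutting S w w-DesR⊆ w-longest σ) (σ≼w : σ ≼ w) where
  private
    module K = CommutativeRing K
    module H = Hecke K m
  open FreeModule K [ σ , w ]ᴸ
  open Linear
  open WeakBruhatModule K σ w
  open WeakOrder {m}
  open Coefficients K σ w
  open Socle K S w w-DesR⊆ w-longest σ σ-cutting σ≼w
  open import Algebra.Properties.Group (AbelianGroup.group +-abelianGroup) using (x∙y⁻¹≈ε⇒x≈y)

  coef-top : coef w ⟨ top ⟩ K.≈ K.1#
  coef-top = bracket-yes (w ≟ₚ w) λ _ → ≡.refl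

  nonzero : ¬ IsZero leftModule
  nonzero zeros = K-nontrivial (K.trans (K.sym coef-top) (coef-cong w (zeros ⟨ top ⟩)))

  top-eigen : Eigen ⟨ top ⟩
  top-eigen i = cases (i ∈DesL? w) (s i · w ∈[ σ , w ]?)
    where
    cases : ∀ d e → actDec i top d e ≈ - ⟨ top ⟩ ⊎ actDec i top d e ≈ 0ᶠ
    cases (yes _) _ = inj₁ refl
    cases (no _) (no _) = inj₂ refl
    cases (no n) (yes (_ , le)) = ⊥-elim (ℕₚ.<⇒≱
      (≡.subst (ℕ._< ℓ (s i · w)) (ℓ-cong {s i · (s i · w)} {w} (s·s i w)) (⋖⇒∈DesL {i} {w} {s i · w} n λ _ → ≡.refl))
      (ℓ-mono le))

  module _ (A B : LeftModule H.ring _ _) (iso : leftModule ≅ A ⊕ B) where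
    open Projection leftModule A B iso

    e-linear : Linear e
    e-linear = record { F-cong = e-cong ; F-+ = e-+ ; F-⊛ = λ a → e-*ₗ (H.ι a) }

    e-T : ∀ i u → e (T i u) ≈ T i (e u)
    e-T i = e-*ₗ (H.π̄ i)

    e′ : Carrier → Carrier
    e′ u = u + - e u

    e′-linear : Linear e′
    e′-linear = +-linear (record { F-cong = λ p → p ; F-+ = λ _ _ → refl ; F-⊛ = λ _ _ → refl }) (neg-linear e-linear)

    e′-T : ∀ i u → e′ (T i u) ≈ T i (e′ u)
    e′-T i u = sym (trans (F-+ (T-linear i) u (- e u))
      (+-cong refl (trans (F-neg (T-linear i) (e u)) (-‿cong (sym (e-T i u))))))

    e-e′ : ∀ u → e (e′ u) ≈ 0ᶠ
    e-e′ u = trans (F-+ e-linear u (- e u))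
      (trans (+-cong refl (trans (F-neg e-linear (e u)) (-‿cong (e-idempotent u)))) (-‿inverseʳ (e u)))

    e′-fixed : ∀ u → e′ (e′ u) ≈ e′ u
    e′-fixed u = trans (+-cong refl (trans (-‿cong (e-e′ u)) -0≈0)) (+-identityʳ (e′ u))

    a : K.Carrier
    a = coef w (e ⟨ top ⟩)

    -- `e` commutes with the action, so it maps the eigenvector `top` to one with the same
    -- eigenvalues, to which `socle` applies.
    e-top : e ⟨ top ⟩ ≈ a ⊛ ⟨ top ⟩
    e-top = socle λ i → [ (λ p → inj₁ (trans (sym (e-T i ⟨ top ⟩)) (trans (e-cong p) (F-neg e-linear ⟨ top ⟩))))
                        , (λ p → inj₂ (trans (sym (e-T i ⟨ top ⟩)) (trans (e-cong p) (F-0 e-linear)))) ]′ (top-eigen i)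

    a-idempotent : a K.* a K.≈ a
    a-idempotent = K.sym (coef-cong w (trans (sym (e-idempotent ⟨ top ⟩)) (trans (e-cong e-top) (F-⊛ e-linear a ⟨ top ⟩))))

    -- A projection fixes its image, so whichever of `e` and `e′` kills `top` is zero.
    summand-zero : IsZero A ⊎ IsZero B
    summand-zero = [ inj₁ ∘ A-zero , inj₂ ∘ B-zero ]′ (K-idempotent a a-idempotent)
      where
      A-zero : a K.≈ K.0# → IsZero A
      A-zero a≈0 = e≈0⇒A-zero λ u → KillsTop.fixed-zero e e-linear e-T
        (trans e-top (trans (⊛-cong a≈0 refl) (⊛-zeroˡ ⟨ top ⟩))) (e-idempotent u)
      B-zero : a K.≈ K.1# → IsZero B
      B-zero a≈1 = e≈id⇒B-zero λ u → sym (x∙y⁻¹≈ε⇒x≈y u (e u) (KillsTop.fixed-zero e′ e′-linear e′-T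
        (trans (+-cong refl (-‿cong (trans e-top (trans (⊛-cong a≈1 refl) (⊛-identity ⟨ top ⟩))))) (-‿inverseʳ ⟨ top ⟩))
        (e′-fixed u)))

  indecomposable : Indecomposable leftModule
  indecomposable = nonzero , summand-zero

-- The reading word of T″

module ReadingWord where
  open ≡ using (refl; sym; trans; cong; cong₂; subst)
  open Composition

  -- Partial sums after appending a part

  take-++ˡ : ∀ k (xs ys : List ℕ) → k ℕ.≤ length xs → List.take k (xs ++ ys) ≡ List.take k xs
  take-++ˡ zero xs ys _ = refl
  take-++ˡ (suc k) (x ∷ xs) ys (ℕ.s≤s le) = cong (x ∷_) (take-++ˡ k xs ys le)

  sum-take≤ : ∀ k xs → sum (List.take k xs) ℕ.≤ sum xs
  sum-take≤ zero xs = ℕ.z≤n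
  sum-take≤ (suc k) [] = ℕ.z≤n
  sum-take≤ (suc k) (x ∷ xs) = ℕₚ.+-monoʳ-≤ x (sum-take≤ k xs)

  ∈-partialSums⁻ : ∀ as {k} → k ∈ᴸ partialSums as → ∃ λ i → suc i ℕ.< length as × k ≡ sum (List.take (suc i) as)
  ∈-partialSums⁻ as k∈ with i , i∈ , e ← ∈-map⁻ (λ k → sum (List.take (suc k) as)) k∈ =
    i , bound (length as) (∈-upTo⁻ i∈) , e
    where
    bound : ∀ l → i ℕ.< l ℕ.∸ 1 → suc i ℕ.< l
    bound (suc l) lt = ℕ.s≤s lt

  ∈-partialSums⁺ : ∀ as i → suc i ℕ.< length as → sum (List.take (suc i) as) ∈ᴸ partialSums as
  ∈-partialSums⁺ as i lt = ∈-map⁺ (λ k → sum (List.take (suc k) as)) (∈-upTo⁺ (ℕₚ.≤-pred (bound (length as) lt)))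
    where
    bound : ∀ l → suc i ℕ.< l → suc (suc i) ℕ.≤ suc (l ℕ.∸ 1)
    bound (suc l) lt = lt

  partialSums≤ : ∀ as {k} → k ∈ᴸ partialSums as → k ℕ.≤ sum as
  partialSums≤ as k∈ with i , _ , refl ← ∈-partialSums⁻ as k∈ = sum-take≤ (suc i) as

  length-∷ʳ : ∀ (as : List ℕ) a → length (as ++ a ∷ []) ≡ suc (length as)
  length-∷ʳ as a = trans (Listₚ.length-++ as) (ℕₚ.+-comm (length as) 1)

  partialSums-∷ʳ⁻ : ∀ as a {k} → k ∈ᴸ partialSums (as ++ a ∷ []) → k ∈ᴸ partialSums as ⊎ k ≡ sum as
  partialSums-∷ʳ⁻ as a k∈ with i , lt , refl ← ∈-partialSums⁻ (as ++ a ∷ []) k∈ =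
    cases (ℕₚ.m≤n⇒m<n∨m≡n i≤)
    where
    i≤ : suc i ℕ.≤ length as
    i≤ = ℕₚ.≤-pred (subst (suc i ℕ.<_) (length-∷ʳ as a) lt)
    cases : suc i ℕ.< length as ⊎ suc i ≡ length as →
            sum (List.take (suc i) (as ++ a ∷ [])) ∈ᴸ partialSums as ⊎ sum (List.take (suc i) (as ++ a ∷ [])) ≡ sum as
    cases (inj₁ lt) = inj₁ (subst (_∈ᴸ partialSums as) (cong sum (sym (take-++ˡ (suc i) as (a ∷ []) i≤)))
      (∈-partialSums⁺ as i lt))
    cases (inj₂ e) = inj₂ (cong sum (trans (take-++ˡ (suc i) as (a ∷ []) i≤)
      (Listₚ.take-all (suc i) as (ℕₚ.≤-reflexive (sym e)))))

  partialSums-∷ʳ⁺ : ∀ as a {k} → k ∈ᴸ partialSums as → k ∈ᴸ partialSums (as ++ a ∷ [])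
  partialSums-∷ʳ⁺ as a k∈ with i , lt , refl ← ∈-partialSums⁻ as k∈ =
    subst (_∈ᴸ partialSums (as ++ a ∷ [])) (cong sum (take-++ˡ (suc i) as (a ∷ []) (ℕₚ.<⇒≤ lt)))
      (∈-partialSums⁺ (as ++ a ∷ []) i (subst (suc i ℕ.<_) (sym (length-∷ʳ as a)) (ℕₚ.m<n⇒m<1+n lt)))

  -- The old total becomes a partial sum once a part follows. A one-part list has no partial sums,
  -- so the empty list is excluded through its total 0.
  sum∈partialSums-∷ʳ : ∀ as a → sum as ≢ 0 → sum as ∈ᴸ partialSums (as ++ a ∷ [])
  sum∈partialSums-∷ʳ [] a ≢0 = ⊥-elim (≢0 refl)
  sum∈partialSums-∷ʳ as@(_ ∷ as′) a _ =
    subst (_∈ᴸ partialSums (as ++ a ∷ []))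
      (cong sum (trans (take-++ˡ (length as) as (a ∷ []) ℕₚ.≤-refl) (Listₚ.take-all (length as) as ℕₚ.≤-refl)))
      (∈-partialSums⁺ (as ++ a ∷ []) (length as′) (ℕₚ.≤-reflexive (sym (length-∷ʳ as a))))

  -- Bottom row first, as in T″; b bounds the first letters from below.
  data Rows : ℕ → List ℕ → List (List ℕ) → Set where
    []  : ∀ {b} → Rows b [] []
    row : ∀ {b x ys as R} → b ℕ.≤ x → AllPairs ℕ._<_ (x ∷ ys) → Rows (suc x) as R →
          Rows b (suc (length ys) ∷ as) ((x ∷ ys) ∷ R)

  wLT-∷ : ∀ xs R → wLT (xs ∷ R) ≡ wLT R ++ xs
  wLT-∷ xs R = trans (cong List.concat (Listₚ.unfold-reverse xs R))
    (trans (sym (Listₚ.concat-++ (List.reverse R) (xs ∷ []))) (cong (wLT R ++_) (Listₚ.++-identityʳ xs)))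

  rows-≥ : ∀ {b as R} → Rows b as R → All (b ℕ.≤_) (wLT R)
  rows-≥ [] = []
  rows-≥ (row {x = x} {ys} {R = R} b≤x (x< ∷ _) rs) = subst (All _) (sym (wLT-∷ (x ∷ ys) R)) (Allₚ.++⁺
    (All.map (λ x<y → ℕₚ.≤-trans b≤x (ℕₚ.<⇒≤ x<y)) (rows-≥ rs))
    (b≤x ∷ All.map (λ x<y → ℕₚ.≤-trans b≤x (ℕₚ.<⇒≤ x<y)) x<))

  rows-length : ∀ {b as R} → Rows b as R → length (wLT R) ≡ sum (List.reverse as)
  rows-length [] = refl
  rows-length (row {x = x} {ys} {as} {R} _ _ rs) = begin
    length (wLT ((x ∷ ys) ∷ R))                       ≡⟨ cong length (wLT-∷ (x ∷ ys) R) ⟩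
    length (wLT R ++ x ∷ ys)                          ≡⟨ Listₚ.length-++ (wLT R) ⟩
    length (wLT R) ℕ.+ suc (length ys)                ≡⟨ cong₂ ℕ._+_ (rows-length rs) (sym (ℕₚ.+-identityʳ _)) ⟩
    sum (List.reverse as) ℕ.+ (suc (length ys) ℕ.+ 0) ≡⟨ sum-++ (List.reverse as) _ ⟨
    sum (List.reverse as ++ suc (length ys) ∷ [])     ≡⟨ cong sum (Listₚ.unfold-reverse _ as) ⟨
    sum (List.reverse (suc (length ys) ∷ as))         ∎
    where open ≡.≡-Reasoning

  data Split (us vs ys : List ℕ) (a b : ℕ) (zs : List ℕ) : Set where
    left     : ∀ zs′ → us ≡ ys ++ a ∷ b ∷ zs′ → Split us vs ys a b zs
    straddle : us ≡ ys ++ a ∷ [] → vs ≡ b ∷ zs → Split us vs ys a b zs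
    right    : ∀ ys′ → ys ≡ us ++ ys′ → vs ≡ ys′ ++ a ∷ b ∷ zs → Split us vs ys a b zs

  split : ∀ us vs ys a b zs → us ++ vs ≡ ys ++ a ∷ b ∷ zs → Split us vs ys a b zs
  split [] vs ys a b zs e = right ys refl e
  split (u ∷ []) vs [] a b zs refl = straddle refl refl
  split (u ∷ u′ ∷ us) vs [] a b zs refl = left us refl
  split (u ∷ us) vs (y ∷ ys) a b zs e with refl , e′ ← Listₚ.∷-injective e | split us vs ys a b zs e′
  ... | left zs′ p = left zs′ (cong (u ∷_) p)
  ... | straddle p q = straddle (cong (u ∷_) p) q
  ... | right ys′ p q = right ys′ (cong (u ∷_) p) q

  BreaksAt : List ℕ → List ℕ → Set
  BreaksAt ks xs = ∀ ys a b zs → xs ≡ ys ++ a ∷ b ∷ zs →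
    (suc (length ys) ∈ᴸ ks → b ℕ.< a) × (suc (length ys) ∉ᴸ ks → a ℕ.< b)

  increasing-adjacent : ∀ ys {a b zs} → AllPairs ℕ._<_ (ys ++ a ∷ b ∷ zs) → a ℕ.< b
  increasing-adjacent [] ((a<b ∷ _) ∷ _) = a<b
  increasing-adjacent (_ ∷ ys) (_ ∷ ap) = increasing-adjacent ys ap

  -- The bottom row is read last, so its length is appended to the reversed composition. The only
  -- possible new cut is the seam, where the rows above end in a letter larger than the first of
  -- this row.
  rows-breaks : ∀ {b as R} → Rows b as R → BreaksAt (partialSums (List.reverse as)) (wLT R)
  rows-breaks [] [] a b zs ()
  rows-breaks [] (_ ∷ _) a b zs ()
  rows-breaks (row {x = x} {xs} {as} {R} _ inc rs) ys a b zs e =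
    subst (λ bs → (suc (length ys) ∈ᴸ partialSums bs → b ℕ.< a) × (suc (length ys) ∉ᴸ partialSums bs → a ℕ.< b))
      (sym (Listₚ.unfold-reverse (suc (length xs)) as))
      (cases (split (wLT R) (x ∷ xs) ys a b zs (trans (sym (wLT-∷ (x ∷ xs) R)) e)))
    where
    bs = List.reverse as
    k = suc (length xs)
    length-left : ∀ zs → wLT R ≡ ys ++ zs → sum bs ≡ length ys ℕ.+ length zs
    length-left zs p = trans (sym (rows-length rs)) (trans (cong length p) (Listₚ.length-++ ys))
    cases : Split (wLT R) (x ∷ xs) ys a b zs →
      (suc (length ys) ∈ᴸ partialSums (bs ++ k ∷ []) → b ℕ.< a) ×
      (suc (length ys) ∉ᴸ partialSums (bs ++ k ∷ []) → a ℕ.< b)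
    -- Both letters lie above the bottom row, so their position is not the new cut `sum bs`.
    cases (left zs′ p) =
      (λ k∈ → [ proj₁ (rows-breaks rs ys a b zs′ p) , (λ q → ⊥-elim (inner q)) ]′ (partialSums-∷ʳ⁻ bs k k∈)) ,
      (λ k∉ → proj₂ (rows-breaks rs ys a b zs′ p) (k∉ ∘ partialSums-∷ʳ⁺ bs k))
      where
      inner : suc (length ys) ≢ sum bs
      inner q with () ← ℕₚ.+-cancelˡ-≡ (length ys) _ _
        (trans (ℕₚ.+-comm (length ys) 1) (trans q (length-left (a ∷ b ∷ zs′) p)))
    cases (straddle p refl) =
      (λ _ → All.head (Allₚ.++⁻ʳ ys (subst (All _) p (rows-≥ rs)))) ,
      (λ k∉ → ⊥-elim (k∉ (subst (_∈ᴸ partialSums (bs ++ k ∷ [])) sum≡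
        (sum∈partialSums-∷ʳ bs k λ z → ℕₚ.1+n≢0 (trans (sym sum≡) z)))))
      where
      sum≡ : sum bs ≡ suc (length ys)
      sum≡ = trans (length-left (a ∷ []) p) (ℕₚ.+-comm (length ys) 1)
    cases (right ys′ p q) =
      (λ k∈ → ⊥-elim (ℕₚ.<⇒≱ (ℕ.s≤s (ℕₚ.≤-trans (ℕₚ.≤-reflexive (sym (rows-length rs)))
          (ℕₚ.≤-trans (ℕₚ.m≤m+n _ _) (ℕₚ.≤-reflexive (sym (trans (cong length p) (Listₚ.length-++ (wLT R))))))))
        ([ partialSums≤ bs , ℕₚ.≤-reflexive ]′ (partialSums-∷ʳ⁻ bs k k∈)))) ,
      (λ _ → increasing-adjacent ys′ (subst (AllPairs ℕ._<_) q inc))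

  -- `B` will be `2 * height₂ as`, a bound for column 2, so that a piece may follow the first two
  -- boxes of a row.
  Piece : ℕ → ℕ → List ℕ → Set
  Piece B k p = length p ≡ k × AllPairs ℕ._<_ p × All (B ℕ.<_) p

  cut-pieces : ∀ {B} ks xs → sum ks ℕ.≤ length xs → AllPairs ℕ._<_ xs → All (B ℕ.<_) xs →
               Pointwise (Piece B) ks (cut ks xs)
  cut-pieces [] xs _ _ _ = []
  cut-pieces (k ∷ ks) xs le inc B< =
    ( trans (Listₚ.length-take k xs) (ℕₚ.m≤n⇒m⊓n≡m (ℕₚ.≤-trans (ℕₚ.m≤m+n k (sum ks)) le))
    , AllPairsₚ.take⁺ k inc , Allₚ.take⁺ k B<) ∷
    cut-pieces ks (List.drop k xs)
      (subst (sum ks ℕ.≤_) (sym (Listₚ.length-drop k xs)) (ℕₚ.m+n≤o⇒m≤o∸n (sum ks) (subst (ℕ._≤ length xs) (ℕₚ.+-comm k _) le)))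
      (AllPairsₚ.drop⁺ k inc) (Allₚ.drop⁺ k B<)

  -- f and g list the first and the second column.
  zip-rows : ∀ {B} (f g : ℕ → ℕ) → (∀ k → f k ℕ.< g k) → (∀ k → f k ℕ.< f (suc k)) →
    ∀ {b} as {ps} → b ℕ.≤ f 0 → (∀ k → k ℕ.< height₂ as → g k ℕ.≤ B) → All (1 ℕ.≤_) as → PeakParts as →
    Pointwise (Piece B) (List.map (ℕ._∸ 2) as) ps →
    Rows b as (List.zipWith _++_ (firstColumns (List.applyUpTo f (length as)) (List.applyUpTo g (height₂ as))) ps)
  zip-rows f g f<g f< [] _ _ _ _ [] = []
  zip-rows f g f<g f< (zero ∷ []) _ _ (() ∷ _) _ _
  zip-rows f g f<g f< (zero ∷ _ ∷ _) _ _ (() ∷ _) _ _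
  -- Only the top row may be a single box; column 2 does not reach it, and its piece has length 0.
  zip-rows f g f<g f< (suc zero ∷ []) {[] ∷ []} b≤ g≤ _ _ (_ ∷ []) = row b≤ ([] ∷ []) []
  zip-rows f g f<g f< (suc zero ∷ _ ∷ as) _ _ _ peak _ = ⊥-elim (peak zero (ℕ.s≤s (ℕ.s≤s ℕ.z≤n)) refl)
  zip-rows {B} f g f<g f< (suc (suc a) ∷ []) {p ∷ []} b≤ g≤ _ _ ((refl , inc , B<) ∷ []) =
    row b≤ ((f<g 0 ∷ All.map (ℕₚ.<-trans (f<g 0)) g<) ∷ g< ∷ inc) []
    where
    g< : All (g 0 ℕ.<_) p
    g< = All.map (ℕₚ.≤-<-trans (g≤ 0 (ℕ.s≤s ℕ.z≤n))) B<
  zip-rows {B} f g f<g f< (suc (suc a) ∷ as@(_ ∷ _)) {p ∷ ps} b≤ g≤ (_ ∷ pos) peak ((refl , inc , B<) ∷ pieces) =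
    row b≤ ((f<g 0 ∷ All.map (ℕₚ.<-trans (f<g 0)) g<) ∷ g< ∷ inc)
      (zip-rows (f ∘ suc) (g ∘ suc) (f<g ∘ suc) (f< ∘ suc) as (f< 0) (λ k lt → g≤ (suc k) (ℕ.s≤s lt)) pos
        (λ i lt → peak (suc i) (ℕ.s≤s lt)) pieces)
    where
    g< : All (g 0 ℕ.<_) p
    g< = All.map (ℕₚ.≤-<-trans (g≤ 0 (ℕ.s≤s ℕ.z≤n))) B<

  parity : ∀ i → ∃ λ k → suc i ≡ 1 ℕ.+ 2 ℕ.* k ⊎ suc i ≡ 2 ℕ.+ 2 ℕ.* k
  parity zero = 0 , inj₁ refl
  parity (suc i) with parity i
  ... | k , inj₁ e = k , inj₂ (cong suc e)
  ... | k , inj₂ e = suc k , inj₁ (cong suc (trans e (sym (ℕₚ.*-suc 2 k))))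

  module _ {n : ℕ} (α : Composition n) (peak : IsPeak α) where
    open T″-Permutation using (count; columns-unique; columns-within; remaining-↭; height₂≤)

    as used rest ks : List ℕ
    as = parts α
    used = odds (length as) ++ evens (height₂ as)
    rest = remaining n used
    ks = List.reverse (List.map (ℕ._∸ 2) as)

    counted : (length as ℕ.+ height₂ as) ℕ.+ sum (List.map (ℕ._∸ 2) as) ≡ n
    counted = trans (count as (positive α) peak) (total α)

    sum-ks : sum ks ≡ length rest
    sum-ks = ℕₚ.+-cancelˡ-≡ (length as ℕ.+ height₂ as) _ _ (begin
      (length as ℕ.+ height₂ as) ℕ.+ sum ks
        ≡⟨ cong ((length as ℕ.+ height₂ as) ℕ.+_) (sum-↭ (↭-reverse (List.map (ℕ._∸ 2) as))) ⟩
      (length as ℕ.+ height₂ as) ℕ.+ sum (List.map (ℕ._∸ 2) as)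
        ≡⟨ counted ⟩
      n
        ≡⟨ Listₚ.length-applyUpTo suc n ⟨
      length (List.applyUpTo suc n)
        ≡⟨ ↭-length (remaining-↭ n used (columns-unique (length as) (height₂ as))
             (columns-within n as (subst (length as ℕ.+ height₂ as ℕ.≤_) counted (ℕₚ.m≤m+n _ _)))) ⟨
      length (used ++ rest)
        ≡⟨ Listₚ.length-++ used ⟩
      length used ℕ.+ length rest
        ≡⟨ cong (ℕ._+ length rest) (trans (Listₚ.length-++ (odds (length as)))
             (cong₂ ℕ._+_ (Listₚ.length-applyUpTo _ (length as)) (Listₚ.length-applyUpTo _ (height₂ as)))) ⟩
      (length as ℕ.+ height₂ as) ℕ.+ length rest ∎)
      where open ≡.≡-Reasoning

    rest-increasing : AllPairs ℕ._<_ rest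
    rest-increasing = AllPairsₚ.filter⁺ (λ x → ¬? (x ∈ᴸ? used)) (AllPairsₚ.applyUpTo⁺₁ suc n λ i<j _ → ℕ.s≤s i<j)

    -- Every number up to twice the height of column 2 is used: the odd ones in column 1, which is
    -- at least as high, the even ones in column 2.
    rest-large : All (2 ℕ.* height₂ as ℕ.<_) rest
    rest-large = All.tabulate λ x∈ → large (∈-filter⁻ (λ x → ¬? (x ∈ᴸ? used)) {xs = List.applyUpTo suc n} x∈)
      where
      large : ∀ {x} → x ∈ᴸ List.applyUpTo suc n × x ∉ᴸ used → 2 ℕ.* height₂ as ℕ.< x
      large {x} (x∈ , x∉) with i , _ , refl ← ∈-applyUpTo⁻ suc x∈ = ℕₚ.≰⇒> λ le → cases le (parity i)
        where
        half : ∀ k → suc (2 ℕ.* k) ℕ.≤ 2 ℕ.* height₂ as → k ℕ.< height₂ as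
        half k le = ℕₚ.*-cancelˡ-< 2 k (height₂ as) le
        cases : suc i ℕ.≤ 2 ℕ.* height₂ as → (∃ λ k → suc i ≡ 1 ℕ.+ 2 ℕ.* k ⊎ suc i ≡ 2 ℕ.+ 2 ℕ.* k) → ⊥
        cases le (k , inj₁ e) = x∉ (∈-++⁺ˡ (subst (_∈ᴸ odds (length as)) (sym e)
          (∈-applyUpTo⁺ (λ k → 1 ℕ.+ 2 ℕ.* k) {i = k}
            (ℕₚ.<-≤-trans (half k (subst (ℕ._≤ 2 ℕ.* height₂ as) e le)) (height₂≤ as)))))
        cases le (k , inj₂ e) = x∉ (∈-++⁺ʳ (odds (length as)) (subst (_∈ᴸ evens (height₂ as)) (sym e)
          (∈-applyUpTo⁺ (λ k → 2 ℕ.+ 2 ℕ.* k) {i = k} (half k (ℕₚ.<⇒≤ (subst (ℕ._≤ 2 ℕ.* height₂ as) e le))))))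

    T″-rows : Rows 1 as (T″ α)
    T″-rows = zip-rows (λ k → 1 ℕ.+ 2 ℕ.* k) (λ k → 2 ℕ.+ 2 ℕ.* k) (λ k → ℕₚ.≤-refl)
      (λ k → ℕ.s≤s (ℕₚ.*-monoʳ-< 2 ℕₚ.≤-refl)) as ℕₚ.≤-refl
      (λ k lt → subst (ℕ._≤ 2 ℕ.* height₂ as) (ℕₚ.*-suc 2 k) (ℕₚ.*-monoʳ-≤ 2 lt)) (positive α) peak
      -- `T″` cuts along the reversed list of lengths and reverses the pieces again; the two
      -- reversals cancel.
      (subst (λ ks → Pointwise (Piece (2 ℕ.* height₂ as)) ks (List.reverse (cut (List.reverse (List.map (ℕ._∸ 2) as)) rest)))
        (Listₚ.reverse-involutive (List.map (ℕ._∸ 2) as))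
        (Pointwise.reverse⁺ (cut-pieces ks rest (ℕₚ.≤-reflexive sum-ks) rest-increasing rest-large)))

  -- Right descents of the reading word

  tabulate-split : ∀ {m} (f : Fin (suc m) → ℕ) (i : Fin m) → ∃ λ ys → ∃ λ zs →
    length ys ≡ toℕ i × List.tabulate f ≡ ys ++ f (inject₁ i) ∷ f (suc i) ∷ zs
  tabulate-split f zero = [] , _ , refl , refl
  tabulate-split f (suc i) with ys , zs , len , e ← tabulate-split (f ∘ suc) i =
    f zero ∷ ys , zs , cong suc len , cong (f zero ∷_) e

  does-true : {P : Set} (d : Dec P) → does d ≡ true → P
  does-true (yes p) _ = p

  module _ {m : ℕ} (α : Composition (suc m)) where

    ∈set⁻ : ∀ {i} → i ∈ set α → suc (toℕ i) ∈ᴸ partialSums (parts α)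
    ∈set⁻ {i} i∈ = does-true (suc (toℕ i) ∈ᴸ? partialSums (parts α))
      (trans (sym (Vecₚ.lookup∘tabulate _ i)) (Vecₚ.[]=⇒lookup i∈))

    ∈set⁺ : ∀ {i} → suc (toℕ i) ∈ᴸ partialSums (parts α) → i ∈ set α
    ∈set⁺ {i} k∈ = Vecₚ.lookup⇒[]= i (set α)
      (trans (Vecₚ.lookup∘tabulate _ i) (dec-true (suc (toℕ i) ∈ᴸ? partialSums (parts α)) k∈))

  module _ {m : ℕ} (α : Composition (suc m)) (peak : IsPeak α) where

    letters : ∀ i →
      (suc (toℕ i) ∈ᴸ partialSums (parts (α ʳ)) → wLT-T″ α peak ⟨$⟩ʳ suc i Fin.< wLT-T″ α peak ⟨$⟩ʳ inject₁ i) ×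
      (suc (toℕ i) ∉ᴸ partialSums (parts (α ʳ)) → wLT-T″ α peak ⟨$⟩ʳ inject₁ i Fin.< wLT-T″ α peak ⟨$⟩ʳ suc i)
    letters i =
      let ys , zs , len , e = tabulate-split (λ j → suc (toℕ (wLT-T″ α peak ⟨$⟩ʳ j))) i
          down , up = rows-breaks (T″-rows α peak) ys _ _ zs (trans (sym (word-wLT-T″ α peak)) e)
      in (λ k∈ → ℕₚ.≤-pred (down (subst (λ l → suc l ∈ᴸ partialSums (parts (α ʳ))) (sym len) k∈))) ,
         (λ k∉ → ℕₚ.≤-pred (up (subst (λ l → suc l ∉ᴸ partialSums (parts (α ʳ))) (sym len) k∉)))

    wLT-T″-descent : ∀ {i} → i ∈ set (α ʳ) → wLT-T″ α peak ⟨$⟩ʳ suc i Fin.< wLT-T″ α peak ⟨$⟩ʳ inject₁ i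
    wLT-T″-descent {i} i∈ = proj₁ (letters i) (∈set⁻ (α ʳ) i∈)

    wLT-T″-ascent : ∀ i → i ∉ set (α ʳ) → wLT-T″ α peak ⟨$⟩ʳ inject₁ i Fin.< wLT-T″ α peak ⟨$⟩ʳ suc i
    wLT-T″-ascent i i∉ = proj₂ (letters i) (i∉ ∘ ∈set⁺ (α ʳ))

corollary5p25 : ∀ (m : ℕ) (α : Composition (suc m)) (pk : IsPeak α) → Indecomposable (Qʳ α pk)
corollary5p25 m α pk = LowerInterval.indecomposable ℂ-commutativeRing
  ComplexIdempotent.idempotent ComplexIdempotent.1≉0 S (w₁ S) (w₁-DesR⊆ S) (w₁-longest S) (wLT-T″ α pk)
  -- Descents at all of `S` give `Cutting`; ascents outside `S` put the reading word below `w₁ S`.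
  (ReadingWord.wLT-T″-descent α pk)
  (LongestElement.≼w S (w₁ S) (w₁-DesR⊆ S) (w₁-longest S) {wLT-T″ α pk} (ReadingWord.wLT-T″-ascent α pk))
  where
  S = set (α ʳ)
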